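{- For every prime $p$, \[ \{(r,e,d)\in\mathscr{A}(p): r=2 \text{ or } r\nmid p-1\}=\{(r,e,d)\in\mathscr{B}(p): r=2\text{ or } r\nmid p-1\}. \]
   Context: Let $p$ be a prime and $r\ge 2$. Let $x_1,\dots,x_r$ be independent indeterminates over $\mathbb{F}_p$ and $f(x)=(x-x_1)\cdots(x-x_r)=x^r+s_1x^{r-1}+\cdots+s_r\in\mathbb{F}_p[x_1,\dots,x_r][x]$. For an integer $e\ge 0$ write $f(x)^e=\sum_{i\ge0}c_ix^i$, and for an integer $0\le d\le p$ let $M_d(f(x)^e)$ be the $d\times d$ matrix whose $(i,j)$ entry is $c_{ip+j-d-1}$ ($1\le i,j\le d$). Put $\delta(x_1,\dots,x_r)=\prod_{1\le i<j\le r}(x_i-x_j)$. $\mathscr{A}(p)$ is the set of $(r,e,d)\in\mathbb{Z}^3$ with $r\ge2$, $e\ge1$, $1\le d\le p$, such that there exist $\varepsilon\in\mathbb{F}_p^{\times}$ and a positive integer $g$ with $\det M_d(f(x)^e)=\varepsilon\,\delta(x_1,\dots,x_r)^g$. $\mathscr{B}_+(p)=\{(r,e,d): 2\le r\le p,\ e=p-1,\ d=r\}$, $\mathscr{B}_0(p)=\{(r,e,d): 2\le r\le p+1,\ (p-1)/2<e\le p-1,\ r(p-1-e)\le p-1,\ d=r-1\}$, $\mathscr{B}_-(p)=\{(r,e,d): r\ge2,\ (p-1)/2<e\le p-1,\ r(p-1-e)=p-1,\ d=r-2\}$ (all subsets of $\mathbb{Z}^3$), and $\mathscr{B}(p)=\mathscr{B}_+(p)\cup\mathscr{B}_0(p)\cup\mathscr{B}_-(p)$.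 -}

module Defs where

open import Data.Nat as ℕ using (ℕ; zero; suc; _∸_; _≤_; _<_)
open import Data.Nat.Divisibility as ℕD using ()
open import Data.Nat.Primality using (Prime)
open import Data.Integer as ℤ using (ℤ; +_; -[1+_])
open import Data.Integer.Divisibility as ℤD using ()
open import Data.Fin as Fin using (Fin; toℕ; punchIn)
open import Data.Vec as Vec using (Vec; []; _∷_; zipWith; tabulate)
open import Data.Vec.Properties as VecP using ()
open import Data.List as List using (List; [_]; map; concat; upTo; allFin; foldr)
open import Data.Bool using (if_then_else_)
open import Data.Product using (Σ; _×_; ∃; _,_)
open import Data.Sum using (_⊎_)
open import Relation.Nullary using (¬_; does)
open import Relation.Binary.PropositionalEquality using (_≡_)

-- Polynomials in n variables with integer coefficients, represented by
-- their coefficient function on exponent vectors (monomials).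
-- Statements over 𝔽_p are made by reducing coefficients modulo p
-- (reduction ℤ → 𝔽_p is a ring homomorphism, so det etc. commute with it).

Mono : ℕ → Set
Mono n = Vec ℕ n

Poly : ℕ → Set
Poly n = Mono n → ℤ

below : ∀ {n} → Mono n → List (Mono n)
below []      = [ [] ]
below (k ∷ m) = concat (map (λ i → map (i ∷_) (below m)) (upTo (suc k)))

module _ {n : ℕ} where

  _+ₚ_ : Poly n → Poly n → Poly n
  (P +ₚ Q) m = P m ℤ.+ Q m

  -ₚ_ : Poly n → Poly n
  (-ₚ P) m = ℤ.- P m

  _-ₚ_ : Poly n → Poly n → Poly n
  P -ₚ Q = P +ₚ (-ₚ Q)

  _*ₚ_ : Poly n → Poly n → Poly n
  (P *ₚ Q) m = foldr ℤ._+_ (+ 0) (map (λ a → P a ℤ.* Q (zipWith _∸_ m a)) (below m))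

  monoP : ℤ → Mono n → Poly n
  monoP c u m = if does (VecP.≡-dec ℕ._≟_ m u) then c else + 0

  constP : ℤ → Poly n
  constP c = monoP c (Vec.replicate n 0)

  0ₚ 1ₚ : Poly n
  0ₚ = constP (+ 0)
  1ₚ = constP (+ 1)

  varP : Fin n → Poly n
  varP i = monoP (+ 1) (tabulate (λ j → if does (i Fin.≟ j) then 1 else 0))

  _^ₚ_ : Poly n → ℕ → Poly n
  P ^ₚ zero  = 1ₚ
  P ^ₚ suc k = P *ₚ (P ^ₚ k)

  sumP : List (Poly n) → Poly n
  sumP = foldr _+ₚ_ 0ₚ

  prodP : List (Poly n) → Poly n
  prodP = foldr _*ₚ_ 1ₚ

  det : ∀ {d} → (Fin d → Fin d → Poly n) → Poly n
  det {zero}  A = 1ₚ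
  det {suc d} A = sumP (map (λ j →
      constP (sign j) *ₚ (A Fin.zero j *ₚ det (λ a b → A (Fin.suc a) (punchIn j b))))
      (allFin (suc d)))
    where
    sign : Fin (suc d) → ℤ
    sign j = (ℤ.- (+ 1)) ℤ.^ toℕ j

  _≡ₚ_[mod_] : Poly n → Poly n → ℕ → Set
  P ≡ₚ Q [mod p ] = ∀ m → (+ p) ℤD.∣ (P m ℤ.- Q m)

-- The data of the paper, for r roots.
-- In Poly (suc r): variable 0 is x, variable (suc j) is x_{j+1}.

module _ (r : ℕ) where

  xP : Poly (suc r)
  xP = varP Fin.zero

  fP : Poly (suc r)
  fP = prodP (map (λ j → xP -ₚ varP (Fin.suc j)) (allFin r))

  coeff : ℕ → ℕ → Poly r
  coeff e k m = (fP ^ₚ e) (k ∷ m)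

  -- M_d(f^e): (i,j) entry (1-based) is c_{ip+j-d-1}, zero if the index is negative.
  -- With 0-based a = i-1, b = j-1 the index is (a+1)p + (b+1) - d - 1.
  Mmat : (p e d : ℕ) → Fin d → Fin d → Poly r
  Mmat p e d a b =
    if does (suc d ℕ.≤? (suc (toℕ a) ℕ.* p ℕ.+ suc (toℕ b)))
    then coeff e (suc (toℕ a) ℕ.* p ℕ.+ suc (toℕ b) ∸ suc d)
    else 0ₚ

  δP : Poly r
  δP = prodP (concat (map (λ i → map (λ j → varP i -ₚ varP j)
          (List.filter (λ j → toℕ i ℕ.<? toℕ j) (allFin r))) (allFin r)))

-- The sets 𝒜(p), ℬ(p) (triples of integers; all members are nonnegative,
-- so we index by ℕ).

InA : (p r e d : ℕ) → Set
InA p r e d =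
  2 ≤ r × 1 ≤ e × 1 ≤ d × d ≤ p ×
  Σ ℤ (λ ε → ¬ ((+ p) ℤD.∣ ε) × Σ ℕ (λ g → 1 ≤ g ×
    (det (Mmat r p e d) ≡ₚ (constP ε *ₚ (δP r ^ₚ g)) [mod p ])))

-- (p-1)/2 < e  ⇔  p - 1 < 2e
InB₊ InB₀ InB₋ InB : (p r e d : ℕ) → Set
InB₊ p r e d = 2 ≤ r × r ≤ p × e ≡ p ∸ 1 × d ≡ r
InB₀ p r e d = 2 ≤ r × r ≤ suc p × p ∸ 1 < 2 ℕ.* e × e ≤ p ∸ 1 ×
               r ℕ.* (p ∸ 1 ∸ e) ≤ p ∸ 1 × d ≡ r ∸ 1
InB₋ p r e d = 2 ≤ r × p ∸ 1 < 2 ℕ.* e × e ≤ p ∸ 1 ×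
               r ℕ.* (p ∸ 1 ∸ e) ≡ p ∸ 1 × d ≡ r ∸ 2
InB p r e d = InB₊ p r e d ⊎ InB₀ p r e d ⊎ InB₋ p r e d

Side : (p r : ℕ) → Set
Side p r = r ≡ 2 ⊎ ¬ (r ℕD.∣ p ∸ 1)

{-# OPTIONS --safe #-}

-- Let z₁, …, z_r be the roots of f, f_j = f / (x - z_j) and D_j = f_j(z_j).
--
-- ℬ ⊆ 𝒜.  Let L be the matrix of the coefficients of f₁, …, f_r; column operations give
-- det L = ±δ, and ∏ D_j = ±δ².  Since f_j f^{p-1} = f_j^p (x - z_j)^{p-1}, multiplication by
-- M_r(f^{p-1}) turns L into its entrywise p-th power (with reversed rows), so that
-- det M_r(f^{p-1}) = ±δ^{p-1}.  The last row of this matrix is (1, 0, …, 0), whence the same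
-- value for M_{r-1}(f^{p-1}).  For smaller exponents one descends from e + 1 to e: the
-- coefficients of x^{ip} in x d/dx (f_j f^{e+1}) vanish mod p, and expanding f_j f′ as
-- D_j f_j plus a multiple of f turns this into an identity
--   M_{r-1}(f^{e+1}) B L = - M_{r-1}(f^e) L diag((e + 1) D_j)
-- between matrices bordered by one more row and column, with B triangular and diagonal
-- (e + 1) r + c, 0 ≤ c < r.  This is invertible as long as r (p - 1 - e) ≤ p - 1, and each
-- step divides the determinant by δ².
--
-- 𝒜 ⊆ ℬ.  The coefficient of the highest power of one root in det M_d(f^e) is, up to a unit,
-- the determinant of M_d or M_{d-1} for the remaining roots.  This gives the lexicographically
-- leading monomial of det M_d(f^e), which must agree with the one of δ^g, i.e. with
-- ∏ z_s^{g (s-1)}.  The comparison leaves only d = r with e = p - 1, d = r - 1 with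
-- g = 2e - (p - 1), and d = r - 2 with r (p - 1 - e) = p - 1.

module Submission where

open import Defs
open import Algebra.Bundles using (CommutativeRing)
open import Algebra.Solver.Ring.AlmostCommutativeRing using (AlmostCommutativeRing; fromCommutativeRing; _-Raw-AlmostCommutative⟶_)
open import Data.Bool using (Bool; true; false; if_then_else_)
open import Data.Empty using (⊥)
open import Data.Fin as Fin using (Fin; zero; suc; toℕ; punchIn; inject₁; fromℕ; opposite)
open import Data.Fin.Relation.Unary.Top using (view; ‵fromℕ; ‵inject₁)
open import Data.Integer as ℤ using (ℤ; +_; -[1+_]; _⊖_)
open import Data.Integer.Divisibility.Signed as ℤS using (∣ᵤ⇒∣; ∣⇒∣ᵤ)
open import Data.List using (List; []; _∷_; map; concat; applyUpTo; upTo; allFin; foldr; _++_; filter; tabulate)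
open import Data.Maybe as Maybe using (Maybe)
open import Data.Nat as ℕ using (ℕ; zero; suc; z≤n; s≤s; _∸_; _≤_; _<_; _<ᵇ_; _!; NonZero)
open import Data.Nat.Combinatorics as Comb using (nCk≡n!/k![n-k]!; k![n∸k]!∣n!; nCn≡1; nCk+nC[k+1]≡[n+1]C[k+1]; k>n⇒nCk≡0)
open import Data.Nat.Coprimality using (Coprime; coprime-Bézout)
open import Data.Nat.Divisibility as ℕD using (_∣_; _∤_; divides)
open import Data.Nat.DivMod using (m/n*n≡m)
open import Data.Nat.GCD using (module Bézout)
open import Data.Nat.Primality using (Prime; euclidsLemma; prime⇒irreducible; prime⇒nonTrivial; prime⇒nonZero; ¬prime[0])
open import Data.Nat.Solver using (module +-*-Solver)
open import Data.Product using (Σ; _×_; _,_; proj₁; proj₂)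
open import Data.Sum using (_⊎_; inj₁; inj₂; [_,_]′)
open import Data.Vec as Vec using (Vec; []; _∷_; replicate; zipWith)
open import Function using (_∘_; id)
open import Function.Bundles using (_⇔_; mk⇔)
open import Level using (0ℓ)
open import Relation.Binary.Consequences using (dec⇒weaklyDec)
open import Relation.Binary.Definitions using (tri<; tri≈; tri>)
open import Relation.Binary.PropositionalEquality as ≡ using (_≡_; _≢_)
open import Relation.Nullary using (contradiction; ¬_; Dec; does; yes; no)
open import Relation.Unary using (Decidable)
import Algebra.Properties.CommutativeMonoid.Mult as CMult
import Algebra.Properties.CommutativeMonoid.Sum as MonoidSum
import Algebra.Properties.CommutativeSemiring.Binomial as Binomial
import Algebra.Properties.CommutativeSemiring.Exp as CExp
import Algebra.Properties.Ring as RingProperties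
import Algebra.Properties.Semiring.Exp as Exp
import Algebra.Properties.Semiring.Mult as Mult
import Algebra.Properties.Semiring.Sum as Sum
import Algebra.Solver.Ring as RingSolver
import Algebra.Solver.Ring.NaturalCoefficients.Default as NatSolver
import Data.Fin.Properties as FinP
import Data.Integer.Divisibility as ℤD
import Data.Integer.Properties as ℤP
import Data.List.Properties as ListP
import Data.Nat.Properties as ℕP
import Data.Vec.Properties as VecP
import Relation.Binary.Reasoning.Setoid as SetoidReasoning

-- The descent identity concerns polynomials of degree at most r - 1, hence r coefficients, while
-- M_{r-1} has only r - 1 columns. The missing equation comes from the two ends: f_j is monic, and
-- the constant coefficient of the factor `W` on the other side is (e + 1) D_j. This is why the two
-- matrices are bordered by unit rows picking opposite ends. All determinants are compared up to
-- factors from 𝔽_p^×, and powers of δ are cancelled. For this δ only has to be a non-zero-divisor,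
-- which is seen one variable at a time in rings of power series; no field of fractions occurs.
-- Leading monomials can be compared only if d (p - 1) ≤ r e and e ≤ p - 1. Outside this range a row
-- vanishes: the last one by degree if r e < d (p - 1), and the first one, after one root is put
-- equal to 0, if e ≥ p; but δ^g remains a non-zero-divisor there. Finally, d = r - 2 comes with r
-- dividing p - 1, so the side condition leaves only r = 2, where d would be 0.

Ring : Set₁
Ring = CommutativeRing 0ℓ 0ℓ

-- Formal power series over a commutative ring.

record Series (A : Set) : Set where
  no-eta-equality
  constructor series
  field coef : ℕ → A
open Series public

module PowerSeries (R : Ring) where
  open CommutativeRing R hiding (zero)
  open SetoidReasoning setoid
  open NatSolver commutativeSemiring using (solve; _:+_; _:*_; _:=_)

  conv : (ℕ → Carrier) → (ℕ → Carrier) → ℕ → Carrier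
  conv a b zero    = a 0 * b 0
  conv a b (suc k) = a 0 * b (suc k) + conv (a ∘ suc) b k

  conv-cong : ∀ {a a′ b b′} → (∀ i → a i ≈ a′ i) → (∀ i → b i ≈ b′ i) →
              ∀ k → conv a b k ≈ conv a′ b′ k
  conv-cong p q zero    = *-cong (p 0) (q 0)
  conv-cong p q (suc k) = +-cong (*-cong (p 0) (q (suc k))) (conv-cong (p ∘ suc) q k)

  -- `conv` peels off the first term of the sum; commutativity also needs the last one.
  conv-sucʳ : ∀ a b k → conv a b (suc k) ≈ conv a (b ∘ suc) k + a (suc k) * b 0
  conv-sucʳ a b zero    = refl
  conv-sucʳ a b (suc k) = trans (+-congˡ (conv-sucʳ (a ∘ suc) b k)) (sym (+-assoc _ _ _))

  conv-comm : ∀ a b k → conv a b k ≈ conv b a k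
  conv-comm a b zero    = *-comm _ _
  conv-comm a b (suc k) = begin
    a 0 * b (suc k) + conv (a ∘ suc) b k  ≈⟨ +-cong (*-comm _ _) (conv-comm (a ∘ suc) b k) ⟩
    b (suc k) * a 0 + conv b (a ∘ suc) k  ≈⟨ +-comm _ _ ⟩
    conv b (a ∘ suc) k + b (suc k) * a 0  ≈⟨ conv-sucʳ b a k ⟨
    conv b a (suc k)                      ∎

  conv-distribʳ : ∀ c a b k → conv (λ i → a i + b i) c k ≈ conv a c k + conv b c k
  conv-distribʳ c a b zero    = distribʳ _ _ _
  conv-distribʳ c a b (suc k) =
    trans (+-congˡ (conv-distribʳ c (a ∘ suc) (b ∘ suc) k))
          (solve 5 (λ x y z u v → (x :+ y) :* z :+ (u :+ v) := (x :* z :+ u) :+ (y :* z :+ v))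
                 refl (a 0) (b 0) (c (suc k)) (conv (a ∘ suc) c k) (conv (b ∘ suc) c k))

  conv-scaleˡ : ∀ x a b k → conv (λ i → x * a i) b k ≈ x * conv a b k
  conv-scaleˡ x a b zero    = *-assoc _ _ _
  conv-scaleˡ x a b (suc k) =
    trans (+-cong (*-assoc _ _ _) (conv-scaleˡ x (a ∘ suc) b k)) (sym (distribˡ _ _ _))

  conv-assoc : ∀ a b c k → conv (conv a b) c k ≈ conv a (conv b c) k
  conv-assoc a b c zero    = *-assoc _ _ _
  conv-assoc a b c (suc k) = begin
    a 0 * b 0 * c (suc k) + conv (λ i → a 0 * b (suc i) + conv (a ∘ suc) b i) c k
      ≈⟨ +-congˡ (conv-distribʳ c (λ i → a 0 * b (suc i)) (conv (a ∘ suc) b) k) ⟩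
    a 0 * b 0 * c (suc k) + (conv (λ i → a 0 * b (suc i)) c k + conv (conv (a ∘ suc) b) c k)
      ≈⟨ +-congˡ (+-cong (conv-scaleˡ (a 0) (b ∘ suc) c k) (conv-assoc (a ∘ suc) b c k)) ⟩
    a 0 * b 0 * c (suc k) + (a 0 * conv (b ∘ suc) c k + conv (a ∘ suc) (conv b c) k)
      ≈⟨ solve 5 (λ x y z u v → x :* y :* z :+ (x :* u :+ v) := x :* (y :* z :+ u) :+ v)
               refl (a 0) (b 0) (c (suc k)) (conv (b ∘ suc) c k) (conv (a ∘ suc) (conv b c) k) ⟩
    a 0 * conv b c (suc k) + conv (a ∘ suc) (conv b c) k ∎

  conv-zeroˡ : ∀ {a} b → (∀ i → a i ≈ 0#) → ∀ k → conv a b k ≈ 0#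
  conv-zeroˡ b z zero    = trans (*-congʳ (z 0)) (zeroˡ _)
  conv-zeroˡ b z (suc k) =
    trans (+-cong (trans (*-congʳ (z 0)) (zeroˡ _)) (conv-zeroˡ b (z ∘ suc) k)) (+-identityˡ _)

  conv-constˡ : ∀ {a} b → (∀ i → a (suc i) ≈ 0#) → ∀ k → conv a b k ≈ a 0 * b k
  conv-constˡ b z zero    = refl
  conv-constˡ b z (suc k) = trans (+-congˡ (conv-zeroˡ b z k)) (+-identityʳ _)

  infix 4 _≈ₛ_
  -- A record rather than a bare function type, so that both series can be inferred from a proof of
  -- their equality.
  record _≈ₛ_ (a b : Series Carrier) : Set where
    constructor pointwise
    field at : ∀ k → coef a k ≈ coef b k
  open _≈ₛ_ public

  infixl 6 _+ₛ_
  infixl 7 _*ₛ_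

  _+ₛ_ _*ₛ_ : Series Carrier → Series Carrier → Series Carrier
  coef (a +ₛ b) k = coef a k + coef b k
  coef (a *ₛ b)   = conv (coef a) (coef b)

  -ₛ_ : Series Carrier → Series Carrier
  coef (-ₛ a) k = - coef a k

  C : Carrier → Series Carrier
  coef (C x) zero    = x
  coef (C x) (suc _) = 0#

  seriesRing : Ring
  seriesRing = record
    { Carrier = Series Carrier
    ; _≈_ = _≈ₛ_
    ; _+_ = _+ₛ_
    ; _*_ = _*ₛ_
    ; -_  = -ₛ_
    ; 0#  = C 0#
    ; 1#  = C 1#
    ; isCommutativeRing = record
      { isRing = record
        { +-isAbelianGroup = record
          { isGroup = record
            { isMonoid = record
              { isSemigroup = record
                { isMagma = record
                  { isEquivalence = record
                    { refl  = pointwise (λ _ → refl)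
                    ; sym   = λ p → pointwise (λ k → sym (at p k))
                    ; trans = λ p q → pointwise (λ k → trans (at p k) (at q k))
                    }
                  ; ∙-cong = λ p q → pointwise (λ k → +-cong (at p k) (at q k))
                  }
                ; assoc = λ a b c → pointwise (λ k → +-assoc _ _ _)
                }
              ; identity = (λ a → pointwise (λ k → trans (+-congʳ (coeff-0 k)) (+-identityˡ _)))
                         , (λ a → pointwise (λ k → trans (+-congˡ (coeff-0 k)) (+-identityʳ _)))
              }
            ; inverse = (λ a → pointwise (λ k → trans (-‿inverseˡ _) (sym (coeff-0 k))))
                      , (λ a → pointwise (λ k → trans (-‿inverseʳ _) (sym (coeff-0 k))))
            ; ⁻¹-cong = λ p → pointwise (λ k → -‿cong (at p k))
            }
          ; comm = λ a b → pointwise (λ k → +-comm _ _)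
          }
        ; *-cong = λ p q → pointwise (conv-cong (at p) (at q))
        ; *-assoc = λ a b c → pointwise (conv-assoc (coef a) (coef b) (coef c))
        ; *-identity = (λ a → pointwise (one-*ˡ a))
                     , (λ a → pointwise (λ k → trans (conv-comm _ _ k) (one-*ˡ a k)))
        ; distrib = (λ a b c → pointwise (λ k →
                        trans (conv-comm _ _ k)
                        (trans (conv-distribʳ (coef a) (coef b) (coef c) k)
                               (+-cong (conv-comm _ _ k) (conv-comm _ _ k)))))
                  , (λ a b c → pointwise (conv-distribʳ (coef a) (coef b) (coef c)))
        }
      ; *-comm = λ a b → pointwise (conv-comm (coef a) (coef b))
      }
    }
    where
    coeff-0 : ∀ k → coef (C 0#) k ≈ 0#
    coeff-0 zero    = refl
    coeff-0 (suc k) = refl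
    one-*ˡ : ∀ a k → conv (coef (C 1#)) (coef a) k ≈ coef a k
    one-*ˡ a k = trans (conv-constˡ (coef a) (λ _ → refl) k) (*-identityˡ _)

-- Integer constants in a ring, and a ring solver using them.

module FromIntegers (R : Ring) where
  open CommutativeRing R hiding (zero)
  open RingProperties ring using (-‿distribˡ-*; -‿distribʳ-*; -‿involutive; -0#≈0#; -‿+-comm)
  open Mult semiring using (×-homo-+; ×1-homo-*) renaming (_×_ to _·_)
  open SetoidReasoning setoid
  open NatSolver commutativeSemiring using () renaming (solve to solveℕ; _:+_ to _:+ₙ_; _:=_ to _:=ₙ_)

  fromℤ : ℤ → Carrier
  fromℤ (+ n)    = n · 1#
  fromℤ -[1+ n ] = - (suc n · 1#)

  fromℤ-⊖ : ∀ m n → fromℤ (m ⊖ n) ≈ m · 1# - n · 1#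
  fromℤ-⊖ m       zero    = trans (sym (+-identityʳ _)) (+-congˡ (sym -0#≈0#))
  fromℤ-⊖ zero    (suc n) = sym (+-identityˡ _)
  fromℤ-⊖ (suc m) (suc n) = begin
    fromℤ (suc m ⊖ suc n)                  ≡⟨ ≡.cong fromℤ (ℤP.[1+m]⊖[1+n]≡m⊖n m n) ⟩
    fromℤ (m ⊖ n)                          ≈⟨ fromℤ-⊖ m n ⟩
    m · 1# - n · 1#                        ≈⟨ +-identityˡ _ ⟨
    0# + (m · 1# - n · 1#)                 ≈⟨ +-congʳ (-‿inverseʳ 1#) ⟨
    (1# - 1#) + (m · 1# - n · 1#)          ≈⟨ solveℕ 4 (λ a b c d → (a :+ₙ b) :+ₙ (c :+ₙ d) :=ₙ (a :+ₙ c) :+ₙ (b :+ₙ d)) refl 1# (- 1#) (m · 1#) (- (n · 1#)) ⟩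
    (1# + m · 1#) + (- 1# - n · 1#)        ≈⟨ +-congˡ (-‿+-comm _ _) ⟩
    suc m · 1# - suc n · 1#                ∎

  fromℤ-neg : ∀ i → fromℤ (ℤ.- i) ≈ - fromℤ i
  fromℤ-neg (+ zero)   = sym -0#≈0#
  fromℤ-neg (+ suc n)  = refl
  fromℤ-neg -[1+ n ]   = sym (-‿involutive _)

  fromℤ-+ : ∀ i j → fromℤ (i ℤ.+ j) ≈ fromℤ i + fromℤ j
  fromℤ-+ (+ m)    (+ n)    = ×-homo-+ 1# m n
  fromℤ-+ (+ m)    -[1+ n ] = fromℤ-⊖ m (suc n)
  fromℤ-+ -[1+ m ] (+ n)    = trans (fromℤ-⊖ n (suc m)) (+-comm _ _)
  fromℤ-+ -[1+ m ] -[1+ n ] = begin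
    - (suc (suc (m ℕ.+ n)) · 1#)      ≈⟨ -‿cong (+-congˡ (×-homo-+ 1# (suc m) n)) ⟩
    - (1# + (suc m · 1# + n · 1#))    ≈⟨ -‿cong (solveℕ 3 (λ a b c → a :+ₙ (b :+ₙ c) :=ₙ b :+ₙ (a :+ₙ c)) refl 1# (suc m · 1#) (n · 1#)) ⟩
    - (suc m · 1# + suc n · 1#)       ≈⟨ -‿+-comm _ _ ⟨
    - (suc m · 1#) - suc n · 1#       ∎

  fromℤ-*⁺ : ∀ m j → fromℤ (+ m ℤ.* j) ≈ m · 1# * fromℤ j
  fromℤ-*⁺ m (+ n) = trans (reflexive (≡.cong fromℤ (≡.sym (ℤP.pos-* m n)))) (×1-homo-* m n)
  fromℤ-*⁺ m -[1+ n ] = begin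
    fromℤ (+ m ℤ.* -[1+ n ])           ≡⟨ ≡.cong fromℤ (≡.sym (ℤP.neg-distribʳ-* (+ m) (+ suc n))) ⟩
    fromℤ (ℤ.- (+ m ℤ.* + suc n))      ≈⟨ fromℤ-neg (+ m ℤ.* + suc n) ⟩
    - fromℤ (+ m ℤ.* + suc n)          ≈⟨ -‿cong (fromℤ-*⁺ m (+ suc n)) ⟩
    - (m · 1# * (suc n · 1#))          ≈⟨ -‿distribʳ-* _ _ ⟩
    m · 1# * - (suc n · 1#)            ∎

  fromℤ-* : ∀ i j → fromℤ (i ℤ.* j) ≈ fromℤ i * fromℤ j
  fromℤ-* (+ m)    j = fromℤ-*⁺ m j
  fromℤ-* -[1+ m ] j = begin
    fromℤ (-[1+ m ] ℤ.* j)             ≡⟨ ≡.cong fromℤ (≡.sym (ℤP.neg-distribˡ-* (+ suc m) j)) ⟩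
    fromℤ (ℤ.- (+ suc m ℤ.* j))        ≈⟨ fromℤ-neg (+ suc m ℤ.* j) ⟩
    - fromℤ (+ suc m ℤ.* j)            ≈⟨ -‿cong (fromℤ-*⁺ (suc m) j) ⟩
    - (suc m · 1# * fromℤ j)           ≈⟨ -‿distribˡ-* _ _ ⟩
    - (suc m · 1#) * fromℤ j           ∎

  private
    almostRing : AlmostCommutativeRing 0ℓ 0ℓ
    almostRing = fromCommutativeRing R

    morphism : ℤ.+-*-rawRing -Raw-AlmostCommutative⟶ almostRing
    morphism = record
      { ⟦_⟧    = fromℤ
      ; +-homo = fromℤ-+
      ; *-homo = fromℤ-*
      ; -‿homo = fromℤ-neg
      ; 0-homo = refl
      ; 1-homo = +-identityʳ _
      }

    -- Soundness suffices for the solver: distinct integers that agree in `R` are merely not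
    -- identified.
    _≟_ : ∀ i j → Maybe (fromℤ i ≈ fromℤ j)
    i ≟ j = Maybe.map (λ e → reflexive (≡.cong fromℤ e)) (dec⇒weaklyDec ℤ._≟_ i j)

  open RingSolver ℤ.+-*-rawRing almostRing morphism _≟_ public
    using (solve; _:+_; _:*_; _:-_; :-_; _:=_; con)

-- Determinants as top coordinates in an exterior algebra.

module Determinants (R : Ring) where
  open CommutativeRing R hiding (zero)
  open RingProperties ring using (-‿distribˡ-*; -0#≈0#)
  open Sum semiring using (sum; sum-cong-≋)
  open FromIntegers R using (solve; _:+_; _:*_; _:-_; :-_; _:=_; con)
  open SetoidReasoning setoid

  Row : ℕ → Set
  Row n = Fin n → Carrier

  Matrix : ℕ → ℕ → Set
  Matrix m n = Fin m → Row n

  sgn : ∀ {n} → Fin n → Carrier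
  sgn zero    = 1#
  sgn (suc j) = - sgn j

  minor : ∀ {d} → Matrix (suc d) (suc d) → Fin (suc d) → Matrix d d
  minor A j a b = A (suc a) (punchIn j b)

  detᵣ : ∀ {d} → Matrix d d → Carrier
  detᵣ {zero}  A = 1#
  detᵣ {suc d} A = sum (λ j → sgn j * (A zero j * detᵣ (minor A j)))

  det-cong : ∀ {d} {A B : Matrix d d} → (∀ i j → A i j ≈ B i j) → detᵣ A ≈ detᵣ B
  det-cong {zero}  e = refl
  det-cong {suc d} e = sum-cong-≋ (λ j →
    *-congˡ {x = sgn j} (*-cong (e zero j) (det-cong (λ a b → e (suc a) (punchIn j b)))))

  -- Elements of the exterior algebra of Rᵐ, by their coordinates in the basis of
  -- products e_i₁ ∧ ⋯ ∧ e_iₖ; the vector of booleans is the indicator of {i₁, …, iₖ}.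
  Ext : ℕ → Set
  Ext m = Vec Bool m → Carrier

  infixr 7 _∧_
  -- Write u = u₀ e₀ + u⁺ and ω = ω₀ + e₀ ∧ ω₁. The part of u ∧ ω without e₀ is u⁺ ∧ ω₀; the factor
  -- of e₀ is u₀ ω₀ - u⁺ ∧ ω₁, the sign coming from moving u⁺ past e₀.
  _∧_ : ∀ {m} → Row m → Ext m → Ext m
  (u ∧ ω) []          = 0#
  (u ∧ ω) (false ∷ s) = ((u ∘ suc) ∧ (ω ∘ (false ∷_))) s
  (u ∧ ω) (true  ∷ s) = u zero * ω (false ∷ s) - ((u ∘ suc) ∧ (ω ∘ (true ∷_))) s

  ∧-cong : ∀ {m} {u v : Row m} {ω η : Ext m} →
           (∀ i → u i ≈ v i) → (∀ s → ω s ≈ η s) → ∀ s → (u ∧ ω) s ≈ (v ∧ η) s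
  ∧-cong p q []          = refl
  ∧-cong p q (false ∷ s) = ∧-cong (p ∘ suc) (q ∘ (false ∷_)) s
  ∧-cong p q (true  ∷ s) =
    +-cong (*-cong (p zero) (q (false ∷ s))) (-‿cong (∧-cong (p ∘ suc) (q ∘ (true ∷_)) s))

  ∧-linearʳ : ∀ {m} (u : Row m) x (ω η : Ext m) s →
              (u ∧ (λ t → x * ω t + η t)) s ≈ x * (u ∧ ω) s + (u ∧ η) s
  ∧-linearʳ u x ω η []          = sym (trans (+-identityʳ _) (zeroʳ x))
  ∧-linearʳ u x ω η (false ∷ s) = ∧-linearʳ (u ∘ suc) x _ _ s
  ∧-linearʳ u x ω η (true  ∷ s) =
    trans (+-congˡ (-‿cong (∧-linearʳ (u ∘ suc) x _ _ s)))
          (solve 6 (λ a x b c d e → a :* (x :* b :+ c) :- (x :* d :+ e) :=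
                                    x :* (a :* b :- d) :+ (a :* c :- e))
                 refl (u zero) x (ω (false ∷ s)) (η (false ∷ s))
                 ((_ ∧ (ω ∘ (true ∷_))) s) ((_ ∧ (η ∘ (true ∷_))) s))

  ∧-linearˡ : ∀ {m} x (u v : Row m) (ω : Ext m) s →
              ((λ i → x * u i + v i) ∧ ω) s ≈ x * (u ∧ ω) s + (v ∧ ω) s
  ∧-linearˡ x u v ω []          = sym (trans (+-identityʳ _) (zeroʳ x))
  ∧-linearˡ x u v ω (false ∷ s) = ∧-linearˡ x (u ∘ suc) (v ∘ suc) _ s
  ∧-linearˡ x u v ω (true  ∷ s) =
    trans (+-congˡ (-‿cong (∧-linearˡ x (u ∘ suc) (v ∘ suc) _ s)))
          (solve 6 (λ x a b w d e → (x :* a :+ b) :* w :- (x :* d :+ e) :=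
                                    x :* (a :* w :- d) :+ (b :* w :- e))
                 refl x (u zero) (v zero) (ω (false ∷ s))
                 (((u ∘ suc) ∧ (ω ∘ (true ∷_))) s) (((v ∘ suc) ∧ (ω ∘ (true ∷_))) s))

  ∧-zeroʳ : ∀ {m} (u : Row m) {ω : Ext m} → (∀ s → ω s ≈ 0#) → ∀ s → (u ∧ ω) s ≈ 0#
  ∧-zeroʳ u z []          = refl
  ∧-zeroʳ u z (false ∷ s) = ∧-zeroʳ (u ∘ suc) (z ∘ (false ∷_)) s
  ∧-zeroʳ u z (true  ∷ s) =
    trans (+-cong (trans (*-congˡ (z (false ∷ s))) (zeroʳ _))
                  (trans (-‿cong (∧-zeroʳ (u ∘ suc) (z ∘ (true ∷_)) s)) -0#≈0#))
          (+-identityʳ _)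

  ∧-zeroˡ : ∀ {m} {u : Row m} → (∀ i → u i ≈ 0#) → (ω : Ext m) → ∀ s → (u ∧ ω) s ≈ 0#
  ∧-zeroˡ z ω []          = refl
  ∧-zeroˡ z ω (false ∷ s) = ∧-zeroˡ (z ∘ suc) (ω ∘ (false ∷_)) s
  ∧-zeroˡ z ω (true  ∷ s) =
    trans (+-cong (trans (*-congʳ (z zero)) (zeroˡ _))
                  (trans (-‿cong (∧-zeroˡ (z ∘ suc) (ω ∘ (true ∷_)) s)) -0#≈0#))
          (+-identityʳ _)

  ∧-minus : ∀ {m} (u : Row m) x (ω η : Ext m) s →
           (u ∧ (λ t → x * ω t - η t)) s ≈ x * (u ∧ ω) s - (u ∧ η) s
  ∧-minus u x ω η s = begin
    (u ∧ (λ t → x * ω t - η t)) s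
      ≈⟨ ∧-cong (λ _ → refl) (λ t → solve 3 (λ x a b → x :* a :- b := (:- con (ℤ.+ 1)) :* b :+ x :* a) refl x (ω t) (η t)) s ⟩
    (u ∧ (λ t → - 1ℤ * η t + x * ω t)) s
      ≈⟨ ∧-linearʳ u (- 1ℤ) η (λ t → x * ω t) s ⟩
    - 1ℤ * (u ∧ η) s + (u ∧ (λ t → x * ω t)) s
      ≈⟨ +-congˡ (∧-cong (λ _ → refl) (λ t → sym (+-identityʳ (x * ω t))) s) ⟩
    - 1ℤ * (u ∧ η) s + (u ∧ (λ t → x * ω t + 0#)) s
      ≈⟨ +-congˡ (trans (∧-linearʳ u x ω (λ _ → 0#) s) (trans (+-congˡ (∧-zeroʳ u (λ _ → refl) s)) (+-identityʳ _))) ⟩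
    - 1ℤ * (u ∧ η) s + x * (u ∧ ω) s
      ≈⟨ solve 3 (λ x a b → (:- con (ℤ.+ 1)) :* b :+ x :* a := x :* a :- b) refl x ((u ∧ ω) s) ((u ∧ η) s) ⟩
    x * (u ∧ ω) s - (u ∧ η) s ∎
    where
    open FromIntegers R using (fromℤ)
    -- The solver reads `con (+ 1)` as `fromℤ (+ 1)`, that is `1# + 0#`; the scalar is stated in the
    -- same form.
    1ℤ : Carrier
    1ℤ = fromℤ (ℤ.+ 1)

  ∧-anticomm : ∀ {m} (u v : Row m) (ω : Ext m) s → (u ∧ v ∧ ω) s ≈ - (v ∧ u ∧ ω) s
  ∧-anticomm u v ω []          = sym -0#≈0#
  ∧-anticomm u v ω (false ∷ s) = ∧-anticomm (u ∘ suc) (v ∘ suc) _ s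
  ∧-anticomm u v ω (true  ∷ s) = begin
    u₀ * (v⁺ ∧ ω₀) s - (u⁺ ∧ (λ t → v₀ * ω₀ t - (v⁺ ∧ ω₁) t)) s
      ≈⟨ +-congˡ (-‿cong (∧-minus u⁺ v₀ ω₀ (v⁺ ∧ ω₁) s)) ⟩
    u₀ * (v⁺ ∧ ω₀) s - (v₀ * (u⁺ ∧ ω₀) s - (u⁺ ∧ v⁺ ∧ ω₁) s)
      ≈⟨ +-congˡ (-‿cong (+-congˡ (-‿cong (∧-anticomm u⁺ v⁺ ω₁ s)))) ⟩
    u₀ * (v⁺ ∧ ω₀) s - (v₀ * (u⁺ ∧ ω₀) s - - (v⁺ ∧ u⁺ ∧ ω₁) s)
      ≈⟨ solve 5 (λ a b c d e → a :* b :- (c :* d :- (:- e)) := :- (c :* d :- (a :* b :- e)))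
               refl u₀ ((v⁺ ∧ ω₀) s) v₀ ((u⁺ ∧ ω₀) s) ((v⁺ ∧ u⁺ ∧ ω₁) s) ⟩
    - (v₀ * (u⁺ ∧ ω₀) s - (u₀ * (v⁺ ∧ ω₀) s - (v⁺ ∧ u⁺ ∧ ω₁) s))
      ≈⟨ -‿cong (+-congˡ (-‿cong (∧-minus v⁺ u₀ ω₀ (u⁺ ∧ ω₁) s))) ⟨
    - (v₀ * (u⁺ ∧ ω₀) s - (v⁺ ∧ (λ t → u₀ * ω₀ t - (u⁺ ∧ ω₁) t)) s) ∎
    where
    u₀ = u zero
    v₀ = v zero
    u⁺ = u ∘ suc
    v⁺ = v ∘ suc
    ω₀ = ω ∘ (false ∷_)
    ω₁ = ω ∘ (true ∷_)

  -- Anticommutativity gives only twice this, which says nothing in characteristic 2. In the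
  -- separate induction the two copies of u₀ (u⁺ ∧ ω₀) cancel.
  ∧-square : ∀ {m} (u : Row m) (ω : Ext m) s → (u ∧ u ∧ ω) s ≈ 0#
  ∧-square u ω []          = refl
  ∧-square u ω (false ∷ s) = ∧-square (u ∘ suc) _ s
  ∧-square u ω (true  ∷ s) = begin
    u₀ * (u⁺ ∧ ω₀) s - (u⁺ ∧ (λ t → u₀ * ω₀ t - (u⁺ ∧ ω₁) t)) s
      ≈⟨ +-congˡ (-‿cong (∧-minus u⁺ u₀ ω₀ (u⁺ ∧ ω₁) s)) ⟩
    u₀ * (u⁺ ∧ ω₀) s - (u₀ * (u⁺ ∧ ω₀) s - (u⁺ ∧ u⁺ ∧ ω₁) s)
      ≈⟨ solve 2 (λ a b → a :- (a :- b) := b) refl (u₀ * (u⁺ ∧ ω₀) s) ((u⁺ ∧ u⁺ ∧ ω₁) s) ⟩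
    (u⁺ ∧ u⁺ ∧ ω₁) s
      ≈⟨ ∧-square u⁺ ω₁ s ⟩
    0# ∎
    where
    u₀ = u zero
    u⁺ = u ∘ suc
    ω₀ = ω ∘ (false ∷_)
    ω₁ = ω ∘ (true ∷_)

  unit : ∀ {m} → Ext m
  unit []          = 1#
  unit (false ∷ s) = unit s
  unit (true  ∷ s) = 0#

  wedge : ∀ {n m} → Matrix n m → Ext m
  wedge {zero}  A = unit
  wedge {suc n} A = A zero ∧ wedge (A ∘ suc)

  top : ∀ {m} → Ext m → Carrier
  top ω = ω (replicate _ true)

  -- The quotient homomorphism sending e_j to 0: only basis products avoiding e_j are kept.
  drop : ∀ {m} → Fin (suc m) → Ext (suc m) → Ext m
  drop zero    ω s       = ω (false ∷ s)
  drop (suc j) ω (b ∷ s) = drop j (ω ∘ (b ∷_)) s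

  drop-∧ : ∀ {m} j (u : Row (suc m)) (ω : Ext (suc m)) s →
           drop j (u ∧ ω) s ≈ ((u ∘ punchIn j) ∧ drop j ω) s
  drop-∧ zero            u ω s           = refl
  drop-∧ (suc j)         u ω (false ∷ s) = drop-∧ j (u ∘ suc) (ω ∘ (false ∷_)) s
  drop-∧ (suc j)         u ω (true ∷ s)  =
    trans (drop-true j u ω s) (+-congˡ (-‿cong (drop-∧ j (u ∘ suc) (ω ∘ (true ∷_)) s)))
    where
    drop-true : ∀ {m} (j : Fin (suc m)) (u : Row (suc (suc m))) (ω : Ext (suc (suc m))) s →
                drop j ((u ∧ ω) ∘ (true ∷_)) s ≈
                u zero * drop j (ω ∘ (false ∷_)) s - drop j ((u ∘ suc) ∧ (ω ∘ (true ∷_))) s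
    drop-true j u ω s = aux j s
      where
      aux : ∀ {k} (j : Fin (suc k)) {x} {ω η : Ext (suc k)} s →
            drop j (λ t → x * ω t - η t) s ≈ x * drop j ω s - drop j η s
      aux zero    s       = refl
      aux (suc j) (b ∷ s) = aux j s

  drop-unit : ∀ {m} (j : Fin (suc m)) s → drop {m} j unit s ≈ unit s
  drop-unit zero    s           = refl
  drop-unit (suc j) (false ∷ s) = drop-unit j s
  drop-unit (suc j) (true ∷ s)  = drop-zero j s
    where
    drop-zero : ∀ {m} (j : Fin (suc m)) s → drop {m} j (λ _ → 0#) s ≈ 0#
    drop-zero zero    s       = refl
    drop-zero (suc j) (b ∷ s) = drop-zero j s

  drop-wedge : ∀ {n m} (j : Fin (suc m)) (A : Matrix n (suc m)) s →
               drop j (wedge A) s ≈ wedge (λ i → A i ∘ punchIn j) s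
  drop-wedge {zero}  j A s = drop-unit j s
  drop-wedge {suc n} j A s =
    trans (drop-∧ j (A zero) (wedge (A ∘ suc)) s)
          (∧-cong (λ _ → refl) (drop-wedge j (A ∘ suc)) s)

  -- Laplace expansion: the tail of `u` passes e₀ and changes sign, which is the recursion defining
  -- `sgn`.
  top-∧ : ∀ {m} (u : Row (suc m)) (ω : Ext (suc m)) →
          top (u ∧ ω) ≈ sum (λ j → sgn j * (u j * top (drop j ω)))
  top-∧ {zero}  u ω = begin
    u zero * ω (false ∷ []) - 0#              ≈⟨ solve 1 (λ a → a :- con (ℤ.+ 0) := a) refl _ ⟩
    u zero * ω (false ∷ [])                   ≈⟨ *-identityˡ _ ⟨
    1# * (u zero * ω (false ∷ []))            ≈⟨ +-identityʳ _ ⟨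
    1# * (u zero * ω (false ∷ [])) + 0#       ∎
  top-∧ {suc m} u ω = +-cong (sym (*-identityˡ _)) (begin
    - top (u⁺ ∧ ω₁)                                        ≈⟨ -‿cong (top-∧ u⁺ ω₁) ⟩
    - sum (λ j → sgn j * (u⁺ j * top (drop j ω₁)))         ≈⟨ sum-neg (λ j → sgn j * (u⁺ j * top (drop j ω₁))) ⟩
    sum (λ j → - (sgn j * (u⁺ j * top (drop j ω₁))))       ≈⟨ sum-cong-≋ (λ j → -‿distribˡ-* (sgn j) (u⁺ j * top (drop j ω₁))) ⟩
    sum (λ j → - sgn j * (u⁺ j * top (drop j ω₁)))         ∎)
    where
    u⁺ = u ∘ suc
    ω₁ = ω ∘ (true ∷_)
    sum-neg : ∀ {n} (f : Fin n → Carrier) → - sum f ≈ sum (-_ ∘ f)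
    sum-neg {zero}  f = -0#≈0#
    sum-neg {suc n} f = trans (solve 2 (λ a b → :- (a :+ b) := :- a :+ (:- b)) refl (f zero) (sum (f ∘ suc)))
                              (+-congˡ (sum-neg (f ∘ suc)))

  -- Both sides obey the expansion along the first row, because `drop` turns the wedge of the other
  -- rows into that of the rows of a minor.
  det-wedge : ∀ {d} (A : Matrix d d) → detᵣ A ≈ top (wedge A)
  det-wedge {zero}  A = refl
  det-wedge {suc d} A = begin
    sum (λ j → sgn j * (A zero j * detᵣ (minor A j)))
      ≈⟨ sum-cong-≋ (λ j → *-congˡ {x = sgn j} (*-congˡ {x = A zero j} (begin
           detᵣ (minor A j)              ≈⟨ det-wedge (minor A j) ⟩
           top (wedge (minor A j))      ≈⟨ drop-wedge j (A ∘ suc) (replicate _ true) ⟨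
           top (drop j (wedge (A ∘ suc))) ∎))) ⟩
    sum (λ j → sgn j * (A zero j * top (drop j (wedge (A ∘ suc)))))
      ≈⟨ top-∧ (A zero) (wedge (A ∘ suc)) ⟨
    top (wedge A) ∎

-- Multiplicativity of the determinant.

module Multiplicativity (R : Ring) where
  open CommutativeRing R hiding (zero)
  open RingProperties ring using (-0#≈0#)
  open Sum semiring using (sum; sum-cong-≋; sum-replicate-zero)
  open FromIntegers R using (solve; _:+_; _:*_; _:-_; :-_; _:=_; con)
  open Determinants R
  open SetoidReasoning setoid

  sum-zero : ∀ {n} {f : Fin n → Carrier} → (∀ i → f i ≈ 0#) → sum f ≈ 0#
  sum-zero {n} z = trans (sum-cong-≋ z) (sum-replicate-zero n)

  infixl 7 _⊗_
  _⊗_ : ∀ {l m n} → Matrix l m → Matrix m n → Matrix l n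
  (A ⊗ B) i j = sum (λ k → A i k * B k j)

  -- The algebra homomorphism Ext m → Ext n sending e_i to B i.
  push : ∀ {m n} → Matrix m n → Ext m → Ext n
  push {zero}  B ω s = ω [] * unit s
  push {suc m} B ω s = push (B ∘ suc) (ω ∘ (false ∷_)) s + (B zero ∧ push (B ∘ suc) (ω ∘ (true ∷_))) s

  push-cong : ∀ {m n} (B : Matrix m n) {ω η : Ext m} → (∀ s → ω s ≈ η s) → ∀ s → push B ω s ≈ push B η s
  push-cong {zero}  B p s = *-congʳ (p [])
  push-cong {suc m} B p s = +-cong (push-cong (B ∘ suc) (p ∘ (false ∷_)) s)
                                   (∧-cong (λ _ → refl) (push-cong (B ∘ suc) (p ∘ (true ∷_))) s)

  ∧-plus : ∀ {m} (u : Row m) (ω η : Ext m) s →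
           (u ∧ (λ t → ω t + η t)) s ≈ (u ∧ ω) s + (u ∧ η) s
  ∧-plus u ω η s =
    trans (∧-cong (λ _ → refl) (λ t → +-congʳ (sym (*-identityˡ (ω t)))) s)
          (trans (∧-linearʳ u 1# ω η s) (+-congʳ (*-identityˡ _)))

  push-minus : ∀ {m n} (B : Matrix m n) x (ω η : Ext m) s →
               push B (λ t → x * ω t - η t) s ≈ x * push B ω s - push B η s
  push-minus {zero}  B x ω η s =
    solve 4 (λ x a b u → (x :* a :- b) :* u := x :* (a :* u) :- b :* u) refl x (ω []) (η []) (unit s)
  push-minus {suc m} B x ω η s =
    trans (+-cong (push-minus (B ∘ suc) x _ _ s)
                  (trans (∧-cong (λ _ → refl) (push-minus (B ∘ suc) x _ _) s) (∧-minus (B zero) x _ _ s)))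
          (solve 5 (λ x a b c d → (x :* a :- b) :+ (x :* c :- d) := x :* (a :+ c) :- (b :+ d)) refl x
                 (push (B ∘ suc) (ω ∘ (false ∷_)) s) (push (B ∘ suc) (η ∘ (false ∷_)) s)
                 ((B zero ∧ push (B ∘ suc) (ω ∘ (true ∷_))) s) ((B zero ∧ push (B ∘ suc) (η ∘ (true ∷_))) s))

  -- The homomorphism property of `push`. Both defining relations of the exterior algebra enter:
  -- anticommutativity and vanishing squares.
  push-∧ : ∀ {m n} (B : Matrix m n) (u : Row m) (ω : Ext m) s →
           push B (u ∧ ω) s ≈ ((λ j → sum (λ k → u k * B k j)) ∧ push B ω) s
  push-∧ {zero}  B u ω s = trans (zeroˡ _) (sym (∧-zeroˡ (λ _ → refl) _ s))
  push-∧ {suc m} B u ω s = begin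
    push B⁺ (u⁺ ∧ ω₀) s + (B₀ ∧ push B⁺ (λ t → u₀ * ω₀ t - (u⁺ ∧ ω₁) t)) s
      ≈⟨ +-cong (push-∧ B⁺ u⁺ ω₀ s) (∧-cong (λ _ → refl) (λ t →
           trans (push-minus B⁺ u₀ ω₀ (u⁺ ∧ ω₁) t) (+-congˡ (-‿cong (push-∧ B⁺ u⁺ ω₁ t)))) s) ⟩
    (uB ∧ P₀) s + (B₀ ∧ (λ t → u₀ * P₀ t - (uB ∧ P₁) t)) s
      ≈⟨ +-congˡ (∧-minus B₀ u₀ P₀ (uB ∧ P₁) s) ⟩
    (uB ∧ P₀) s + (u₀ * (B₀ ∧ P₀) s - (B₀ ∧ uB ∧ P₁) s)
      ≈⟨ +-congˡ (+-congˡ (-‿cong (∧-anticomm B₀ uB P₁ s))) ⟩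
    (uB ∧ P₀) s + (u₀ * (B₀ ∧ P₀) s - - (uB ∧ B₀ ∧ P₁) s)
      ≈⟨ solve 4 (λ a x b c → a :+ (x :* b :- (:- c)) := x :* (b :+ con (ℤ.+ 0)) :+ (a :+ c)) refl
               ((uB ∧ P₀) s) u₀ ((B₀ ∧ P₀) s) ((uB ∧ B₀ ∧ P₁) s) ⟩
    -- The `0#` is the place of B₀ ∧ B₀ ∧ P₁, inserted so that u₀ B₀ and uB multiply the same
    -- element P₀ + B₀ ∧ P₁.
    u₀ * ((B₀ ∧ P₀) s + 0#) + ((uB ∧ P₀) s + (uB ∧ B₀ ∧ P₁) s)
      ≈⟨ +-cong (*-congˡ (+-congˡ (∧-square B₀ P₁ s))) (∧-plus uB P₀ (B₀ ∧ P₁) s) ⟨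
    u₀ * ((B₀ ∧ P₀) s + (B₀ ∧ B₀ ∧ P₁) s) + (uB ∧ (λ t → P₀ t + (B₀ ∧ P₁) t)) s
      ≈⟨ +-congʳ (*-congˡ (∧-plus B₀ P₀ (B₀ ∧ P₁) s)) ⟨
    u₀ * (B₀ ∧ (λ t → P₀ t + (B₀ ∧ P₁) t)) s + (uB ∧ (λ t → P₀ t + (B₀ ∧ P₁) t)) s
      ≈⟨ ∧-linearˡ u₀ B₀ uB _ s ⟨
    ((λ j → u₀ * B₀ j + uB j) ∧ (λ t → P₀ t + (B₀ ∧ P₁) t)) s ∎
    where
    u₀ = u zero
    u⁺ = u ∘ suc
    B₀ = B zero
    B⁺ = B ∘ suc
    ω₀ = ω ∘ (false ∷_)
    ω₁ = ω ∘ (true ∷_)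
    P₀ = push B⁺ ω₀
    P₁ = push B⁺ ω₁
    uB : Row _
    uB j = sum (λ k → u⁺ k * B⁺ k j)

  push-0 : ∀ {m n} (B : Matrix m n) s → push B (λ _ → 0#) s ≈ 0#
  push-0 {zero}  B s = zeroˡ _
  push-0 {suc m} B s =
    trans (+-cong (push-0 (B ∘ suc) s) (∧-zeroʳ (B zero) (push-0 (B ∘ suc)) s)) (+-identityʳ _)

  push-unit : ∀ {m n} (B : Matrix m n) s → push B unit s ≈ unit s
  push-unit {zero}  B s = *-identityˡ _
  push-unit {suc m} B s =
    trans (+-cong (push-unit (B ∘ suc) s) (∧-zeroʳ (B zero) (push-0 (B ∘ suc)) s)) (+-identityʳ _)

  wedge-⊗ : ∀ {l m n} (A : Matrix l m) (B : Matrix m n) s → wedge (A ⊗ B) s ≈ push B (wedge A) s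
  wedge-⊗ {zero}  A B s = sym (push-unit B s)
  wedge-⊗ {suc l} A B s =
    trans (∧-cong (λ _ → refl) (wedge-⊗ (A ∘ suc) B) s) (sym (push-∧ B (A zero) (wedge (A ∘ suc)) s))

  weight : ∀ {m} → Vec Bool m → ℕ
  weight []          = 0
  weight (true  ∷ s) = suc (weight s)
  weight (false ∷ s) = weight s

  weight≤ : ∀ {m} (s : Vec Bool m) → weight s ℕ.≤ m
  weight≤ []          = z≤n
  weight≤ (true  ∷ s) = s≤s (weight≤ s)
  weight≤ (false ∷ s) = ℕP.m≤n⇒m≤1+n (weight≤ s)

  ∧-degree : ∀ {m k} (u : Row m) {ω : Ext m} → (∀ s → weight s ℕ.< k → ω s ≈ 0#) →
             ∀ s → weight s ℕ.< suc k → (u ∧ ω) s ≈ 0#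
  ∧-degree u z []          _       = refl
  ∧-degree u z (false ∷ s) l       = ∧-degree (u ∘ suc) (z ∘ (false ∷_)) s l
  ∧-degree {k = suc k} u z (true ∷ s) (s≤s l) =
    trans (+-cong (trans (*-congˡ (z (false ∷ s) l)) (zeroʳ _))
                  (trans (-‿cong (∧-degree (u ∘ suc) (λ t q → z (true ∷ t) (s≤s q)) s l)) -0#≈0#))
          (+-identityʳ _)

  -- A wedge of n rows has no components of degree below n; for a square matrix only the top
  -- coordinate is left.
  wedge-degree : ∀ {n m} (A : Matrix n m) s → weight s ℕ.< n → wedge A s ≈ 0#
  wedge-degree {suc n} A s l = ∧-degree (A zero) (wedge-degree (A ∘ suc)) s l

  push-top : ∀ {m n} (B : Matrix m n) {ω : Ext m} → (∀ s → weight s ℕ.< m → ω s ≈ 0#) →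
             ∀ s → push B ω s ≈ top ω * wedge B s
  push-top {zero}  B z s = refl
  push-top {suc m} B {ω} z s = begin
    push B⁺ (ω ∘ (false ∷_)) s + (B zero ∧ push B⁺ (ω ∘ (true ∷_))) s
      ≈⟨ +-cong (push-cong B⁺ (λ t → z (false ∷ t) (s≤s (weight≤ t))) s)
                (∧-cong (λ _ → refl) (push-top B⁺ (λ t q → z (true ∷ t) (s≤s q))) s) ⟩
    push B⁺ (λ _ → 0#) s + (B zero ∧ (λ t → top ω * wedge B⁺ t)) s
      ≈⟨ +-cong (push-0 B⁺ s) (∧-cong (λ _ → refl) (λ t → sym (+-identityʳ _)) s) ⟩
    0# + (B zero ∧ (λ t → top ω * wedge B⁺ t + 0#)) s
      ≈⟨ +-congˡ (∧-linearʳ (B zero) (top ω) (wedge B⁺) (λ _ → 0#) s) ⟩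
    0# + (top ω * (B zero ∧ wedge B⁺) s + (B zero ∧ (λ _ → 0#)) s)
      ≈⟨ trans (+-identityˡ _) (trans (+-congˡ (∧-zeroʳ (B zero) (λ _ → refl) s)) (+-identityʳ _)) ⟩
    top ω * wedge B s ∎
    where
    B⁺ = B ∘ suc

  det-⊗ : ∀ {n} (A B : Matrix n n) → detᵣ (A ⊗ B) ≈ detᵣ A * detᵣ B
  det-⊗ A B = begin
    detᵣ (A ⊗ B)                  ≈⟨ det-wedge (A ⊗ B) ⟩
    top (wedge (A ⊗ B))          ≈⟨ wedge-⊗ A B _ ⟩
    top (push B (wedge A))       ≈⟨ push-top B (wedge-degree A) _ ⟩
    top (wedge A) * top (wedge B) ≈⟨ *-cong (det-wedge A) (det-wedge B) ⟨
    detᵣ A * detᵣ B                ∎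

-- Determinants with special rows or columns.

module SpecialDeterminants (R : Ring) where
  open CommutativeRing R hiding (zero)
  open Sum semiring using (sum; sum-cong-≋; *-distribˡ-sum)
  open MonoidSum *-commutativeMonoid public using () renaming (sum to prod; sum-cong-≋ to prod-cong; ∑-distrib-+ to prod-distrib-*)
  open FromIntegers R using (solve; _:*_; _:-_; :-_; _:=_)
  open Determinants R
  open Multiplicativity R
  open SetoidReasoning setoid

  sum-single : ∀ {n} (c : Fin n) {f : Fin n → Carrier} → (∀ i → i ≢ c → f i ≈ 0#) → sum f ≈ f c
  sum-single zero    z = trans (+-congˡ (sum-zero (λ i → z (suc i) λ ()))) (+-identityʳ _)
  sum-single (suc c) z =
    trans (+-cong (z zero λ ()) (sum-single c (λ i i≢c → z (suc i) (i≢c ∘ FinP.suc-injective)))) (+-identityˡ _)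

  laplaceTerm : ∀ {d} → Matrix (suc d) (suc d) → Fin (suc d) → Carrier
  laplaceTerm A j = sgn j * (A zero j * detᵣ (minor A j))

  laplaceTerm-entry : ∀ {d} (A : Matrix (suc d) (suc d)) j → A zero j ≈ 0# → laplaceTerm A j ≈ 0#
  laplaceTerm-entry A j z = trans (*-congˡ (trans (*-congʳ z) (zeroˡ _))) (zeroʳ _)

  laplaceTerm-minor : ∀ {d} (A : Matrix (suc d) (suc d)) j → detᵣ (minor A j) ≈ 0# → laplaceTerm A j ≈ 0#
  laplaceTerm-minor A j z = trans (*-congˡ (trans (*-congˡ z) (zeroʳ _))) (zeroʳ _)

  det-row₀ : ∀ {d} (A : Matrix (suc d) (suc d)) c → (∀ j → j ≢ c → A zero j ≈ 0#) →
             detᵣ A ≈ sgn c * (A zero c * detᵣ (minor A c))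
  det-row₀ A c z = sum-single c {f = laplaceTerm A} (λ j j≢c → laplaceTerm-entry A j (z j j≢c))

  det-lower : ∀ {d} (A : Matrix d d) → (∀ i j → i Fin.< j → A i j ≈ 0#) → detᵣ A ≈ prod (λ i → A i i)
  det-lower {zero}  A z = refl
  det-lower {suc d} A z = begin
    detᵣ A
      ≈⟨ det-row₀ A zero (λ { zero 0≢0 → contradiction ≡.refl 0≢0 ; (suc j) _ → z zero (suc j) (s≤s z≤n) }) ⟩
    1# * (A zero zero * detᵣ (minor A zero))
      ≈⟨ *-identityˡ _ ⟩
    A zero zero * detᵣ (minor A zero)
      ≈⟨ *-congˡ (det-lower (minor A zero) (λ i j i<j → z (suc i) (suc j) (s≤s i<j))) ⟩
    A zero zero * prod (λ i → A (suc i) (suc i)) ∎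

  det-zeroRow : ∀ {d} (A : Matrix d d) i → (∀ j → A i j ≈ 0#) → detᵣ A ≈ 0#
  det-zeroRow A zero    z = sum-zero {f = laplaceTerm A} (λ j → laplaceTerm-entry A j (z j))
  det-zeroRow {suc (suc d)} A (suc i) z = sum-zero {f = laplaceTerm A} (λ j →
    laplaceTerm-minor A j (det-zeroRow (minor A j) i (λ b → z (punchIn j b))))

  -- As the expansion is along rows, this needs an induction: the zero column stays column 0 of
  -- every minor except that of column 0, whose term has a zero entry as factor.
  det-zeroCol₀ : ∀ {d} (A : Matrix (suc d) (suc d)) → (∀ i → A i zero ≈ 0#) → detᵣ A ≈ 0#
  det-zeroCol₀ {d} A z = sum-zero {f = laplaceTerm A} (go d A z)
    where
    go : ∀ d (A : Matrix (suc d) (suc d)) → (∀ i → A i zero ≈ 0#) → ∀ j → laplaceTerm A j ≈ 0#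
    go d       A z zero    = laplaceTerm-entry A zero (z zero)
    go (suc d) A z (suc j) = laplaceTerm-minor A (suc j)
      (sum-zero {f = laplaceTerm (minor A (suc j))} (go d (minor A (suc j)) (λ i → z (suc i))))

  -- In the expansion along the first row, the minor of column 0 has a zero last row. The other
  -- terms form the same expansion of the complementary block, shifted by one column, so each row
  -- passed contributes a sign.
  det-lastRow : ∀ {d} (A : Matrix (suc d) (suc d)) → (∀ j → A (fromℕ d) (suc j) ≈ 0#) →
                detᵣ A ≈ sgn (fromℕ d) * (A (fromℕ d) zero * detᵣ (λ a b → A (inject₁ a) (suc b)))
  det-lastRow {zero}  A z = +-identityʳ _
  det-lastRow {suc d} A z = begin
    1# * (A zero zero * detᵣ (minor A zero)) + sum (λ j → - sgn j * (A zero (suc j) * detᵣ (minor A (suc j))))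
      ≈⟨ +-cong (laplaceTerm-minor A zero (det-zeroRow (minor A zero) (fromℕ d) z))
                (sum-cong-≋ λ j → trans
                  (*-congˡ {x = - sgn j} (*-congˡ {x = A zero (suc j)} (det-lastRow (minor A (suc j)) (λ b → z (punchIn j b)))))
                  (solve 5 (λ s a t l m → (:- s) :* (a :* (t :* (l :* m))) := (:- t :* l) :* (s :* (a :* m)))
                         refl (sgn j) (A zero (suc j)) (sgn (fromℕ d)) ℓ (detᵣ (minor B j)))) ⟩
    0# + sum (λ j → (- sgn (fromℕ d) * ℓ) * (sgn j * (A zero (suc j) * detᵣ (minor B j))))
      ≈⟨ +-identityˡ _ ⟩
    sum (λ j → (- sgn (fromℕ d) * ℓ) * (sgn j * (B zero j * detᵣ (minor B j))))
      ≈⟨ *-distribˡ-sum (- sgn (fromℕ d) * ℓ) (λ j → sgn j * (B zero j * detᵣ (minor B j))) ⟨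
    (- sgn (fromℕ d) * ℓ) * detᵣ B
      ≈⟨ *-assoc _ _ _ ⟩
    - sgn (fromℕ d) * (ℓ * detᵣ B) ∎
    where
    ℓ = A (fromℕ (suc d)) zero
    B : Matrix (suc d) (suc d)
    B a b = A (inject₁ a) (suc b)

-- Non-zero-divisors.

module Regularity (R : Ring) where
  open CommutativeRing R hiding (zero)
  open SpecialDeterminants R using (prod)
  open Exp semiring using (_^_)

  Regular : Carrier → Set
  Regular a = ∀ b → a * b ≈ 0# → b ≈ 0#

  regular-resp : ∀ {a b} → a ≈ b → Regular a → Regular b
  regular-resp a≈b reg c bc≈0 = reg c (trans (*-congʳ a≈b) bc≈0)

  regular-1 : Regular 1#
  regular-1 b e = trans (sym (*-identityˡ b)) e

  regular-* : ∀ {a b} → Regular a → Regular b → Regular (a * b)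
  regular-* ra rb c e = rb c (ra _ (trans (sym (*-assoc _ _ c)) e))

  regular-prod : ∀ {n} {f : Fin n → Carrier} → (∀ i → Regular (f i)) → Regular (prod f)
  regular-prod {zero}  r = regular-1
  regular-prod {suc n} r = regular-* (r zero) (regular-prod (r ∘ suc))

  regular-^ : ∀ {a} n → Regular a → Regular (a ^ n)
  regular-^ zero    r = regular-1
  regular-^ (suc n) r = regular-* r (regular-^ n r)

  regular-neg : ∀ {a} → Regular a → Regular (- a)
  regular-neg {a} r b e = r b (trans (solve 2 (λ a b → a :* b := :- (:- a :* b)) refl a b) (trans (-‿cong e) -0#≈0#))
    where
    open FromIntegers R using (solve; _:*_; :-_; _:=_)
    open RingProperties ring using (-0#≈0#)

-- Equality up to nonzero constants of the prime field.

HasCharacteristic : Ring → ℕ → Set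
HasCharacteristic R p = p · 1# ≈ 0#
  where
  open CommutativeRing R
  open Mult semiring renaming (_×_ to _·_)

module Scalars (R : Ring) (p : ℕ) (p-prime : Prime p)
  (char : HasCharacteristic R p) where
  open CommutativeRing R hiding (zero)
  open RingProperties ring using (-‿distribˡ-*; +-inverseˡ-unique)
  open Mult semiring renaming (_×_ to _·_)
  open Exp semiring using (_^_)
  open FromIntegers R using (solve; _:+_; _:*_; _:-_; :-_; _:=_)
  open Determinants R
  open SpecialDeterminants R
  open Regularity R
  open SetoidReasoning setoid

  -- An element of the image of 𝔽_p^×, with a representative that can serve as the integer ε in
  -- `InA`.
  record Scalar (x : Carrier) : Set where
    constructor scalar
    field
      value   : ℕ
      p∤value : p ∤ value
      x≈value : x ≈ value · 1#

  p≢1 : p ≢ 1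
  p≢1 ≡.refl with prime⇒nonTrivial p-prime
  ... | ()

  scalar-1 : Scalar 1#
  scalar-1 = scalar 1 (λ p∣1 → p≢1 (ℕD.∣1⇒≡1 p∣1)) (sym (+-identityʳ _))

  scalar-resp : ∀ {x y} → x ≈ y → Scalar x → Scalar y
  scalar-resp e (scalar n p∤n x≈n) = scalar n p∤n (trans (sym e) x≈n)

  scalar-* : ∀ {x y} → Scalar x → Scalar y → Scalar (x * y)
  scalar-* (scalar m p∤m x≈m) (scalar n p∤n y≈n) =
    scalar (m ℕ.* n) ([ p∤m , p∤n ]′ ∘ euclidsLemma m n p-prime)
           (trans (*-cong x≈m y≈n) (sym (×1-homo-* m n)))

  scalar-neg : ∀ {x} → Scalar x → Scalar (- x)
  scalar-neg {x} s = scalar-resp (trans (sym (-‿distribˡ-* 1# x)) (-‿cong (*-identityˡ x))) (scalar-* minusOne s)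
    where
    q = ℕ.pred p
    instance
      p≢0 : NonZero p
      p≢0 = prime⇒nonZero p-prime
    1+q≡p : suc q ≡ p
    1+q≡p = ℕP.suc-pred p
    minusOne : Scalar (- 1#)
    minusOne = scalar q
      (λ p∣q → p≢1 (ℕD.∣1⇒≡1 (ℕD.∣m+n∣m⇒∣n (≡.subst (p ∣_) (≡.trans (≡.sym 1+q≡p) (ℕP.+-comm 1 q)) ℕD.∣-refl) p∣q)))
      (sym (inverseʳ-unique′ (trans (reflexive (≡.cong (_· 1#) 1+q≡p)) char)))
      where
      inverseʳ-unique′ : ∀ {y} → 1# + y ≈ 0# → y ≈ - 1#
      inverseʳ-unique′ {y} e = +-inverseˡ-unique y 1# (trans (+-comm _ _) e)

  scalar-sgn : ∀ {n} (j : Fin n) → Scalar (sgn j)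
  scalar-sgn zero    = scalar-1
  scalar-sgn (suc j) = scalar-neg (scalar-sgn j)

  scalar-prod : ∀ {n} {f : Fin n → Carrier} → (∀ i → Scalar (f i)) → Scalar (prod f)
  scalar-prod {zero}  s = scalar-1
  scalar-prod {suc n} s = scalar-* (s zero) (scalar-prod (s ∘ suc))

  -- A Bézout relation between `n` and `p` gives u n ≡ 1 or u n ≡ -1 mod p; in the second case the
  -- inverse is -u.
  scalar-inverse : ∀ {x} → Scalar x → Σ Carrier λ y → Scalar y × y * x ≈ 1#
  scalar-inverse {x} (scalar n p∤n x≈n) with coprime-Bézout coprime
    where
    coprime : Coprime n p
    coprime (d∣n , d∣p) with prime⇒irreducible p-prime d∣p
    ... | inj₁ d≡1    = d≡1
    ... | inj₂ ≡.refl = contradiction d∣n p∤n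
  ... | Bézout.+- u v 1+vp≡un = u · 1# , scalar u p∤u refl , ux≈1
    where
    p∤u : p ∤ u
    p∤u p∣u = p≢1 (ℕD.∣1⇒≡1 (ℕD.∣m+n∣m⇒∣n
      (≡.subst (p ∣_) (≡.trans (≡.sym 1+vp≡un) (ℕP.+-comm 1 (v ℕ.* p))) (ℕD.∣m⇒∣m*n n p∣u)) (ℕD.n∣m*n v)))
    ux≈1 : u · 1# * x ≈ 1#
    ux≈1 = begin
      u · 1# * x                     ≈⟨ *-congˡ x≈n ⟩
      u · 1# * (n · 1#)              ≈⟨ ×1-homo-* u n ⟨
      (u ℕ.* n) · 1#                 ≡⟨ ≡.cong (_· 1#) 1+vp≡un ⟨
      1# + (v ℕ.* p) · 1#            ≈⟨ +-congˡ (trans (×1-homo-* v p) (trans (*-congˡ char) (zeroʳ _))) ⟩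
      1# + 0#                        ≈⟨ +-identityʳ _ ⟩
      1#                             ∎
  ... | Bézout.-+ u v 1+un≡vp = - (u · 1#) , scalar-neg (scalar u p∤u refl) , trans (sym (-‿distribˡ-* _ _))
      (trans (-‿cong ux≈-1) (solve 1 (λ a → :- (:- a) := a) refl 1#))
    where
    p∤u : p ∤ u
    p∤u p∣u = p≢1 (ℕD.∣1⇒≡1 (ℕD.∣m+n∣m⇒∣n
      (≡.subst (p ∣_) (≡.trans (≡.sym 1+un≡vp) (ℕP.+-comm 1 (u ℕ.* n))) (ℕD.n∣m*n v)) (ℕD.∣m⇒∣m*n n p∣u)))
    ux≈-1 : u · 1# * x ≈ - 1#
    ux≈-1 = +-inverseˡ-unique _ _ (begin
      u · 1# * x + 1#                ≈⟨ +-congʳ (trans (*-congˡ x≈n) (sym (×1-homo-* u n))) ⟩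
      (u ℕ.* n) · 1# + 1#            ≈⟨ +-comm _ _ ⟩
      (suc (u ℕ.* n)) · 1#           ≡⟨ ≡.cong (_· 1#) 1+un≡vp ⟩
      (v ℕ.* p) · 1#                 ≈⟨ trans (×1-homo-* v p) (trans (*-congˡ char) (zeroʳ _)) ⟩
      0#                             ∎)

  infix 4 _~_
  _~_ : Carrier → Carrier → Set
  a ~ b = Σ Carrier λ s → Scalar s × a ≈ s * b

  ≈⇒~ : ∀ {a b} → a ≈ b → a ~ b
  ≈⇒~ e = 1# , scalar-1 , trans e (sym (*-identityˡ _))

  ~-refl : ∀ {a} → a ~ a
  ~-refl = ≈⇒~ refl

  ~-trans : ∀ {a b c} → a ~ b → b ~ c → a ~ c
  ~-trans (s , Ss , e) (t , St , f) = s * t , scalar-* Ss St , trans e (trans (*-congˡ f) (sym (*-assoc _ _ _)))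

  ~-sym : ∀ {a b} → a ~ b → b ~ a
  ~-sym {a} {b} (s , Ss , e) with scalar-inverse Ss
  ... | t , St , ts≈1 = t , St , (begin
    b              ≈⟨ *-identityˡ b ⟨
    1# * b         ≈⟨ *-congʳ ts≈1 ⟨
    t * s * b      ≈⟨ *-assoc _ _ _ ⟩
    t * (s * b)    ≈⟨ *-congˡ e ⟨
    t * a          ∎)

  ~-* : ∀ {a b c d} → a ~ b → c ~ d → a * c ~ b * d
  ~-* {a} {b} {c} {d} (s , Ss , e) (t , St , f) = s * t , scalar-* Ss St ,
    trans (*-cong e f) (solve 4 (λ s b t d → (s :* b) :* (t :* d) := (s :* t) :* (b :* d)) refl s b t d)

  ~-^ : ∀ {a b} n → a ~ b → a ^ n ~ b ^ n
  ~-^ zero    e = ~-refl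
  ~-^ (suc n) e = ~-* e (~-^ n e)

  ~-scalar : ∀ {s a} → Scalar s → s * a ~ a
  ~-scalar {s} Ss = s , Ss , refl

  ~-cancelˡ : ∀ {a b c} → Regular a → a * b ~ a * c → b ~ c
  ~-cancelˡ {a} {b} {c} reg (s , Ss , e) = s , Ss , (begin
    b                    ≈⟨ solve 2 (λ b t → b := (b :- t) :+ t) refl b (s * c) ⟩
    (b - s * c) + s * c  ≈⟨ +-congʳ (reg _ (trans (solve 4 (λ a b s c → a :* (b :- s :* c) := a :* b :- s :* (a :* c)) refl a b s c)
                                                 (trans (+-congʳ e) (-‿inverseʳ _)))) ⟩
    0# + s * c           ≈⟨ +-identityˡ _ ⟩
    s * c                ∎)

-- Degrees, coefficients of products, and the derivation of power series.

module SeriesTools (R : Ring) where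
  open CommutativeRing R hiding (zero)
  open RingProperties ring using (-0#≈0#)
  open Sum semiring using (sum; sum-cong-≋)
  open Mult semiring using (×-congʳ; ×-comm-*) renaming (_×_ to _·_)
  open CMult +-commutativeMonoid using (×-distrib-+)
  open PowerSeries R public
  open FromIntegers R using (solve; _:+_; _:=_; con)
  module S = CommutativeRing seriesRing
  module SSum = Sum S.semiring
  module SMult = Mult S.semiring
  module SExp = Exp S.semiring
  open SetoidReasoning setoid

  X : Series Carrier
  coef X zero          = 0#
  coef X (suc zero)    = 1#
  coef X (suc (suc _)) = 0#

  X*-zero : ∀ a → coef (X *ₛ a) 0 ≈ 0#
  X*-zero a = zeroˡ _

  X*-suc : ∀ a k → coef (X *ₛ a) (suc k) ≈ coef a k
  X*-suc a k = trans (+-cong (zeroˡ _) (trans (conv-constˡ (coef a) (λ _ → refl) k) (*-identityˡ _))) (+-identityˡ _)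

  C*-coeff : ∀ x a k → coef (C x *ₛ a) k ≈ x * coef a k
  C*-coeff x a k = conv-constˡ (coef a) (λ _ → refl) k

  C-cong : ∀ {x y} → x ≈ y → C x ≈ₛ C y
  C-cong e = pointwise λ { zero → e ; (suc k) → refl }

  C-* : ∀ x y → C (x * y) ≈ₛ C x *ₛ C y
  C-* x y = pointwise λ { zero → refl ; (suc k) → sym (trans (C*-coeff x (C y) (suc k)) (zeroʳ x)) }

  C-+ : ∀ x y → C (x + y) ≈ₛ C x +ₛ C y
  C-+ x y = pointwise λ { zero → refl ; (suc k) → sym (+-identityˡ 0#) }

  C-neg : ∀ x → C (- x) ≈ₛ -ₛ C x
  C-neg x = pointwise λ { zero → refl ; (suc k) → sym -0#≈0# }

  coeff-0 : ∀ k → coef S.0# k ≈ 0#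
  coeff-0 zero    = refl
  coeff-0 (suc k) = refl

  coeff-sum : ∀ {n} (f : Fin n → Series Carrier) k → coef (SSum.sum f) k ≈ sum (λ i → coef (f i) k)
  coeff-sum {zero}  f k = coeff-0 k
  coeff-sum {suc n} f k = +-congˡ (coeff-sum (f ∘ suc) k)

  coeff-· : ∀ n a k → coef (n SMult.× a) k ≈ n · coef a k
  coeff-· zero    a k = coeff-0 k
  coeff-· (suc n) a k = +-congˡ (coeff-· n a k)

  tail : Series Carrier → Series Carrier
  coef (tail a) k = coef a (suc k)

  head-tail : ∀ a → a ≈ₛ C (coef a 0) +ₛ X *ₛ tail a
  head-tail a = pointwise λ
    { zero    → sym (trans (+-congˡ (X*-zero (tail a))) (+-identityʳ _))
    ; (suc k) → sym (trans (+-congˡ (X*-suc (tail a) k)) (+-identityˡ _)) }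

  X^*-+ : ∀ n a k → coef (X SExp.^ n *ₛ a) (n ℕ.+ k) ≈ coef a k
  X^*-+ zero    a k = at (S.*-identityˡ a) k
  X^*-+ (suc n) a k = begin
    coef (X *ₛ X SExp.^ n *ₛ a) (suc (n ℕ.+ k))    ≈⟨ at (S.*-assoc X (X SExp.^ n) a) (suc (n ℕ.+ k)) ⟩
    coef (X *ₛ (X SExp.^ n *ₛ a)) (suc (n ℕ.+ k))  ≈⟨ X*-suc (X SExp.^ n *ₛ a) (n ℕ.+ k) ⟩
    coef (X SExp.^ n *ₛ a) (n ℕ.+ k)               ≈⟨ X^*-+ n a k ⟩
    coef a k                                       ∎

  X^*-< : ∀ n a {k} → k < n → coef (X SExp.^ n *ₛ a) k ≈ 0#
  X^*-< (suc n) a {zero} l = trans (at (S.*-assoc X (X SExp.^ n) a) 0) (X*-zero (X SExp.^ n *ₛ a))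
  X^*-< (suc n) a {suc k} (s≤s l) = begin
    coef (X *ₛ X SExp.^ n *ₛ a) (suc k)    ≈⟨ at (S.*-assoc X (X SExp.^ n) a) (suc k) ⟩
    coef (X *ₛ (X SExp.^ n *ₛ a)) (suc k)  ≈⟨ X*-suc (X SExp.^ n *ₛ a) k ⟩
    coef (X SExp.^ n *ₛ a) k               ≈⟨ X^*-< n a l ⟩
    0#                                      ∎

  X^*-≥ : ∀ n a {k} → n ≤ k → coef (X SExp.^ n *ₛ a) k ≈ coef a (k ∸ n)
  X^*-≥ n a {k} l = trans (reflexive (≡.cong (coef (X SExp.^ n *ₛ a)) (≡.sym (ℕP.m+[n∸m]≡n l)))) (X^*-+ n a (k ∸ n))

  -- Here `α` may be 0, so `n` is only a bound for the degree; in this form the notion passes to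
  -- sums and products over any ring.
  record HasTop (a : Series Carrier) (n : ℕ) (α : Carrier) : Set where
    constructor hasTop
    field
      above : ∀ k → n < k → coef a k ≈ 0#
      atTop : coef a n ≈ α
  open HasTop public

  hasTop-resp : ∀ {a b n α β} → a ≈ₛ b → α ≈ β → HasTop a n α → HasTop b n β
  hasTop-resp e f t = hasTop (λ k l → trans (sym (at e k)) (above t k l)) (trans (sym (at e _)) (trans (atTop t) f))

  hasTop-C : ∀ x → HasTop (C x) 0 x
  hasTop-C x = hasTop (λ { (suc k) _ → refl }) refl

  hasTop-+ : ∀ {a b n α β} → HasTop a n α → HasTop b n β → HasTop (a +ₛ b) n (α + β)
  hasTop-+ s t = hasTop (λ k l → trans (+-cong (above s k l) (above t k l)) (+-identityˡ _)) (+-cong (atTop s) (atTop t))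

  hasTop-* : ∀ {a b m n α β} → HasTop a m α → HasTop b n β → HasTop (a *ₛ b) (m ℕ.+ n) (α * β)
  hasTop-* {a} {b} {m} {n} s t = hasTop
    (λ k l → conv-above m n (above s) (above t) k l)
    (trans (conv-top m n (above s) (above t)) (*-cong (atTop s) (atTop t)))
    where
    conv-above : ∀ m n {a b : ℕ → Carrier} → (∀ k → m < k → a k ≈ 0#) → (∀ k → n < k → b k ≈ 0#) →
                 ∀ k → m ℕ.+ n < k → conv a b k ≈ 0#
    conv-above zero    n {a} {b} p q k       l       =
      trans (conv-constˡ b (λ i → p (suc i) (s≤s z≤n)) k) (trans (*-congˡ (q k l)) (zeroʳ _))
    conv-above (suc m) n {a} {b} p q (suc k) (s≤s l) =
      trans (+-cong (trans (*-congˡ (q (suc k) (s≤s (ℕP.≤-trans (ℕP.m≤n+m n m) (ℕP.<⇒≤ l))))) (zeroʳ _))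
                    (conv-above m n (λ i r → p (suc i) (s≤s r)) q k l))
            (+-identityˡ _)
    conv-top : ∀ m n {a b : ℕ → Carrier} → (∀ k → m < k → a k ≈ 0#) → (∀ k → n < k → b k ≈ 0#) →
               conv a b (m ℕ.+ n) ≈ a m * b n
    conv-top zero    n {a} {b} p q = conv-constˡ b (λ i → p (suc i) (s≤s z≤n)) n
    conv-top (suc m) n {a} {b} p q =
      trans (+-cong (trans (*-congˡ (q (suc (m ℕ.+ n)) (s≤s (ℕP.m≤n+m n m)))) (zeroʳ _))
                    (conv-top m n (λ i r → p (suc i) (s≤s r)) q))
            (+-identityˡ _)

  hasTop-^ : ∀ {a n} e → HasTop a n 1# → HasTop (a SExp.^ e) (e ℕ.* n) 1#
  hasTop-^ zero    t = hasTop-C 1#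
  hasTop-^ (suc e) t = hasTop-resp S.refl (*-identityˡ _) (hasTop-* t (hasTop-^ e t))

  X-top : HasTop X 1 1#
  X-top = hasTop (λ { (suc zero) (s≤s ()) ; (suc (suc k)) _ → refl }) refl

  X^-top : ∀ k → HasTop (X SExp.^ k) k 1#
  X^-top k = ≡.subst (λ i → HasTop (X SExp.^ k) i 1#) (ℕP.*-identityʳ k) (hasTop-^ k X-top)

  lin : Carrier → Series Carrier
  lin z = X S.- C z

  lin-top : ∀ z → HasTop (lin z) 1 1#
  lin-top z = hasTop (λ { (suc zero) (s≤s ()) ; (suc (suc k)) _ → trans (+-identityˡ _) -0#≈0# })
                     (trans (+-congˡ -0#≈0#) (+-identityʳ _))

  -- The products of the matrices M_d with columns of coefficients are computed by this: a row times
  -- a column listed from the leading coefficient downwards is one coefficient of a product of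
  -- series.
  expand : ∀ n g h N → (∀ k → n < k → coef g k ≈ 0#) →
           sum {suc n} (λ c → coef (X SExp.^ (n ∸ toℕ c) *ₛ h) N * coef g (n ∸ toℕ c)) ≈ coef (g *ₛ h) N
  expand n g h N above-n = begin
    sum {suc n} (λ c → coef (X SExp.^ (n ∸ toℕ c) *ₛ h) N * coef g (n ∸ toℕ c))
      ≈⟨ sum-cong-≋ {suc n} (λ c → term (n ∸ toℕ c)) ⟩
    sum {suc n} (λ c → coef (mono (n ∸ toℕ c) *ₛ h) N)
      ≈⟨ coeff-sum {suc n} (λ c → mono (n ∸ toℕ c) *ₛ h) N ⟨
    coef (SSum.sum {suc n} (λ c → mono (n ∸ toℕ c) *ₛ h)) N
      ≈⟨ at (SSum.*-distribʳ-sum {suc n} h (λ c → mono (n ∸ toℕ c))) N ⟨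
    coef (SSum.sum {suc n} (λ c → mono (n ∸ toℕ c)) *ₛ h) N
      ≈⟨ at (S.*-congʳ {h} {SSum.sum {suc n} (λ c → mono (n ∸ toℕ c))} {g} (pointwise trunc-all)) N ⟩
    coef (g *ₛ h) N ∎
    where
    mono : ℕ → Series Carrier
    mono k = C (coef g k) *ₛ X SExp.^ k

    term : ∀ k → coef (X SExp.^ k *ₛ h) N * coef g k ≈ coef (mono k *ₛ h) N
    term k = trans (*-comm _ _) (trans (sym (C*-coeff (coef g k) (X SExp.^ k *ₛ h) N))
                                       (at (S.sym (S.*-assoc (C (coef g k)) (X SExp.^ k) h)) N))

    mono-coeff : ∀ k i → coef (mono k) i ≈ coef g k * coef (X SExp.^ k *ₛ S.1#) i
    mono-coeff k i = trans (C*-coeff (coef g k) (X SExp.^ k) i)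
                           (*-congˡ (at (S.sym (S.*-identityʳ (X SExp.^ k))) i))

    mono-eq : ∀ k → coef (mono k) k ≈ coef g k
    mono-eq k = trans (mono-coeff k k) (trans (*-congˡ (trans (X^*-≥ k S.1# ℕP.≤-refl)
      (reflexive (≡.cong (coef S.1#) (ℕP.n∸n≡0 k))))) (*-identityʳ _))

    mono-≢ : ∀ k i → i ≢ k → coef (mono k) i ≈ 0#
    mono-≢ k i i≢k with ℕP.<-cmp i k
    ... | tri< i<k _ _ = trans (mono-coeff k i) (trans (*-congˡ (X^*-< k S.1# i<k)) (zeroʳ _))
    ... | tri≈ _ i≡k _ = contradiction i≡k i≢k
    ... | tri> _ _ k<i = trans (mono-coeff k i) (trans (*-congˡ (trans (X^*-≥ k S.1# (ℕP.<⇒≤ k<i)) (one (ℕP.m<n⇒0<n∸m k<i)))) (zeroʳ _))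
      where
      one : ∀ {j} → 0 < j → coef S.1# j ≈ 0#
      one {suc j} _ = refl

    trunc : ∀ n i → (i ≤ n → coef (SSum.sum {suc n} (λ c → mono (n ∸ toℕ c))) i ≈ coef g i)
                  × (n < i → coef (SSum.sum {suc n} (λ c → mono (n ∸ toℕ c))) i ≈ 0#)
    trunc zero    i = (λ { z≤n → trans (+-congˡ refl) (trans (+-identityʳ _) (mono-eq 0)) })
                    , (λ l → trans (+-cong (mono-≢ 0 i (λ e → ℕP.<⇒≢ l (≡.sym e))) (coeff-0 i)) (+-identityʳ _))
    trunc (suc n) i = low , (λ l → trans (+-cong (mono-≢ (suc n) i (λ e → ℕP.<⇒≢ l (≡.sym e))) (proj₂ (trunc n i) (ℕP.<⇒≤ l))) (+-identityʳ _))
      where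
      low : i ≤ suc n → coef (SSum.sum {suc (suc n)} (λ c → mono (suc n ∸ toℕ c))) i ≈ coef g i
      low l with i ℕ.≟ suc n
      ... | yes ≡.refl = trans (+-cong (mono-eq i) (proj₂ (trunc n i) ℕP.≤-refl)) (+-identityʳ _)
      ... | no  i≢1+n  = trans (+-cong (mono-≢ (suc n) i i≢1+n) (proj₁ (trunc n i) (ℕP.≤-pred (ℕP.≤∧≢⇒< l i≢1+n)))) (+-identityˡ _)

    trunc-all : ∀ i → coef (SSum.sum {suc n} (λ c → mono (n ∸ toℕ c))) i ≈ coef g i
    trunc-all i with i ℕ.≤? n
    ... | yes l = proj₁ (trunc n i) l
    ... | no ¬l = trans (proj₂ (trunc n i) (ℕP.≰⇒> ¬l)) (sym (above-n i (ℕP.≰⇒> ¬l)))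

  -- θ is x d/dx, preferred to d/dx since it does not shift coefficients.
  θ : Series Carrier → Series Carrier
  coef (θ a) k = k · coef a k

  θ-* : ∀ a b → θ (a *ₛ b) ≈ₛ θ a *ₛ b +ₛ a *ₛ θ b
  θ-* a b = pointwise (conv-θ (coef a) (coef b))
    where
    conv-θ : ∀ a b k → k · conv a b k ≈ conv (λ i → i · a i) b k + conv a (λ i → i · b i) k
    conv-θ a b zero    = sym (trans (+-cong (zeroˡ _) (zeroʳ _)) (+-identityˡ _))
    conv-θ a b (suc k) = begin
      suc k · (a 0 * b (suc k) + A)
        ≈⟨ ×-distrib-+ (a 0 * b (suc k)) A (suc k) ⟩
      suc k · (a 0 * b (suc k)) + (A + k · A)
        ≈⟨ +-cong (sym (×-comm-* (suc k) (a 0) (b (suc k)))) (+-congˡ (conv-θ (a ∘ suc) b k)) ⟩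
      a 0 * (suc k · b (suc k)) + (A + (conv (λ i → i · a (suc i)) b k + A′))
        ≈⟨ solve 4 (λ x a t a′ → x :+ (a :+ (t :+ a′)) := (con (ℤ.+ 0) :+ (a :+ t)) :+ (x :+ a′)) refl _ A _ A′ ⟩
      (0# + (A + conv (λ i → i · a (suc i)) b k)) + (a 0 * (suc k · b (suc k)) + A′)
        ≈⟨ +-congʳ (+-cong (zeroˡ _) (conv-distribʳ b (a ∘ suc) (λ i → i · a (suc i)) k)) ⟨
      (0# * b (suc k) + conv (λ i → suc i · a (suc i)) b k) + (a 0 * (suc k · b (suc k)) + A′) ∎
      where
      A = conv (a ∘ suc) b k
      A′ = conv (a ∘ suc) (λ i → i · b i) k

  θ-cong : ∀ {a b} → a ≈ₛ b → θ a ≈ₛ θ b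
  θ-cong e = pointwise (λ k → ×-congʳ k (at e k))

  ·-0 : ∀ n → n · 0# ≈ 0#
  ·-0 zero    = refl
  ·-0 (suc n) = trans (+-identityˡ _) (·-0 n)

  θ-lin : ∀ z → θ (lin z) ≈ₛ X
  θ-lin z = pointwise λ
    { zero          → refl
    ; (suc zero)    → trans (+-identityʳ _) (atTop (lin-top z))
    ; (suc (suc k)) → trans (×-congʳ (suc (suc k)) (above (lin-top z) (suc (suc k)) (s≤s (s≤s z≤n)))) (·-0 (suc (suc k))) }

  θ-^ : ∀ a e → θ (a SExp.^ suc e) ≈ₛ (suc e SMult.× S.1#) *ₛ (a SExp.^ e *ₛ θ a)
  θ-^ a zero = S.trans (θ-cong (S.*-identityʳ a))
    (S.sym (S.trans (S.*-cong (S.+-identityʳ S.1#) (S.*-identityˡ (θ a))) (S.*-identityˡ (θ a))))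
  θ-^ a (suc e) = S.trans (θ-* a (a SExp.^ suc e)) (S.trans
    (S.+-cong (S.sym (S.*-identityˡ _)) (S.*-congˡ (θ-^ a e)))
    (solveₛ 5 (λ o t a b n → o ⊡ (t ⊡ (a ⊡ b)) ⊞ a ⊡ (n ⊡ (b ⊡ t)) ⊜ (o ⊞ n) ⊡ ((a ⊡ b) ⊡ t))
            S.refl S.1# (θ a) a (a SExp.^ e) (suc e SMult.× S.1#)))
    where open FromIntegers seriesRing using () renaming (solve to solveₛ; _:+_ to infixl 6 _⊞_; _:*_ to infixl 7 _⊡_; _:=_ to infix 4 _⊜_)

-- Binomial coefficients modulo a prime.

module PrimeBinomials (p : ℕ) (p-prime : Prime p) where

  p∤k! : ∀ {k} → k < p → p ∤ k !
  p∤k! {zero}  l p∣1 with ≡.refl ← ℕD.∣1⇒≡1 p∣1 | () ← prime⇒nonTrivial p-prime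
  p∤k! {suc k} l p∣ = [ (λ p∣1+k → ℕP.<⇒≱ l (ℕD.∣⇒≤ p∣1+k)) , p∤k! (ℕP.<⇒≤ l) ]′
                      (euclidsLemma (suc k) (k !) p-prime p∣)

  nCk-factorials : ∀ {n k} → k ≤ n → (n Comb.C k) ℕ.* (k ! ℕ.* (n ∸ k) !) ≡ n !
  nCk-factorials {n} {k} k≤n =
    ≡.trans (≡.cong (ℕ._* (k ! ℕ.* (n ∸ k) !)) (nCk≡n!/k![n-k]! k≤n)) (m/n*n≡m (k![n∸k]!∣n! k≤n))
    where instance
      _ = ℕP._!*_!≢0 k (n ∸ k)

  -- The prime divides p! = C(p, k) k! (p - k)!, but neither of the two factorials on the right.
  p∣pCk : ∀ {k} → 0 < k → k < p → p ∣ (p Comb.C k)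
  p∣pCk {k} 0<k k<p with euclidsLemma (p Comb.C k) (k ! ℕ.* (p ∸ k) !) p-prime
    (≡.subst (p ∣_) (≡.sym (nCk-factorials (ℕP.<⇒≤ k<p))) (p∣p! k<p))
    where
    p∣p! : ∀ {k p} → k < p → p ∣ p !
    p∣p! {p = suc q} _ = ℕD.m∣m*n (q !)
  ... | inj₁ d = d
  ... | inj₂ d = contradiction (euclidsLemma (k !) ((p ∸ k) !) p-prime d)
      [ p∤k! k<p , p∤k! (ℕP.∸-monoʳ-< 0<k (ℕP.<⇒≤ k<p)) ]′

  p∤nCk : ∀ {n k} → k ≤ n → n < p → p ∤ (n Comb.C k)
  p∤nCk {n} {k} k≤n n<p d = p∤k! n<p (≡.subst (p ∣_) (nCk-factorials k≤n) (ℕD.∣m⇒∣m*n _ d))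

-- The Frobenius map.

module Frobenius (R : Ring) (q : ℕ) (p-prime : Prime (suc q))
  (char : HasCharacteristic R (suc q)) where
  open CommutativeRing R hiding (zero)
  open RingProperties ring using (+-inverseˡ-unique)
  open Sum semiring using (sum; sum-cong-≋; sum-init-last)
  open Mult semiring renaming (_×_ to _·_)
  open Exp semiring using (_^_; ^-congˡ)
  open CExp commutativeSemiring using (^-distrib-*)
  open Determinants R
  open Multiplicativity R using (sum-zero)
  open PrimeBinomials (suc q) p-prime
  open SetoidReasoning setoid

  p : ℕ
  p = suc q

  p∣⇒·≈0 : ∀ {n} x → p ∣ n → n · x ≈ 0#
  p∣⇒·≈0 x (divides m ≡.refl) = begin
    (m ℕ.* p) · x          ≈⟨ ×-congʳ (m ℕ.* p) (*-identityˡ x) ⟨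
    (m ℕ.* p) · (1# * x)   ≈⟨ ×-assoc-* (m ℕ.* p) 1# x ⟨
    (m ℕ.* p) · 1# * x     ≈⟨ *-congʳ (trans (×1-homo-* m p) (trans (*-congˡ char) (zeroʳ _))) ⟩
    0# * x                 ≈⟨ zeroˡ x ⟩
    0#                     ∎

  +-^p : ∀ x y → (x + y) ^ p ≈ x ^ p + y ^ p
  +-^p x y = begin
    (x + y) ^ p
      ≈⟨ Binomial.theorem commutativeSemiring p x y ⟩
    t zero + sum (t ∘ suc)
      ≈⟨ +-cong first (sum-init-last (t ∘ suc)) ⟩
    y ^ p + (sum (λ i → t (suc (inject₁ i))) + t (suc (fromℕ q)))
      ≈⟨ +-congˡ (+-cong (sum-zero middle) last) ⟩
    y ^ p + (0# + x ^ p)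
      ≈⟨ trans (+-congˡ (+-identityˡ _)) (+-comm _ _) ⟩
    x ^ p + y ^ p ∎
    where
    t = Binomial.binomialTerm commutativeSemiring x y p
    first : t zero ≈ y ^ p
    first = trans (×-homo-1 _) (*-identityˡ _)
    middle : ∀ i → t (suc (inject₁ i)) ≈ 0#
    middle i = p∣⇒·≈0 _ (p∣pCk (s≤s z≤n) (s≤s (≡.subst (_< q) (≡.sym (FinP.toℕ-inject₁ i)) (FinP.toℕ<n i))))
    last : t (suc (fromℕ q)) ≈ x ^ p
    last = begin
      (p Comb.C toℕ (suc (fromℕ q))) · (x ^ toℕ (suc (fromℕ q)) * y ^ (p ∸ toℕ (suc (fromℕ q))))
        ≡⟨ ≡.cong (λ k → (p Comb.C k) · (x ^ k * y ^ (p ∸ k))) (≡.cong suc (FinP.toℕ-fromℕ q)) ⟩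
      (p Comb.C p) · (x ^ p * y ^ (p ∸ p))
        ≡⟨ ≡.cong₂ (λ m n → m · (x ^ p * y ^ n)) (nCn≡1 p) (ℕP.n∸n≡0 q) ⟩
      1 · (x ^ p * 1#)
        ≈⟨ trans (×-homo-1 _) (*-identityʳ _) ⟩
      x ^ p ∎

  0^p : 0# ^ p ≈ 0#
  0^p = zeroˡ _

  1^ : ∀ n → 1# ^ n ≈ 1#
  1^ zero    = refl
  1^ (suc n) = trans (*-identityˡ _) (1^ n)

  sum-^p : ∀ {n} (f : Fin n → Carrier) → sum f ^ p ≈ sum (λ i → f i ^ p)
  sum-^p {zero}  f = 0^p
  sum-^p {suc n} f = trans (+-^p _ _) (+-congˡ (sum-^p (f ∘ suc)))

  -- From (-s)^p + s^p = (-s + s)^p = 0, which treats p = 2 and odd p alike.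
  sgn-^p : ∀ {n} (j : Fin n) → sgn j ^ p ≈ sgn j
  sgn-^p zero    = 1^ p
  sgn-^p (suc j) = begin
    (- sgn j) ^ p        ≈⟨ +-inverseˡ-unique _ _ (trans (sym (+-^p (- sgn j) (sgn j))) (trans (^-congˡ p (-‿inverseˡ _)) 0^p)) ⟩
    - (sgn j ^ p)        ≈⟨ -‿cong (sgn-^p j) ⟩
    - sgn j              ∎

  -- Frobenius is additive and multiplicative and fixes the signs, and the determinant is a
  -- polynomial with coefficients ±1.
  det-^p : ∀ {d} (A : Matrix d d) → detᵣ A ^ p ≈ detᵣ (λ i j → A i j ^ p)
  det-^p {zero}  A = 1^ p
  det-^p {suc d} A = trans (sum-^p (λ j → sgn j * (A zero j * detᵣ (minor A j)))) (sum-cong-≋ λ j → begin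
    (sgn j * (A zero j * detᵣ (minor A j))) ^ p           ≈⟨ ^-distrib-* _ _ p ⟩
    sgn j ^ p * (A zero j * detᵣ (minor A j)) ^ p         ≈⟨ *-cong (sgn-^p j) (^-distrib-* _ _ p) ⟩
    sgn j * (A zero j ^ p * detᵣ (minor A j) ^ p)         ≈⟨ *-congˡ {x = sgn j} (*-congˡ {x = A zero j ^ p} (det-^p (minor A j))) ⟩
    sgn j * (A zero j ^ p * detᵣ (minor (λ i j → A i j ^ p) j)) ∎)

-- Diagonal matrices.

module Diagonal (R : Ring) where
  open CommutativeRing R hiding (zero)
  open Determinants R
  open Multiplicativity R
  open SpecialDeterminants R
  open SetoidReasoning setoid

  -- By recursion on the indices, so that it computes without deciding their equality; with
  -- `λ _ → 1#` its rows serve as unit vectors.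
  diag : ∀ {n} → Row n → Matrix n n
  diag v zero    zero    = v zero
  diag v zero    (suc j) = 0#
  diag v (suc i) zero    = 0#
  diag v (suc i) (suc j) = diag (v ∘ suc) i j

  diag-on : ∀ {n} (v : Row n) i → diag v i i ≈ v i
  diag-on v zero    = refl
  diag-on v (suc i) = diag-on (v ∘ suc) i

  diag-off : ∀ {n} (v : Row n) {i j} → i ≢ j → diag v i j ≈ 0#
  diag-off v {zero}  {zero}  i≢j = contradiction ≡.refl i≢j
  diag-off v {zero}  {suc j} i≢j = refl
  diag-off v {suc i} {zero}  i≢j = refl
  diag-off v {suc i} {suc j} i≢j = diag-off (v ∘ suc) (i≢j ∘ ≡.cong suc)

  det-diag : ∀ {n} (v : Row n) → detᵣ (diag v) ≈ prod v
  det-diag v = trans (det-lower (diag v) (λ i j i<j → diag-off v (λ e → ℕP.<⇒≢ i<j (≡.cong toℕ e))))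
                     (prod-cong (diag-on v))

  ⊗-diag : ∀ {m n} (A : Matrix m n) (v : Row n) i j → (A ⊗ diag v) i j ≈ A i j * v j
  ⊗-diag A v i j = trans
    (sum-single j {f = λ k → A i k * diag v k j} (λ k k≢j → trans (*-congˡ (diag-off v k≢j)) (zeroʳ _)))
    (*-congˡ (diag-on v j))

  diag-⊗ : ∀ {m n} (v : Row m) (A : Matrix m n) i j → (diag v ⊗ A) i j ≈ v i * A i j
  diag-⊗ v A i j = trans
    (sum-single i {f = λ k → diag v i k * A k j} (λ k k≢i → trans (*-congʳ (diag-off v (k≢i ∘ ≡.sym))) (zeroˡ _)))
    (*-congʳ (diag-on v i))

-- The polynomials f and f_j, and division by linear factors.

module RootPolynomials (R : Ring) where
  open CommutativeRing R hiding (zero)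
  open RingProperties ring using (-0#≈0#)
  open Sum semiring using (sum; sum-cong-≋; *-distribˡ-sum)
  open Determinants R
  open Multiplicativity R
  open SpecialDeterminants R
  open Diagonal R
  open SeriesTools R
  open FromIntegers R using (solve; _:+_; _:-_; :-_; _:=_)
  open FromIntegers seriesRing using () renaming (solve to solveₛ; _:+_ to infixl 6 _⊞_; _:-_ to infixl 6 _⊟_; _:*_ to infixl 7 _⊡_; _:=_ to infix 4 _⊜_)
  open SetoidReasoning setoid

  F : ∀ {n} → Row n → Series Carrier
  F {zero}  z = S.1#
  F {suc n} z = lin (z zero) *ₛ F (z ∘ suc)

  omit : ∀ {n} → Row (suc n) → Fin (suc n) → Series Carrier
  omit         z zero    = F (z ∘ suc)
  omit {suc n} z (suc j) = lin (z zero) *ₛ omit (z ∘ suc) j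

  F-split : ∀ {n} (z : Row (suc n)) j → F z ≈ₛ lin (z j) *ₛ omit z j
  F-split         z zero    = S.refl
  F-split {suc n} z (suc j) = S.trans (S.*-congˡ (F-split (z ∘ suc) j))
    (solveₛ 3 (λ a b c → a ⊡ (b ⊡ c) ⊜ b ⊡ (a ⊡ c)) S.refl (lin (z zero)) (lin (z (suc j))) (omit (z ∘ suc) j))

  F-top : ∀ {n} (z : Row n) → HasTop (F z) n 1#
  F-top {zero}  z = hasTop-C 1#
  F-top {suc n} z = hasTop-resp S.refl (*-identityˡ _) (hasTop-* (lin-top (z zero)) (F-top (z ∘ suc)))

  omit-top : ∀ {n} (z : Row (suc n)) j → HasTop (omit z j) n 1#
  omit-top         z zero    = F-top (z ∘ suc)
  omit-top {suc n} z (suc j) = hasTop-resp S.refl (*-identityˡ _) (hasTop-* (lin-top (z zero)) (omit-top (z ∘ suc) j))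

  θF : ∀ {n} (z : Row (suc n)) → θ (F z) ≈ₛ SSum.sum (λ i → X *ₛ omit z i)
  θF {zero}  z = S.trans (θ-cong (S.*-identityʳ _)) (S.trans (θ-lin (z zero))
    (S.sym (S.trans (S.+-identityʳ _) (S.*-identityʳ X))))
  θF {suc n} z = S.trans (θ-* (lin (z zero)) (F (z ∘ suc))) (S.+-cong (S.*-congʳ (θ-lin (z zero)))
    (S.trans (S.*-congˡ (θF (z ∘ suc))) (S.trans (SSum.*-distribˡ-sum {suc n} (lin (z zero)) (λ i → X *ₛ omit (z ∘ suc) i))
      (SSum.sum-cong-≋ {suc n} (λ i → solveₛ 3 (λ a b c → a ⊡ (b ⊡ c) ⊜ b ⊡ (a ⊡ c)) S.refl (lin (z zero)) X (omit (z ∘ suc) i))))))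

  -- The value f_j(w), defined from the factors because a power series cannot be evaluated.
  omitAt : ∀ {n} → Row (suc n) → Fin (suc n) → Carrier → Carrier
  omitAt         z zero    w = prod (λ k → w - z (suc k))
  omitAt {suc n} z (suc j) w = (w - z zero) * omitAt (z ∘ suc) j w

  prod-zero : ∀ {n} {f : Fin n → Carrier} i → f i ≈ 0# → prod f ≈ 0#
  prod-zero {suc n} zero    e = trans (*-congʳ e) (zeroˡ _)
  prod-zero {suc n} (suc i) e = trans (*-congˡ (prod-zero i e)) (zeroʳ _)

  omitAt-other : ∀ {n} (z : Row (suc n)) i j → i ≢ j → omitAt z j (z i) ≈ 0#
  omitAt-other         z zero    zero    i≢j = contradiction ≡.refl i≢j
  omitAt-other         z (suc i) zero    i≢j = prod-zero {f = λ k → z (suc i) - z (suc k)} i (-‿inverseʳ _)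
  omitAt-other {suc n} z zero    (suc j) i≢j = trans (*-congʳ (-‿inverseʳ _)) (zeroˡ _)
  omitAt-other {suc n} z (suc i) (suc j) i≢j =
    trans (*-congˡ (omitAt-other (z ∘ suc) i j (i≢j ∘ ≡.cong suc))) (zeroʳ _)

  -- Division by x - w of a polynomial `g` of degree at most `n`, so that the quotient has degree
  -- below `n`.
  record Division (w : Carrier) (g : Series Carrier) (ρ : Carrier) (n : ℕ) : Set where
    constructor division
    field
      quotient : Series Carrier
      bound    : ∀ k → n ≤ k → coef quotient k ≈ 0#
      remainder : g ≈ₛ C ρ +ₛ lin w *ₛ quotient

  -- (x - y)(ρ + (x - w) h) = (w - y) ρ + (x - w)(ρ + (x - y) h), so division proceeds factor by
  -- factor.
  divide-lin : ∀ {w g ρ n} y → Division w g ρ n → Division w (lin y *ₛ g) ((w - y) * ρ) (suc n)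
  divide-lin {w} {g} {ρ} {n} y (division h h-bound g≈) = division (C ρ +ₛ lin y *ₛ h)
    (λ { (suc k) (s≤s l) → trans (+-identityˡ _) (lin-bound k l) })
    (S.trans (S.*-congˡ g≈) (S.trans
      (solveₛ 5 (λ x w y r h → (x ⊟ y) ⊡ (r ⊞ (x ⊟ w) ⊡ h) ⊜ (w ⊟ y) ⊡ r ⊞ (x ⊟ w) ⊡ (r ⊞ (x ⊟ y) ⊡ h))
              S.refl X (C w) (C y) (C ρ) h)
      (S.+-congʳ (S.sym (S.trans (C-* (w - y) ρ) (S.*-congʳ (S.trans (C-+ w (- y)) (S.+-congˡ (C-neg y)))))))))
    where
    lin-bound : ∀ k → n ≤ k → coef (lin y *ₛ h) (suc k) ≈ 0#
    lin-bound k l = trans (at (S.distribʳ h X (S.- C y)) (suc k)) (trans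
      (+-cong (trans (X*-suc h k) (h-bound k l))
              (trans (at (S.*-congʳ {h} (S.sym (C-neg y))) (suc k)) (trans (C*-coeff (- y) h (suc k))
                (trans (*-congˡ (h-bound (suc k) (ℕP.m≤n⇒m≤1+n l))) (zeroʳ _)))))
      (+-identityˡ _))

  divide-F : ∀ {n} w (z : Row n) → Division w (F z) (prod (λ k → w - z k)) n
  divide-F {zero}  w z = division S.0# (λ k _ → coeff-0 k) (S.sym (S.trans (S.+-congˡ (S.zeroʳ _)) (S.+-identityʳ _)))
  divide-F {suc n} w z = divide-lin (z zero) (divide-F w (z ∘ suc))

  divide-omit : ∀ {n} w (z : Row (suc n)) j → Division w (omit z j) (omitAt z j w) n
  divide-omit         w z zero    = divide-F w (z ∘ suc)
  divide-omit {suc n} w z (suc j) = divide-lin (z zero) (divide-omit w (z ∘ suc) j)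

  -- Leading coefficients come first, matching the order of the columns of M_d.
  L : ∀ {n} → Row (suc n) → Matrix (suc n) (suc n)
  L {n} z c j = coef (omit z j) (n ∸ toℕ c)

  δ : ∀ {n} → Row n → Carrier
  δ {zero}  z = 1#
  δ {suc n} z = prod (λ j → z zero - z (suc j)) * δ (z ∘ suc)

  -- Right multiplication by colOps subtracts column 0 from all the other columns.
  colOps : ∀ {n} → Matrix (suc n) (suc n)
  colOps zero    zero    = 1#
  colOps zero    (suc j) = - 1#
  colOps (suc i) zero    = 0#
  colOps (suc i) (suc j) = diag (λ _ → 1#) i j

  det-colOps : ∀ n → detᵣ (colOps {n}) ≈ 1#
  det-colOps n = begin
    laplaceTerm U zero + sum (λ j → laplaceTerm U (suc j))
      ≈⟨ +-cong (trans (*-identityˡ _) (trans (*-identityˡ _) (trans (det-diag {n} (λ _ → 1#)) (prod-1 n))))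
                (sum-zero {f = λ j → laplaceTerm U (suc j)} (others n)) ⟩
    1# + 0#
      ≈⟨ +-identityʳ _ ⟩
    1# ∎
    where
    U = colOps {n}
    prod-1 : ∀ n → prod {n} (λ _ → 1#) ≈ 1#
    prod-1 zero    = refl
    prod-1 (suc n) = trans (*-identityˡ _) (prod-1 n)
    others : ∀ n j → laplaceTerm (colOps {n}) (suc j) ≈ 0#
    others (suc n) j = laplaceTerm-minor (colOps {suc n}) (suc j) (det-zeroCol₀ (minor (colOps {suc n}) (suc j)) (λ _ → refl))

  ⊗-colOps-zero : ∀ {m n} (A : Matrix m (suc n)) i → (A ⊗ colOps) i zero ≈ A i zero
  ⊗-colOps-zero A i = trans (+-cong (*-identityʳ _) (sum-zero {f = λ k → A i (suc k) * 0#} (λ k → zeroʳ _))) (+-identityʳ _)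

  ⊗-colOps-suc : ∀ {m n} (A : Matrix m (suc n)) i j → (A ⊗ colOps) i (suc j) ≈ A i (suc j) - A i zero
  ⊗-colOps-suc A i j = trans
    (+-congˡ (trans (⊗-diag (λ i k → A i (suc k)) (λ _ → 1#) i j) (*-identityʳ _)))
    (trans (+-congʳ (trans (*-comm _ _) (RingProperties.-1*x≈-x ring _))) (+-comm _ _))

  -- The two polynomials share the product without either root and differ in one monic linear
  -- factor, so x cancels in the difference.
  omit-difference : ∀ {n} (z : Row (suc (suc n))) j →
                    omit z (suc j) S.- omit z zero ≈ₛ C (z (suc j) - z zero) *ₛ omit (z ∘ suc) j
  omit-difference z j = S.trans (S.+-congˡ (S.-‿cong (F-split (z ∘ suc) j))) (S.trans
    (solveₛ 4 (λ x a b o → (x ⊟ a) ⊡ o ⊟ (x ⊟ b) ⊡ o ⊜ (b ⊟ a) ⊡ o) S.refl X (C (z zero)) (C (z (suc j))) (omit (z ∘ suc) j))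
    (S.*-congʳ (S.sym (S.trans (C-+ (z (suc j)) (- z zero)) (S.+-congˡ (C-neg (z zero)))))))

  geometric : Carrier → ℕ → Carrier
  geometric w zero    = 1#
  geometric w (suc k) = w * geometric w k

  -- Entry (i, j) is a (i - j) for j ≤ i: truncated multiplication by the series with coefficients
  -- `a`.
  toeplitz : ∀ {m} → (ℕ → Carrier) → Matrix m m
  toeplitz a i       zero    = a (toℕ i)
  toeplitz a zero    (suc j) = 0#
  toeplitz a (suc i) (suc j) = toeplitz a i j

  toeplitz-upper : ∀ {m} a (i j : Fin m) → i Fin.< j → toeplitz a i j ≈ 0#
  toeplitz-upper a zero    (suc j) _       = refl
  toeplitz-upper a (suc i) (suc j) (s≤s l) = toeplitz-upper a i j l

  toeplitz-diagonal : ∀ {m} a (i : Fin m) → toeplitz a i i ≈ a 0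
  toeplitz-diagonal a zero    = refl
  toeplitz-diagonal a (suc i) = toeplitz-diagonal a i

  toeplitz-conv : ∀ {m} a b (i : Fin m) → sum (λ j → toeplitz a i j * b (toℕ j)) ≈ conv a b (toℕ i)
  toeplitz-conv {suc m} a b zero    = trans (+-congˡ (sum-zero {m} {f = λ j → 0# * b (suc (toℕ j))} (λ j → zeroˡ _))) (+-identityʳ _)
  toeplitz-conv {suc m} a b (suc i) = trans (+-congˡ (toeplitz-conv a (b ∘ suc) i))
    (trans (+-comm _ _) (sym (conv-sucʳ a b (toℕ i))))

  conv-sum : ∀ {m} (a : Fin m → ℕ → Carrier) b k → conv (λ l → sum (λ i → a i l)) b k ≈ sum (λ i → conv (a i) b k)
  conv-sum {zero}  a b k = conv-zeroˡ b (λ _ → refl) k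
  conv-sum {suc m} a b k = trans (conv-distribʳ b (a zero) (λ l → sum (λ i → a (suc i) l)) k) (+-congˡ (conv-sum (a ∘ suc) b k))

  -- Horner's scheme for division by x - w: y 0 is the remainder and y (k + 1) the k-th coefficient
  -- of the quotient. Solving the recursion from the top expresses them by powers of `w`.
  horner : ∀ n w (g y : ℕ → Carrier) → (∀ k → g k ≈ y k - w * y (suc k)) → y (suc n) ≈ 0# →
           ∀ c → c ≤ n → conv (geometric w) (λ k → g (n ∸ k)) c ≈ y (n ∸ c)
  horner n w g y g≈ y₀ zero    _ = trans (*-identityˡ _) (trans (g≈ n)
    (trans (+-congˡ (trans (-‿cong (trans (*-congˡ y₀) (zeroʳ _))) -0#≈0#)) (+-identityʳ _)))
  horner n w g y g≈ y₀ (suc c) l = begin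
    1# * g (n ∸ suc c) + conv (λ i → w * geometric w i) (λ k → g (n ∸ k)) c
      ≈⟨ +-cong (*-identityˡ _) (trans (conv-scaleˡ w (geometric w) (λ k → g (n ∸ k)) c) (*-congˡ (horner n w g y g≈ y₀ c (ℕP.<⇒≤ l)))) ⟩
    g (n ∸ suc c) + w * y (n ∸ c)
      ≈⟨ +-cong (g≈ (n ∸ suc c)) (*-congˡ (reflexive (≡.cong y (ℕP.+-∸-assoc 1 l)))) ⟩
    (y (n ∸ suc c) - w * y (suc (n ∸ suc c))) + w * y (suc (n ∸ suc c))
      ≈⟨ solve 2 (λ a b → (a :- b) :+ b := a) refl _ _ ⟩
    y (n ∸ suc c) ∎

-- The exponent p - 1.

module Evaluation (R : Ring) (q : ℕ) (p-prime : Prime (suc q))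
  (char : HasCharacteristic R (suc q)) where
  open CommutativeRing R hiding (zero)
  open RingProperties ring using (-1*x≈-x)
  open Sum semiring using (sum; sum-cong-≋)
  open Mult semiring renaming (_×_ to _·_)
  open Exp semiring using (_^_; ^-congˡ)
  open Determinants R
  open Multiplicativity R
  open SpecialDeterminants R
  open Diagonal R
  open Regularity R
  open SeriesTools R
  open RootPolynomials R
  open Scalars R (suc q) p-prime char
  open FromIntegers R using (solve; _:*_; _:-_; :-_; _:=_)
  open FromIntegers seriesRing using () renaming (solve to solveₛ; _:*_ to infixl 7 _⊡_; _:=_ to infix 4 _⊜_)
  open SetoidReasoning setoid

  p : ℕ
  p = suc q

  charₛ : p SMult.× S.1# S.≈ S.0#
  charₛ = pointwise λ
    { zero    → trans (coeff-· p S.1# 0) char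
    ; (suc k) → trans (coeff-· p S.1# (suc k)) (·-0 p) }

  module FrobR = Frobenius R q p-prime char
  module FrobS = Frobenius seriesRing q p-prime charₛ
  open FrobR using (det-^p)

  prod-swap : ∀ m (w : Row m) x → prod (λ j → w j - x) ~ prod (λ j → x - w j)
  prod-swap zero    w x = ~-refl
  prod-swap (suc m) w x = ~-* (- 1# , scalar-neg scalar-1 , trans
      (solve 2 (λ a b → a :- b := :- (b :- a)) refl (w zero) x) (sym (-1*x≈-x _)))
    (prod-swap m (w ∘ suc) x)

  -- Each difference of two roots occurs twice, with opposite signs; the induction removes the first
  -- root.
  prod-δ² : ∀ {n} (z : Row (suc n)) → prod (λ j → omitAt z j (z j)) ~ δ z * δ z
  prod-δ² {zero}  z = ≈⇒~ (trans (*-identityʳ 1#) (sym (trans (*-cong (*-identityʳ 1#) (*-identityʳ 1#)) (*-identityʳ 1#))))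
  prod-δ² {suc n} z = ~-trans
    (~-* (~-refl {V}) (~-trans (≈⇒~ (prod-distrib-* (λ j → z (suc j) - z zero) (λ j → omitAt z′ j (z′ j))))
                               (~-* (prod-swap (suc n) z′ (z zero)) (prod-δ² z′))))
    (≈⇒~ (solve 2 (λ v d → v :* (v :* (d :* d)) := (v :* d) :* (v :* d)) refl V (δ z′)))
    where
    z′ = z ∘ suc
    V = prod (λ j → z zero - z (suc j))

  -- A Vandermonde induction: as all f_j are monic, `colOps` turns the first row into (1, 0, ...,
  -- 0), and by `omit-difference` the remaining block is `L` of the other roots with its columns
  -- scaled by differences of roots.
  det-L : ∀ {n} (z : Row (suc n)) → detᵣ (L z) ~ δ z
  det-L {zero}  z = ≈⇒~ (trans (+-identityʳ _) (trans (*-identityˡ _) (trans (*-identityʳ _) (sym (*-identityʳ _)))))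
  det-L {suc n} z = ~-trans (≈⇒~ (begin
      detᵣ (L z)                       ≈⟨ trans (*-congˡ (det-colOps (suc n))) (*-identityʳ _) ⟨
      detᵣ (L z) * detᵣ (colOps {suc n}) ≈⟨ det-⊗ (L z) (colOps {suc n}) ⟨
      detᵣ N                           ≈⟨ det-row₀ N zero row₀ ⟩
      1# * (N zero zero * detᵣ (minor N zero))
        ≈⟨ trans (*-identityˡ _) (*-congʳ {detᵣ (minor N zero)} (trans (⊗-colOps-zero (L z) zero) (atTop (omit-top z zero)))) ⟩
      1# * detᵣ (minor N zero)         ≈⟨ *-identityˡ _ ⟩
      detᵣ (minor N zero)              ≈⟨ det-cong (λ c j → trans (entry (suc c) j)
                                           (trans (*-comm _ _) (sym (⊗-diag (L z′) v c j)))) ⟩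
      detᵣ (L z′ ⊗ diag v)             ≈⟨ det-⊗ (L z′) (diag v) ⟩
      detᵣ (L z′) * detᵣ (diag v)       ≈⟨ trans (*-congˡ (det-diag v)) (*-comm _ _) ⟩
      prod v * detᵣ (L z′)             ∎))
    (~-* (prod-swap (suc n) z′ (z zero)) (det-L z′))
    where
    z′ = z ∘ suc
    N = L z ⊗ colOps
    v : Row (suc n)
    v j = z′ j - z zero
    entry : ∀ c j → N c (suc j) ≈ v j * coef (omit z′ j) (suc n ∸ toℕ c)
    entry c j = trans (⊗-colOps-suc (L z) c j) (trans (at (omit-difference z j) (suc n ∸ toℕ c))
      (C*-coeff (v j) (omit z′ j) (suc n ∸ toℕ c)))
    row₀ : ∀ j → j ≢ zero → N zero j ≈ 0#
    row₀ zero    0≢0 = contradiction ≡.refl 0≢0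
    row₀ (suc j) _   = trans (entry zero j) (trans (*-congˡ (above (omit-top z′ j) (suc n) ℕP.≤-refl)) (zeroʳ _))

  reversal : ∀ {n} → Matrix n n
  reversal i = diag (λ _ → 1#) (opposite i)

  det-reversal : ∀ n → Scalar (detᵣ (reversal {n}))
  det-reversal zero    = scalar-1
  det-reversal (suc n) = scalar-resp
    (sym (trans (det-row₀ (reversal {suc n}) (fromℕ n) (λ j j≢n → diag-off (λ _ → 1#) (j≢n ∘ ≡.sym)))
                (*-congˡ {x = sgn (fromℕ n)} (trans (*-congʳ {detᵣ (minor (reversal {suc n}) (fromℕ n))} (diag-on (λ _ → 1#) (fromℕ n)))
                         (trans (*-identityˡ _) (det-cong (entry n)))))))
    (scalar-* (scalar-sgn (fromℕ n)) (det-reversal n))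
    where
    inject₁-diag : ∀ {n} (i j : Fin n) → diag (λ _ → 1#) (inject₁ i) (punchIn (fromℕ n) j) ≈ diag (λ _ → 1#) i j
    inject₁-diag zero    zero    = refl
    inject₁-diag zero    (suc j) = refl
    inject₁-diag (suc i) zero    = refl
    inject₁-diag (suc i) (suc j) = inject₁-diag i j
    entry : ∀ n (i j : Fin n) → minor (reversal {suc n}) (fromℕ n) i j ≈ reversal i j
    entry n i j = inject₁-diag (opposite i) j

  -- As g^p = Σ g_i^p x^{ip}, only the coefficients of `u` at multiples of p matter, and the only
  -- nonzero one is 1, at p. The induction splits off the constant term of `g`.
  coeff-^p : ∀ g u a → HasTop u p 1# → coef u 0 ≈ 0# →
             coef (g SExp.^ p *ₛ u) (suc a ℕ.* p) ≈ coef g a ^ p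
  coeff-^p g u a top-u u₀ = begin
    coef (g SExp.^ p *ₛ u) (suc a ℕ.* p)
      ≈⟨ at (S.*-congʳ {u} split) (p ℕ.+ a ℕ.* p) ⟩
    coef ((C (coef g 0 ^ p) +ₛ X SExp.^ p *ₛ t SExp.^ p) *ₛ u) (p ℕ.+ a ℕ.* p)
      ≈⟨ at (S.trans (S.distribʳ u (C (coef g 0 ^ p)) (X SExp.^ p *ₛ t SExp.^ p)) (S.+-congˡ (S.*-assoc (X SExp.^ p) (t SExp.^ p) u))) (p ℕ.+ a ℕ.* p) ⟩
    coef (C (coef g 0 ^ p) *ₛ u) (p ℕ.+ a ℕ.* p) + coef (X SExp.^ p *ₛ (t SExp.^ p *ₛ u)) (p ℕ.+ a ℕ.* p)
      ≈⟨ +-cong (C*-coeff (coef g 0 ^ p) u (p ℕ.+ a ℕ.* p)) (X^*-+ p (t SExp.^ p *ₛ u) (a ℕ.* p)) ⟩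
    coef g 0 ^ p * coef u (p ℕ.+ a ℕ.* p) + coef (t SExp.^ p *ₛ u) (a ℕ.* p)
      ≈⟨ rest a ⟩
    coef g a ^ p ∎
    where
    t = tail g
    C-^ : ∀ x n → C x SExp.^ n ≈ₛ C (x ^ n)
    C-^ x zero    = S.refl
    C-^ x (suc n) = S.trans (S.*-congˡ (C-^ x n)) (S.sym (C-* x (x ^ n)))
    split : g SExp.^ p ≈ₛ C (coef g 0 ^ p) +ₛ X SExp.^ p *ₛ t SExp.^ p
    split = S.trans (SExp.^-congˡ p (head-tail g)) (S.trans (FrobS.+-^p (C (coef g 0)) (X *ₛ t))
      (S.+-cong (C-^ (coef g 0) p) (CExp.^-distrib-* S.commutativeSemiring X t p)))
    rest : ∀ a → coef g 0 ^ p * coef u (p ℕ.+ a ℕ.* p) + coef (t SExp.^ p *ₛ u) (a ℕ.* p) ≈ coef g a ^ p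
    rest zero    = trans
      (+-cong (trans (*-congˡ (trans (reflexive (≡.cong (coef u) (ℕP.+-identityʳ p))) (atTop top-u))) (*-identityʳ _))
              (trans (*-congˡ u₀) (zeroʳ _)))
      (+-identityʳ _)
    rest (suc a) = trans
      (+-cong (trans (*-congˡ (above top-u (p ℕ.+ suc a ℕ.* p) (ℕP.m<m+n p (s≤s z≤n)))) (zeroʳ _))
              (coeff-^p t u a top-u u₀))
      (+-identityˡ _)

  -- The matrix M_d of the paper for the series h, its entry being the coefficient of
  -- x^{(a+1)p} in x^{d-b} h.
  hasse : ∀ d → Series Carrier → Matrix d d
  hasse d h a b = coef (X SExp.^ (d ∸ toℕ b) *ₛ h) (suc (toℕ a) ℕ.* p)

  X-shift : ∀ {m} n → m ≤ n → ∀ h → X SExp.^ (suc n ∸ m) *ₛ h ≈ₛ X SExp.^ (n ∸ m) *ₛ (X *ₛ h)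
  X-shift {m} n m≤n h = S.trans
    (S.reflexive (≡.cong (λ k → X SExp.^ k *ₛ h) (ℕP.+-∸-assoc 1 m≤n)))
    (solveₛ 3 (λ x y h → (x ⊡ y) ⊡ h ⊜ y ⊡ (x ⊡ h)) S.refl X (X SExp.^ (n ∸ m)) h)

  det-hasse-p-1 : ∀ {n} (z : Row (suc n)) → Regular (δ z) → detᵣ (hasse (suc n) (F z SExp.^ q)) ~ δ z ^ q
  det-hasse-p-1 {n} z reg = ~-cancelˡ reg (~-trans (≈⇒~ (*-comm _ _)) (~-trans
    (~-* ~-refl (~-sym (det-L z))) (~-trans (≈⇒~ (begin
      detᵣ H * detᵣ (L z)                             ≈⟨ det-⊗ H (L z) ⟨
      detᵣ (H ⊗ L z)                                 ≈⟨ det-cong product ⟩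
      detᵣ (reversal {suc n} ⊗ (λ i j → L z i j ^ p)) ≈⟨ det-⊗ (reversal {suc n}) (λ i j → L z i j ^ p) ⟩
      detᵣ (reversal {suc n}) * detᵣ (λ i j → L z i j ^ p)      ≈⟨ *-congˡ (det-^p (L z)) ⟨
      detᵣ (reversal {suc n}) * detᵣ (L z) ^ p                  ∎))
    (~-trans (~-scalar (det-reversal (suc n))) (~-^ p (det-L z))))))
    where
    H = hasse (suc n) (F z SExp.^ q)
    u : ∀ j → Series Carrier
    u j = X *ₛ lin (z j) SExp.^ q
    u-top : ∀ j → HasTop (u j) p 1#
    u-top j = ≡.subst (λ k → HasTop (u j) (suc k) 1#) (ℕP.*-identityʳ q)
      (hasTop-resp S.refl (*-identityˡ _) (hasTop-* X-top (hasTop-^ q (lin-top (z j)))))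
    product : ∀ a j → (H ⊗ L z) a j ≈ (reversal ⊗ (λ i j → L z i j ^ p)) a j
    product a j = begin
      sum {suc n} (λ b → coef (X SExp.^ (suc n ∸ toℕ b) *ₛ F z SExp.^ q) N * coef (omit z j) (n ∸ toℕ b))
        ≈⟨ sum-cong-≋ {suc n} (λ b → *-congʳ {coef (omit z j) (n ∸ toℕ b)} (at (X-shift n (ℕP.≤-pred (FinP.toℕ<n b)) (F z SExp.^ q)) N)) ⟩
      sum {suc n} (λ b → coef (X SExp.^ (n ∸ toℕ b) *ₛ (X *ₛ F z SExp.^ q)) N * coef (omit z j) (n ∸ toℕ b))
        ≈⟨ expand n (omit z j) (X *ₛ F z SExp.^ q) N (above (omit-top z j)) ⟩
      coef (omit z j *ₛ (X *ₛ F z SExp.^ q)) N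
        ≈⟨ at (S.*-congˡ {omit z j} (S.*-congˡ {X} (S.trans (SExp.^-congˡ q (F-split z j)) (CExp.^-distrib-* S.commutativeSemiring (lin (z j)) (omit z j) q)))) N ⟩
      coef (omit z j *ₛ (X *ₛ (lin (z j) SExp.^ q *ₛ omit z j SExp.^ q))) N
        ≈⟨ at (solveₛ 4 (λ o x l k → o ⊡ (x ⊡ (l ⊡ k)) ⊜ (o ⊡ k) ⊡ (x ⊡ l)) S.refl (omit z j) X (lin (z j) SExp.^ q) (omit z j SExp.^ q)) N ⟩
      coef (omit z j SExp.^ p *ₛ u j) N
        ≈⟨ coeff-^p (omit z j) (u j) (toℕ a) (u-top j) (X*-zero (lin (z j) SExp.^ q)) ⟩
      coef (omit z j) (toℕ a) ^ p
        ≡⟨ ≡.cong (λ k → coef (omit z j) k ^ p) index ⟩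
      L z (opposite a) j ^ p
        ≈⟨ *-identityˡ _ ⟨
      1# * L z (opposite a) j ^ p
        ≈⟨ diag-⊗ (λ _ → 1#) (λ i j → L z i j ^ p) (opposite a) j ⟨
      (reversal ⊗ (λ i j → L z i j ^ p)) a j ∎
      where
      N = suc (toℕ a) ℕ.* p
      -- `L` lists coefficients from degree n downwards, so the coefficient of degree a stands in
      -- row n - a; this is the origin of `reversal`.
      index : toℕ a ≡ n ∸ toℕ (opposite a)
      index = ≡.trans (≡.sym (ℕP.m∸[m∸n]≡n (ℕP.≤-pred (FinP.toℕ<n a)))) (≡.cong (n ∸_) (≡.sym (FinP.opposite-prop a)))

  -- The series x^{n+1-b} f^{p-1} has degree (n + 1) p - b and is monic, so in the last row only
  -- column b = 0 reaches x^{(n+1)p}.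
  det-hasse-last : ∀ {n} (z : Row (suc n)) →
                   detᵣ (hasse (suc n) (F z SExp.^ q)) ~ detᵣ (hasse n (F z SExp.^ q))
  det-hasse-last {n} z = ~-trans (≈⇒~ (begin
    detᵣ H
      ≈⟨ det-lastRow H (λ b → above (xh-top (n ∸ toℕ b)) N (bound (s≤s (ℕP.m∸n≤m n (toℕ b))))) ⟩
    sgn (fromℕ n) * (H (fromℕ n) zero * detᵣ (λ a b → H (inject₁ a) (suc b)))
      ≈⟨ *-congˡ {x = sgn (fromℕ n)} (*-cong (trans (reflexive (≡.cong (coef (X SExp.^ suc n *ₛ h)) corner)) (atTop (xh-top (suc n))))
                          (det-cong {A = λ a b → H (inject₁ a) (suc b)} {B = hasse n h} (λ a b → reflexive (≡.cong (λ i → coef (X SExp.^ (n ∸ toℕ b) *ₛ h) (suc i ℕ.* p)) (FinP.toℕ-inject₁ a))))) ⟩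
    sgn (fromℕ n) * (1# * detᵣ (hasse n h))
      ≈⟨ *-congˡ (*-identityˡ _) ⟩
    sgn (fromℕ n) * detᵣ (hasse n h) ∎))
    (~-scalar (scalar-sgn (fromℕ n)))
    where
    h = F z SExp.^ q
    H = hasse (suc n) h
    N = suc (toℕ (fromℕ n)) ℕ.* p
    xh-top : ∀ k → HasTop (X SExp.^ k *ₛ h) (k ℕ.+ q ℕ.* suc n) 1#
    xh-top k = hasTop-resp S.refl (*-identityˡ _) (hasTop-* (X^-top k) (hasTop-^ q (F-top z)))
    corner : N ≡ suc n ℕ.+ q ℕ.* suc n
    corner = ≡.trans (≡.cong (λ i → suc i ℕ.* p) (FinP.toℕ-fromℕ n)) (ℕP.*-comm (suc n) p)
    bound : ∀ {k} → k < suc n → k ℕ.+ q ℕ.* suc n < N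
    bound {k} l = ≡.subst (k ℕ.+ q ℕ.* suc n <_) (≡.sym corner) (ℕP.+-monoˡ-< (q ℕ.* suc n) l)

-- The descent from e + 1 to e.

module Step (R : Ring) (q : ℕ) (p-prime : Prime (suc q))
  (char : HasCharacteristic R (suc q)) where
  open CommutativeRing R hiding (zero)
  open RingProperties ring using (-1*x≈-x)
  open Sum semiring using (sum; sum-cong-≋; *-distribˡ-sum; ∑-distrib-+; sum-replicate)
  open Mult semiring renaming (_×_ to _·_)
  open Exp semiring using (_^_)
  open Determinants R
  open Multiplicativity R
  open SpecialDeterminants R
  open Diagonal R
  open Regularity R
  open SeriesTools R
  open RootPolynomials R
  open Scalars R (suc q) p-prime char
  open FromIntegers R using (fromℤ; solve; _:+_; _:*_; _:-_; :-_; _:=_; con)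
  open FromIntegers seriesRing using () renaming (solve to solveₛ; _:+_ to infixl 6 _⊞_; _:-_ to infixl 6 _⊟_; _:*_ to infixl 7 _⊡_; _:=_ to infix 4 _⊜_)
  open SetoidReasoning setoid

  open Evaluation R q p-prime char
  open SMult using () renaming (_×_ to _·ₛ_)

  C-· : ∀ n → n ·ₛ S.1# ≈ₛ C (n · 1#)
  C-· zero    = S.refl
  C-· (suc n) = S.sym (S.trans (C-+ 1# (n · 1#)) (S.+-congˡ (S.sym (C-· n))))

  module _ {n : ℕ} (z : Row (suc n)) (e : ℕ) where
    f fᵉ : Series Carrier
    f  = F z
    fᵉ = f SExp.^ e

    E : Carrier
    E = suc e · 1#

    D : Row (suc n)
    D j = omitAt z j (z j)

    module _ (i j : Fin (suc n)) where
      open Division (divide-omit (z i) z j) renaming (quotient to h; bound to h-bound; remainder to omit≈)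

      ρ : Carrier
      ρ = omitAt z j (z i)

      -- With f_j = ρ + (x - z_i) h, the remainder and the quotient are stored in one series, as in
      -- Horner's scheme.
      y : Series Carrier
      y = C ρ +ₛ X *ₛ h

      y-suc : ∀ k → coef y (suc k) ≈ coef h k
      y-suc k = trans (+-identityˡ _) (X*-suc h k)

      y-zero : coef y 0 ≈ ρ
      y-zero = trans (+-congˡ (X*-zero h)) (+-identityʳ _)

      y-horner : ∀ k → coef (omit z j) k ≈ coef y k - z i * coef y (suc k)
      y-horner k = begin
        coef (omit z j) k
          ≈⟨ at (S.trans omit≈ (solveₛ 4 (λ r x w h → r ⊞ (x ⊟ w) ⊡ h ⊜ (r ⊞ x ⊡ h) ⊟ w ⊡ h) S.refl (C ρ) X (C (z i)) h)) k ⟩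
        coef y k - coef (C (z i) *ₛ h) k
          ≈⟨ +-congˡ (-‿cong (trans (C*-coeff (z i) h k) (*-congˡ (sym (y-suc k))))) ⟩
        coef y k - z i * coef y (suc k) ∎

      y-above : coef y (suc n) ≈ 0#
      y-above = trans (y-suc n) (h-bound n ℕP.≤-refl)

      -- By f = (x - z_i) f_i, x h f = x f_i (x - z_i) h = x f_i (f_j - ρ).
      y*f : y *ₛ f ≈ₛ omit z j *ₛ (X *ₛ omit z i) +ₛ C ρ *ₛ (f S.- X *ₛ omit z i)
      y*f =
        (S.trans (S.trans (S.distribʳ f (C ρ) (X *ₛ h)) (S.+-congˡ (S.*-congˡ {X *ₛ h} (F-split z i))))
        (S.trans (solveₛ 6 (λ r f x h l o → r ⊡ f ⊞ x ⊡ h ⊡ (l ⊡ o) ⊜ (r ⊞ l ⊡ h) ⊡ (x ⊡ o) ⊞ r ⊡ (f ⊟ x ⊡ o)) S.refl (C ρ) f X h (lin (z i)) (omit z i))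
        (S.+-congʳ (S.*-congʳ {X *ₛ omit z i} (S.sym omit≈)))))

    module _ (j : Fin (suc n)) where
      -- Summed over i, the terms x f_i give θ f, while ρ = f_j(z_i) survives only for i = j. So `Y`
      -- f is f_j θ f up to a multiple of D_j, and `W` f^{e+1} is θ (f_j f^{e+1}) up to such a
      -- multiple.
      Y W : Series Carrier
      Y = SSum.sum {suc n} (λ i → y i j)
      W = C E *ₛ Y +ₛ θ (omit z j)

      Y*f : Y *ₛ f ≈ₛ omit z j *ₛ θ f +ₛ C (D j) *ₛ (f S.- X *ₛ omit z j)
      Y*f =
        (S.trans (SSum.*-distribʳ-sum {suc n} f (λ i → y i j))
        (S.trans (SSum.sum-cong-≋ {suc n} (λ i → y*f i j))
        (S.trans (SSum.∑-distrib-+ {suc n} (λ i → omit z j *ₛ (X *ₛ omit z i)) (λ i → C (ρ i j) *ₛ (f S.- X *ₛ omit z i)))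
        (S.+-cong (S.trans (S.sym (SSum.*-distribˡ-sum {suc n} (omit z j) (λ i → X *ₛ omit z i))) (S.*-congˡ {omit z j} (S.sym (θF z)))) (SpecialDeterminants.sum-single seriesRing j {f = λ i → C (ρ i j) *ₛ (f S.- X *ₛ omit z i)} (λ i i≢j → S.trans (S.*-congʳ {f S.- X *ₛ omit z i} (C-cong (omitAt-other z i j i≢j))) (S.zeroˡ _)))))))

      W*fᵉ⁺¹ : W *ₛ (f *ₛ fᵉ) ≈ₛ θ (omit z j *ₛ (f *ₛ fᵉ)) +ₛ C (E * D j) *ₛ (f *ₛ fᵉ S.- omit z j *ₛ (X *ₛ fᵉ))
      W*fᵉ⁺¹ =
        (S.trans (solveₛ 5 (λ E Y t f g → (E ⊡ Y ⊞ t) ⊡ (f ⊡ g) ⊜ E ⊡ (Y ⊡ f) ⊡ g ⊞ t ⊡ (f ⊡ g)) S.refl (C E) Y (θ (omit z j)) f fᵉ)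
        (S.trans (S.+-congʳ (S.*-congʳ {fᵉ} (S.*-congˡ {C E} Y*f)))
        (S.trans (solveₛ 8 (λ E o t D f x g s → E ⊡ (o ⊡ t ⊞ D ⊡ (f ⊟ x ⊡ o)) ⊡ g ⊞ s ⊡ (f ⊡ g) ⊜ (s ⊡ (f ⊡ g) ⊞ o ⊡ (E ⊡ (g ⊡ t))) ⊞ (E ⊡ D) ⊡ (f ⊡ g ⊟ o ⊡ (x ⊡ g))) S.refl (C E) (omit z j) (θ f) (C (D j)) f X fᵉ (θ (omit z j)))
        (S.trans (S.+-cong (S.+-congˡ {θ (omit z j) *ₛ (f *ₛ fᵉ)} (S.*-congˡ {omit z j} (S.trans (S.*-congʳ {fᵉ *ₛ θ f} (S.sym (C-· (suc e)))) (S.sym (θ-^ f e))))) (S.*-congʳ {f *ₛ fᵉ S.- omit z j *ₛ (X *ₛ fᵉ)} (S.sym (C-* E (D j)))))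
        (S.+-congʳ (S.sym (θ-* (omit z j) (f *ₛ fᵉ))))))))

      W-zero : coef W 0 ≈ E * D j
      W-zero = trans (+-identityʳ _) (trans (C*-coeff E Y 0) (*-congˡ (begin
        coef Y 0                               ≈⟨ coeff-sum {suc n} (λ i → y i j) 0 ⟩
        sum {suc n} (λ i → coef (y i j) 0)     ≈⟨ sum-cong-≋ {suc n} (λ i → y-zero i j) ⟩
        sum {suc n} (λ i → ρ i j)               ≈⟨ sum-single j {f = λ i → ρ i j} (λ i i≢j → omitAt-other z i j i≢j) ⟩
        D j ∎)))

      W-above : ∀ k → n < k → coef W k ≈ 0#
      W-above (suc k) (s≤s l) = trans
        (+-cong (trans (C*-coeff E Y (suc k)) (trans (*-congˡ (trans (coeff-sum {suc n} (λ i → y i j) (suc k))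
                  (sum-zero {suc n} {λ i → coef (y i j) (suc k)} (λ i → trans (y-suc i j k) (Division.bound (divide-omit (z i) z j) k l))))) (zeroʳ _)))
                (trans (×-congʳ (suc k) (above (omit-top z j) (suc k) (s≤s l))) (·-0 (suc k))))
        (+-identityˡ _)

    -- The power sums of the roots: Horner's scheme, summed over i, produces the coefficients of `Y`
    -- from those of f_j by the Toeplitz matrix of `P`.
    P : ℕ → Carrier
    P k = sum (λ i → geometric (z i) k)

    -- The matrix taking the coefficients of f_j to those of `W`: the Toeplitz part yields E `Y` and
    -- the diagonal part yields θ. The zeroth power sum is r = n + 1, whence the diagonal entries E
    -- r + (n - c).
    B : Matrix (suc n) (suc n)
    B c c′ = E * toeplitz P c c′ + diag (λ c → (n ∸ toℕ c) · 1#) c c′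

    det-B : detᵣ B ≈ prod {suc n} (λ c → E * (suc n · 1#) + (n ∸ toℕ c) · 1#)
    det-B = trans
      (det-lower B (λ i j i<j → trans (+-cong (trans (*-congˡ (toeplitz-upper P i j i<j)) (zeroʳ _))
                                              (diag-off (λ c → (n ∸ toℕ c) · 1#) (λ e → ℕP.<⇒≢ i<j (≡.cong toℕ e)))) (+-identityˡ _)))
      (prod-cong {suc n} (λ c → +-cong (*-congˡ {E} (trans (toeplitz-diagonal P c) (sum-replicate (suc n))))
                                       (diag-on (λ c → (n ∸ toℕ c) · 1#) c)))

    B⊗L : ∀ c j → (B ⊗ L z) c j ≈ coef (W j) (n ∸ toℕ c)
    B⊗L c j = begin
      sum {suc n} (λ k → (E * toeplitz P c k + diag v c k) * L z k j)
        ≈⟨ sum-cong-≋ {suc n} (λ k → solve 4 (λ E t d l → (E :* t :+ d) :* l := E :* (t :* l) :+ d :* l) refl E (toeplitz P c k) (diag v c k) (L z k j)) ⟩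
      sum {suc n} (λ k → E * (toeplitz P c k * L z k j) + diag v c k * L z k j)
        ≈⟨ ∑-distrib-+ {suc n} (λ k → E * (toeplitz P c k * L z k j)) (λ k → diag v c k * L z k j) ⟩
      sum {suc n} (λ k → E * (toeplitz P c k * L z k j)) + sum {suc n} (λ k → diag v c k * L z k j)
        ≈⟨ +-cong (trans (sym (*-distribˡ-sum {suc n} E (λ k → toeplitz P c k * L z k j))) (*-congˡ {E} (toeplitz-conv P b c)))
                  (diag-⊗ v (L z) c j) ⟩
      E * conv P b (toℕ c) + (n ∸ toℕ c) · 1# * L z c j
        ≈⟨ +-cong (*-congˡ (trans (conv-sum (λ i → geometric (z i)) b (toℕ c)) (sum-cong-≋ {suc n} (λ i →
                    horner n (z i) (coef (omit z j)) (coef (y i j)) (y-horner i j) (y-above i j) (toℕ c) (ℕP.≤-pred (FinP.toℕ<n c))))))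
                  (trans (×-assoc-* (n ∸ toℕ c) 1# (L z c j)) (×-congʳ (n ∸ toℕ c) (*-identityˡ _))) ⟩
      E * sum {suc n} (λ i → coef (y i j) (n ∸ toℕ c)) + coef (θ (omit z j)) (n ∸ toℕ c)
        ≈⟨ +-congʳ (trans (*-congˡ (sym (coeff-sum {suc n} (λ i → y i j) (n ∸ toℕ c)))) (sym (C*-coeff E (Y j) (n ∸ toℕ c)))) ⟩
      coef (W j) (n ∸ toℕ c) ∎
      where
      v : Row (suc n)
      v c = (n ∸ toℕ c) · 1#
      b : ℕ → Carrier
      b k = coef (omit z j) (n ∸ k)

    index : Fin n → ℕ
    index a = suc (toℕ a) ℕ.* p

    κ : Row n
    κ a = coef (f *ₛ fᵉ) (index a)

    -- The bordered matrices: M₊ contains M_{r-1}(f^{e+1}) and M₋ contains - M_{r-1}(f^e).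
    M₊ M₋ : Matrix (suc n) (suc n)
    M₊ zero    c = diag (λ _ → 1#) (fromℕ n) c
    M₊ (suc a) c = coef (X SExp.^ (n ∸ toℕ c) *ₛ (f *ₛ fᵉ)) (index a)
    M₋ zero    c = diag (λ _ → 1#) zero c
    M₋ (suc a) c = κ a * diag (λ _ → 1#) zero c - coef (X SExp.^ (n ∸ toℕ c) *ₛ (X *ₛ fᵉ)) (index a)

    e₀-sum : ∀ (b : Row (suc n)) i → sum {suc n} (λ c → diag (λ _ → 1#) i c * b c) ≈ b i
    e₀-sum b i = trans (diag-⊗ (λ _ → 1#) (λ c (_ : Fin 1) → b c) i zero) (*-identityˡ _)

    -- Row 0 sets the constant coefficient E D_j of `W` against the leading coefficient 1 of f_j.
    -- The other rows take coefficients at multiples of p, where θ contributes 0; the term κ_a goes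
    -- into column 0 of `M₋`, again because f_j is monic.
    M₊⊗B⊗L : ∀ a j → (M₊ ⊗ (B ⊗ L z)) a j ≈ ((M₋ ⊗ L z) ⊗ diag (λ j → E * D j)) a j
    M₊⊗B⊗L zero j = begin
      sum {suc n} (λ c → diag (λ _ → 1#) (fromℕ n) c * (B ⊗ L z) c j)   ≈⟨ e₀-sum (λ c → (B ⊗ L z) c j) (fromℕ n) ⟩
      (B ⊗ L z) (fromℕ n) j                        ≈⟨ B⊗L (fromℕ n) j ⟩
      coef (W j) (n ∸ toℕ (fromℕ n))              ≡⟨ ≡.cong (coef (W j)) (≡.trans (≡.cong (n ∸_) (FinP.toℕ-fromℕ n)) (ℕP.n∸n≡0 n)) ⟩
      coef (W j) 0                                ≈⟨ W-zero j ⟩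
      E * D j                                      ≈⟨ *-identityˡ _ ⟨
      1# * (E * D j)                               ≈⟨ *-congʳ (trans (e₀-sum (λ c → L z c j) zero) (atTop (omit-top z j))) ⟨
      (M₋ ⊗ L z) zero j * (E * D j)                ≈⟨ ⊗-diag (M₋ ⊗ L z) (λ j → E * D j) zero j ⟨
      ((M₋ ⊗ L z) ⊗ diag (λ j → E * D j)) zero j   ∎
    M₊⊗B⊗L (suc a) j = begin
      sum {suc n} (λ c → M₊ (suc a) c * (B ⊗ L z) c j)
        ≈⟨ sum-cong-≋ {suc n} (λ c → *-congˡ {M₊ (suc a) c} (B⊗L c j)) ⟩
      sum {suc n} (λ c → coef (X SExp.^ (n ∸ toℕ c) *ₛ (f *ₛ fᵉ)) N * coef (W j) (n ∸ toℕ c))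
        ≈⟨ expand n (W j) (f *ₛ fᵉ) N (W-above j) ⟩
      coef (W j *ₛ (f *ₛ fᵉ)) N
        ≈⟨ at (W*fᵉ⁺¹ j) N ⟩
      N · coef (omit z j *ₛ (f *ₛ fᵉ)) N + coef (C (E * D j) *ₛ (f *ₛ fᵉ S.- omit z j *ₛ (X *ₛ fᵉ))) N
        ≈⟨ +-cong (FrobR.p∣⇒·≈0 _ (ℕD.n∣m*n (suc (toℕ a)))) (C*-coeff (E * D j) (f *ₛ fᵉ S.- omit z j *ₛ (X *ₛ fᵉ)) N) ⟩
      0# + E * D j * (κ a - coef (omit z j *ₛ (X *ₛ fᵉ)) N)
        ≈⟨ trans (+-identityˡ _) (*-comm _ _) ⟩
      (κ a - coef (omit z j *ₛ (X *ₛ fᵉ)) N) * (E * D j)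
        ≈⟨ *-congʳ M₋-row ⟨
      (M₋ ⊗ L z) (suc a) j * (E * D j)
        ≈⟨ ⊗-diag (M₋ ⊗ L z) (λ j → E * D j) (suc a) j ⟨
      ((M₋ ⊗ L z) ⊗ diag (λ j → E * D j)) (suc a) j ∎
      where
      N = index a
      T : Row (suc n)
      T c = coef (X SExp.^ (n ∸ toℕ c) *ₛ (X *ₛ fᵉ)) N
      M₋-row : (M₋ ⊗ L z) (suc a) j ≈ κ a - coef (omit z j *ₛ (X *ₛ fᵉ)) N
      M₋-row = begin
        sum {suc n} (λ c → (κ a * diag (λ _ → 1#) zero c - T c) * L z c j)
          ≈⟨ sum-cong-≋ {suc n} (λ c → solve 4 (λ k d t l → (k :* d :- t) :* l := k :* (d :* l) :+ con -[1+ 0 ] :* (t :* l)) refl (κ a) (diag (λ _ → 1#) zero c) (T c) (L z c j)) ⟩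
        sum {suc n} (λ c → κ a * (diag (λ _ → 1#) zero c * L z c j) + fromℤ -[1+ 0 ] * (T c * L z c j))
          ≈⟨ ∑-distrib-+ {suc n} (λ c → κ a * (diag (λ _ → 1#) zero c * L z c j)) (λ c → fromℤ -[1+ 0 ] * (T c * L z c j)) ⟩
        sum {suc n} (λ c → κ a * (diag (λ _ → 1#) zero c * L z c j)) + sum {suc n} (λ c → fromℤ -[1+ 0 ] * (T c * L z c j))
          ≈⟨ +-cong (*-distribˡ-sum {suc n} (κ a) (λ c → diag (λ _ → 1#) zero c * L z c j)) (*-distribˡ-sum {suc n} (fromℤ -[1+ 0 ]) (λ c → T c * L z c j)) ⟨
        κ a * sum {suc n} (λ c → diag (λ _ → 1#) zero c * L z c j) + fromℤ -[1+ 0 ] * sum {suc n} (λ c → T c * L z c j)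
          ≈⟨ +-cong (trans (*-congˡ (trans (e₀-sum (λ c → L z c j) zero) (atTop (omit-top z j)))) (*-identityʳ _))
                    (*-congˡ (expand n (omit z j) (X *ₛ fᵉ) N (above (omit-top z j)))) ⟩
        κ a + fromℤ -[1+ 0 ] * coef (omit z j *ₛ (X *ₛ fᵉ)) N
          ≈⟨ solve 2 (λ k t → k :+ con -[1+ 0 ] :* t := k :- t) refl (κ a) _ ⟩
        κ a - coef (omit z j *ₛ (X *ₛ fᵉ)) N ∎

    det-M₊ : detᵣ M₊ ~ detᵣ (hasse n (f *ₛ fᵉ))
    det-M₊ = ~-trans (≈⇒~ (trans
        (det-row₀ M₊ (fromℕ n) (λ j j≢n → diag-off (λ _ → 1#) (j≢n ∘ ≡.sym)))
        (*-congˡ {sgn (fromℕ n)} (trans (*-congʳ {detᵣ (minor M₊ (fromℕ n))} (diag-on (λ _ → 1#) (fromℕ n))) (trans (*-identityˡ _)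
          (det-cong {A = minor M₊ (fromℕ n)} {B = hasse n (f *ₛ fᵉ)} (λ a b → reflexive (≡.cong (λ k → coef (X SExp.^ (n ∸ k) *ₛ (f *ₛ fᵉ)) (index a)) (toℕ-punchIn-last b)))))))))
      (~-scalar (scalar-sgn (fromℕ n)))
      where
      toℕ-punchIn-last : ∀ {n} (b : Fin n) → toℕ (punchIn (fromℕ n) b) ≡ toℕ b
      toℕ-punchIn-last zero    = ≡.refl
      toℕ-punchIn-last (suc b) = ≡.cong suc (toℕ-punchIn-last b)

    det-M₋ : detᵣ M₋ ~ detᵣ (hasse n fᵉ)
    det-M₋ = ~-trans (≈⇒~ (begin
      detᵣ M₋
        ≈⟨ det-row₀ M₋ zero (λ { zero 0≢0 → contradiction ≡.refl 0≢0 ; (suc j) _ → refl }) ⟩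
      1# * (1# * detᵣ (minor M₋ zero))
        ≈⟨ trans (*-identityˡ _) (*-identityˡ _) ⟩
      detᵣ (minor M₋ zero)
        ≈⟨ det-cong {B = diag (λ _ → - 1#) ⊗ hasse n fᵉ} entry ⟩
      detᵣ (diag (λ _ → - 1#) ⊗ hasse n fᵉ)
        ≈⟨ det-⊗ (diag (λ _ → - 1#)) (hasse n fᵉ) ⟩
      detᵣ (diag {n} (λ _ → - 1#)) * detᵣ (hasse n fᵉ) ∎))
      (~-scalar (scalar-resp (sym (det-diag {n} (λ _ → - 1#))) (scalar-prod {n} (λ _ → scalar-neg scalar-1))))
      where
      entry : ∀ a b → minor M₋ zero a b ≈ (diag (λ _ → - 1#) ⊗ hasse n fᵉ) a b
      entry a b = begin
        κ a * 0# - coef (X SExp.^ (n ∸ suc (toℕ b)) *ₛ (X *ₛ fᵉ)) (index a)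
          ≈⟨ trans (+-congʳ (zeroʳ _)) (+-identityˡ _) ⟩
        - coef (X SExp.^ (n ∸ suc (toℕ b)) *ₛ (X *ₛ fᵉ)) (index a)
          ≈⟨ -‿cong (at (X-shift n (FinP.toℕ<n b) fᵉ) (index a)) ⟨
        - hasse n fᵉ a b
          ≈⟨ -1*x≈-x _ ⟨
        - 1# * hasse n fᵉ a b
          ≈⟨ diag-⊗ (λ _ → - 1#) (hasse n fᵉ) a b ⟨
        (diag (λ _ → - 1#) ⊗ hasse n fᵉ) a b ∎

    det-hasse-step : p ∤ suc e → (∀ c → c ≤ n → p ∤ (suc e ℕ.* suc n ℕ.+ c)) → ∀ g → Regular (δ z) →
                     -- On the left det L raises δ^{g+2} to δ^{g+3}; on the right stand δ from det L
                     -- and δ² from the product of the D_j. So δ is cancelled three times.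
                     detᵣ (hasse n (f SExp.^ suc e)) ~ δ z ^ suc (suc g) → detᵣ (hasse n (f SExp.^ e)) ~ δ z ^ g
    det-hasse-step p∤e p∤c g reg IH = ~-cancelˡ reg (~-cancelˡ reg (~-cancelˡ reg (~-sym (~-trans
      (≈⇒~ (*-comm (δ z) (δ z ^ suc (suc g))))
      (~-trans (~-* (~-sym IH) (~-trans (~-sym (det-L z)) (~-sym (~-scalar det-B-scalar))))
      (~-trans (~-* (~-sym det-M₊) ~-refl)
      (~-trans (≈⇒~ identity)
      (~-trans (~-* (~-* det-M₋ (det-L z)) (~-trans (≈⇒~ (prod-distrib-* {suc n} (λ _ → E) D)) (~-trans (~-scalar (scalar-prod {suc n} (λ _ → E-scalar))) (prod-δ² z))))
      (≈⇒~ (solve 2 (λ a d → a :* d :* (d :* d) := d :* (d :* (d :* a))) refl (detᵣ (hasse n fᵉ)) (δ z)))))))))))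
      where
      E-scalar : Scalar E
      E-scalar = scalar (suc e) p∤e refl
      det-B-scalar : Scalar (detᵣ B)
      det-B-scalar = scalar-resp (sym det-B) (scalar-prod {suc n} (λ c → scalar (suc e ℕ.* suc n ℕ.+ (n ∸ toℕ c))
        (p∤c (n ∸ toℕ c) (ℕP.m∸n≤m n (toℕ c)))
        (sym (trans (×-homo-+ 1# (suc e ℕ.* suc n) (n ∸ toℕ c)) (+-congʳ (×1-homo-* (suc e) (suc n)))))))
      identity : detᵣ M₊ * (detᵣ B * detᵣ (L z)) ≈ detᵣ M₋ * detᵣ (L z) * prod {suc n} (λ j → E * D j)
      identity = begin
        detᵣ M₊ * (detᵣ B * detᵣ (L z))                          ≈⟨ *-congˡ (det-⊗ B (L z)) ⟨
        detᵣ M₊ * detᵣ (B ⊗ L z)                                ≈⟨ det-⊗ M₊ (B ⊗ L z) ⟨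
        detᵣ (M₊ ⊗ (B ⊗ L z))                                  ≈⟨ det-cong M₊⊗B⊗L ⟩
        detᵣ ((M₋ ⊗ L z) ⊗ diag (λ j → E * D j))               ≈⟨ det-⊗ (M₋ ⊗ L z) (diag (λ j → E * D j)) ⟩
        detᵣ (M₋ ⊗ L z) * detᵣ (diag (λ j → E * D j))           ≈⟨ *-cong (det-⊗ M₋ (L z)) (det-diag (λ j → E * D j)) ⟩
        detᵣ M₋ * detᵣ (L z) * prod {suc n} (λ j → E * D j)     ∎

-- Iterating the descent.

module Iteration (R : Ring) (q : ℕ) (p-prime : Prime (suc q))
  (char : HasCharacteristic R (suc q)) where
  open CommutativeRing R hiding (zero)
  open Exp semiring using (_^_)
  open Determinants R
  open Regularity R
  open SeriesTools R
  open RootPolynomials R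
  open Scalars R (suc q) p-prime char
  open Evaluation R q p-prime char
  open Step R q p-prime char

  -- `m` counts the descent steps from the exponent q = p - 1; each lowers the power of δ by 2.
  det-hasse-δ : ∀ {n} (z : Row (suc n)) → Regular (δ z) → ∀ m e g → e ℕ.+ m ≡ q → g ℕ.+ (m ℕ.+ m) ≡ q →
                suc n ℕ.* m ≤ q → detᵣ (hasse n (F z SExp.^ e)) ~ δ z ^ g
  det-hasse-δ z reg zero e g e≡q g≡q _ with ≡.trans (≡.sym (ℕP.+-identityʳ e)) e≡q | ≡.trans (≡.sym (ℕP.+-identityʳ g)) g≡q
  ... | ≡.refl | ≡.refl = ~-trans (~-sym (det-hasse-last z)) (det-hasse-p-1 z reg)
  det-hasse-δ {n} z reg (suc m) e g e+m≡q g+2m≡q rm≤q =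
    det-hasse-step z e p∤1+e p∤ g reg
      (det-hasse-δ z reg m (suc e) (suc (suc g)) (≡.trans (≡.sym (ℕP.+-suc e m)) e+m≡q)
        (≡.trans (≡.trans (≡.cong suc (≡.sym (ℕP.+-suc g (m ℕ.+ m)))) (≡.trans (≡.sym (ℕP.+-suc g (suc (m ℕ.+ m)))) (≡.cong (λ k → g ℕ.+ suc k) (≡.sym (ℕP.+-suc m m))))) g+2m≡q)
        (ℕP.≤-trans (ℕP.*-monoʳ-≤ (suc n) (ℕP.n≤1+n m)) rm≤q))
    where
    p∤1+e : p ∤ suc e
    p∤1+e d = ℕP.<⇒≱ (s≤s (≡.subst (suc e ≤_) e+m≡q (≡.subst (suc e ≤_) (≡.sym (ℕP.+-suc e m)) (ℕP.m≤m+n (suc e) m)))) (ℕD.∣⇒≤ d)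
    -- (e + 1) r + c ≡ c - (m + 1) r mod p, and 0 < (m + 1) r - c < p.
    p∤ : ∀ c → c ≤ n → p ∤ (suc e ℕ.* suc n ℕ.+ c)
    p∤ c c≤n d = ℕP.<⇒≱ (s≤s x≤q) (ℕD.∣⇒≤ {{ℕ.>-nonZero 0<x}} (ℕD.∣m+n∣m⇒∣n (≡.subst (p ∣_) (≡.sym total) (ℕD.m∣m*n (suc n))) d))
      where
      x : ℕ
      x = suc n ℕ.* suc m ∸ c
      c<rm : c < suc n ℕ.* suc m
      c<rm = ℕP.≤-trans (s≤s c≤n) (ℕP.m≤m*n (suc n) (suc m))
      0<x : 0 < x
      0<x = ℕP.m<n⇒0<n∸m c<rm
      x≤q : x ≤ q
      x≤q = ℕP.≤-trans (ℕP.m∸n≤m (suc n ℕ.* suc m) c) rm≤q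
      total : suc e ℕ.* suc n ℕ.+ c ℕ.+ x ≡ p ℕ.* suc n
      total = ≡.trans (ℕP.+-assoc (suc e ℕ.* suc n) c x) (≡.trans
        (≡.cong (suc e ℕ.* suc n ℕ.+_) (≡.trans (ℕP.m+[n∸m]≡n (ℕP.<⇒≤ c<rm)) (ℕP.*-comm (suc n) (suc m)))) (≡.trans
        (≡.sym (ℕP.*-distribʳ-+ (suc n) (suc e) (suc m)))
        (≡.cong (λ k → suc k ℕ.* suc n) e+m≡q)))

-- Non-zero-divisors among power series.

module RegularSeries (R : Ring) where
  open CommutativeRing R hiding (zero)
  open SeriesTools R
  open Regularity R
  module RegS = Regularity seriesRing

  -- The coefficients of `b` vanish one after another, since the k-th equation is a_0 b_k plus terms
  -- already known to be 0.
  regular-const : ∀ {a} → Regular (coef a 0) → RegS.Regular a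
  regular-const {a} reg b ab≈0 = pointwise (λ k → trans (vanish (suc k) k ℕP.≤-refl) (sym (coeff-0 k)))
    where
    vanish : ∀ n k → k < n → coef b k ≈ 0#
    conv-vanish : ∀ (c : ℕ → Carrier) n k → k < n → conv c (coef b) k ≈ 0#
    conv-vanish c n zero    l = trans (*-congˡ (vanish n 0 l)) (zeroʳ _)
    conv-vanish c n (suc k) l =
      trans (+-cong (trans (*-congˡ (vanish n (suc k) l)) (zeroʳ _)) (conv-vanish (c ∘ suc) n k (ℕP.<⇒≤ l))) (+-identityʳ _)
    vanish (suc n) zero    l       = reg _ (at ab≈0 0)
    vanish (suc n) (suc k) (s≤s l) = reg _ (trans (sym (trans (+-congˡ (conv-vanish (coef a ∘ suc) n k l)) (+-identityʳ _))) (at ab≈0 (suc k)))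

  regular-X : RegS.Regular X
  regular-X b e = pointwise (λ k → trans (sym (X*-suc b k)) (trans (at e (suc k)) (sym (coeff-0 k))))

-- The prime field, power series in n variables over it, and leading monomials.

module IntegersMod (p : ℕ) where

  infix 4 _≈_
  record _≈_ (a b : ℤ) : Set where
    constructor congruent
    field p∣a-b : + p ℤS.∣ a ℤ.- b
  open _≈_ public

  private
    via : ∀ {a b c} → c ≡ a ℤ.- b → + p ℤS.∣ c → a ≈ b
    via ≡.refl d = congruent d

    open FromIntegers ℤP.+-*-commutativeRing using (solve; _:+_; _:*_; _:-_; :-_; _:=_)

    refl′ : ∀ {a b} → a ≡ b → a ≈ b
    refl′ {a} ≡.refl = via (≡.sym (ℤP.+-inverseʳ a)) (ℤS.divides (+ 0) ≡.refl)

    add : ∀ {a b c d} → a ≈ b → c ≈ d → a ℤ.+ c ≈ b ℤ.+ d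
    add {a} {b} {c} {d} (congruent e) (congruent f) =
      via (solve 4 (λ a b c d → (a :- b) :+ (c :- d) := (a :+ c) :- (b :+ d)) ≡.refl a b c d) (ℤS.∣m∣n⇒∣m+n e f)

    mul : ∀ {a b c d} → a ≈ b → c ≈ d → a ℤ.* c ≈ b ℤ.* d
    mul {a} {b} {c} {d} (congruent e) (congruent f) =
      via (solve 4 (λ a b c d → (a :- b) :* c :+ b :* (c :- d) := (a :* c) :- (b :* d)) ≡.refl a b c d)
          (ℤS.∣m∣n⇒∣m+n (ℤS.∣m⇒∣m*n c e) (ℤS.∣n⇒∣m*n b f))

    neg : ∀ {a b} → a ≈ b → ℤ.- a ≈ ℤ.- b
    neg {a} {b} (congruent e) = via (solve 2 (λ a b → :- (a :- b) := (:- a) :- (:- b)) ≡.refl a b) (ℤS.∣m⇒∣-m e)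

    symm : ∀ {a b} → a ≈ b → b ≈ a
    symm {a} {b} (congruent e) = via (solve 2 (λ a b → :- (a :- b) := b :- a) ≡.refl a b) (ℤS.∣m⇒∣-m e)

    transi : ∀ {a b c} → a ≈ b → b ≈ c → a ≈ c
    transi {a} {b} {c} (congruent e) (congruent f) =
      via (solve 3 (λ a b c → (a :- b) :+ (b :- c) := a :- c) ≡.refl a b c) (ℤS.∣m∣n⇒∣m+n e f)

  ring : Ring
  ring = record
    { Carrier = ℤ
    ; _≈_ = _≈_
    ; _+_ = ℤ._+_
    ; _*_ = ℤ._*_
    ; -_  = ℤ.-_
    ; 0#  = + 0
    ; 1#  = + 1
    ; isCommutativeRing = record
      { isRing = record
        { +-isAbelianGroup = record
          { isGroup = record
            { isMonoid = record
              { isSemigroup = record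
                { isMagma = record
                  { isEquivalence = record { refl = refl′ ≡.refl ; sym = symm ; trans = transi }
                  ; ∙-cong = add
                  }
                ; assoc = λ a b c → refl′ (ℤP.+-assoc a b c)
                }
              ; identity = (λ a → refl′ (ℤP.+-identityˡ a)) , (λ a → refl′ (ℤP.+-identityʳ a))
              }
            ; inverse = (λ a → refl′ (ℤP.+-inverseˡ a)) , (λ a → refl′ (ℤP.+-inverseʳ a))
            ; ⁻¹-cong = neg
            }
          ; comm = λ a b → refl′ (ℤP.+-comm a b)
          }
        ; *-cong = mul
        ; *-assoc = λ a b c → refl′ (ℤP.*-assoc a b c)
        ; *-identity = (λ a → refl′ (ℤP.*-identityˡ a)) , (λ a → refl′ (ℤP.*-identityʳ a))
        ; distrib = (λ a b c → refl′ (ℤP.*-distribˡ-+ a b c)) , (λ a b c → refl′ (ℤP.*-distribʳ-+ a b c))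
        }
      ; *-comm = λ a b → refl′ (ℤP.*-comm a b)
      }
    }

  ≈0⇒∣ : ∀ {a} → a ≈ + 0 → (+ p) ℤD.∣ a
  ≈0⇒∣ {a} (congruent e) = ∣⇒∣ᵤ (≡.subst (+ p ℤS.∣_) (ℤP.+-identityʳ a) e)

  ∣⇒≈0 : ∀ {a} → (+ p) ℤD.∣ a → a ≈ + 0
  ∣⇒≈0 {a} d = congruent (≡.subst (+ p ℤS.∣_) (≡.sym (ℤP.+-identityʳ a)) (∣ᵤ⇒∣ d))

-- Poly n imposes no finiteness condition, so modulo p it is a ring of power series over 𝔽_p;
-- the first variable is the outermost one.
module Iterated (q : ℕ) (p-prime : Prime (suc q)) where
  p : ℕ
  p = suc q

  module Zp = IntegersMod p

  PS : ℕ → Ring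
  PS zero    = Zp.ring
  PS (suc n) = PowerSeries.seriesRing (PS n)

  ⟦PS_⟧ : ℕ → Set
  ⟦PS n ⟧ = CommutativeRing.Carrier (PS n)

  nat-Zp : ∀ n → Mult._×_ (CommutativeRing.semiring Zp.ring) n (+ 1) ≡ + n
  nat-Zp zero    = ≡.refl
  nat-Zp (suc n) = ≡.cong (λ k → + 1 ℤ.+ k) (nat-Zp n)

  char : ∀ n → HasCharacteristic (PS n) p
  char zero    = ≡.subst (Zp._≈ + 0) (≡.sym (nat-Zp p)) (Zp.∣⇒≈0 {+ p} ℕD.∣-refl)
  char (suc n) = pointwise λ
    { zero    → trans (coeff-· p S.1# 0) (char n)
    ; (suc k) → trans (coeff-· p S.1# (suc k)) (·-0 p) }
    where
    open CommutativeRing (PS n)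
    open SeriesTools (PS n)

  vars : ∀ n → Fin n → ⟦PS n ⟧
  vars (suc n) zero    = SeriesTools.X (PS n)
  vars (suc n) (suc j) = PowerSeries.C (PS n) (vars n j)

  module _ (n : ℕ) where
    open Scalars (PS n) p p-prime (char n) public using (Scalar; scalar)
    open Regularity (PS n) public using (Regular)

  regular-var : ∀ n j → Regular n (vars n j)
  regular-var (suc n) zero    = RegularSeries.regular-X (PS n)
  regular-var (suc n) (suc j) = RegularSeries.regular-const (PS n) (regular-var n j)

  -- At the level of the outer of the two variables, the constant term of the difference is the
  -- other variable up to sign.
  regular-var-difference : ∀ n i j → i ≢ j → Regular n (CommutativeRing._-_ (PS n) (vars n i) (vars n j))
  regular-var-difference (suc n) zero    zero    i≢j = contradiction ≡.refl i≢j
  regular-var-difference (suc n) zero    (suc j) i≢j = RegularSeries.regular-const (PS n)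
    (Regularity.regular-resp (PS n) (CommutativeRing.sym (PS n) (CommutativeRing.+-identityˡ (PS n) _)) (Regularity.regular-neg (PS n) (regular-var n j)))
  regular-var-difference (suc n) (suc i) zero    i≢j = RegularSeries.regular-const (PS n)
    (Regularity.regular-resp (PS n) (CommutativeRing.sym (PS n)
      (CommutativeRing.trans (PS n) (CommutativeRing.+-congˡ (PS n) (RingProperties.-0#≈0# (CommutativeRing.ring (PS n)))) (CommutativeRing.+-identityʳ (PS n) _)))
      (regular-var n i))
  regular-var-difference (suc n) (suc i) (suc j) i≢j =
    RegularSeries.regular-const (PS n) (regular-var-difference n i j (i≢j ∘ ≡.cong suc))

  -- Stated for an injective `ι`, so that roots can be removed while the ring stays the same.
  regular-δ : ∀ n {m} (ι : Fin m → Fin n) → (∀ {i j} → ι i ≡ ι j → i ≡ j) → Regular n (RootPolynomials.δ (PS n) (vars n ∘ ι))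
  regular-δ n {zero}  ι inj = Regularity.regular-1 (PS n)
  regular-δ n {suc m} ι inj = Regularity.regular-* (PS n)
    (Regularity.regular-prod (PS n) (λ j → regular-var-difference n (ι zero) (ι (suc j)) (λ e → 0≢suc (inj e))))
    (regular-δ n (ι ∘ suc) (λ e → suc-inj (inj e)))
    where
    0≢suc : ∀ {m} {j : Fin m} → Fin.zero ≡ Fin.suc j → ⊥
    0≢suc ()
    suc-inj : ∀ {m} {i j : Fin m} → Fin.suc i ≡ suc j → i ≡ j
    suc-inj ≡.refl = ≡.refl

  -- Lead n P h: the monomial with exponents h is the greatest monomial of P in the
  -- lexicographic order.
  Lead : ∀ n → ⟦PS n ⟧ → Vec ℕ n → Set
  Lead zero    P []       = ¬ (P Zp.≈ + 0)
  Lead (suc n) P (h ∷ hs) = (∀ k → h < k → CommutativeRing._≈_ (PS n) (coef P k) (CommutativeRing.0# (PS n)))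
                          × Lead n (coef P h) hs

  lead-resp : ∀ n {P Q hs} → CommutativeRing._≈_ (PS n) P Q → Lead n P hs → Lead n Q hs
  lead-resp zero    {hs = []}     e l       = λ Q≈0 → l (CommutativeRing.trans Zp.ring e Q≈0)
  lead-resp (suc n) {hs = h ∷ hs} e (a , l) =
    (λ k h<k → CommutativeRing.trans (PS n) (CommutativeRing.sym (PS n) (PowerSeries.at e k)) (a k h<k)) ,
    lead-resp n (PowerSeries.at e h) l

  lead-nonzero : ∀ n {P hs} → Lead n P hs → ¬ CommutativeRing._≈_ (PS n) P (CommutativeRing.0# (PS n))
  lead-nonzero zero    {hs = []}     l       P≈0 = l P≈0
  lead-nonzero (suc n) {hs = h ∷ hs} (_ , l) P≈0 =
    lead-nonzero n l (CommutativeRing.trans (PS n) (PowerSeries.at P≈0 h) (SeriesTools.coeff-0 (PS n) h))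

  lead-unique : ∀ n {P hs hs′} → Lead n P hs → Lead n P hs′ → hs ≡ hs′
  lead-unique zero    {hs = []}     {[]}       _       _         = ≡.refl
  lead-unique (suc n) {hs = h ∷ hs} {h′ ∷ hs′} (a , l) (a′ , l′) with ℕP.<-cmp h h′
  ... | tri< h<h′ _ _     = contradiction (a h′ h<h′) (lead-nonzero n l′)
  ... | tri≈ _ ≡.refl _   = ≡.cong (h ∷_) (lead-unique n l l′)
  ... | tri> _ _ h′<h     = contradiction (a′ h h′<h) (lead-nonzero n l)

  lead-* : ∀ n {P Q hs hs′} → Lead n P hs → Lead n Q hs′ → Lead n (CommutativeRing._*_ (PS n) P Q) (zipWith ℕ._+_ hs hs′)
  lead-* zero    {P} {Q} {hs = []}     {[]}       l l′ PQ≈0 =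
    [ (λ d → l (Zp.∣⇒≈0 {P} d)) , (λ d → l′ (Zp.∣⇒≈0 {Q} d)) ]′
      (euclidsLemma ℤ.∣ P ∣ ℤ.∣ Q ∣ p-prime (≡.subst (p ∣_) (ℤP.abs-* P Q) (Zp.≈0⇒∣ PQ≈0)))
  lead-* (suc n) {P} {Q} {hs = h ∷ hs} {h′ ∷ hs′} (a , l) (a′ , l′) =
    above top , lead-resp n (CommutativeRing.sym (PS n) (atTop top)) (lead-* n l l′)
    where
    open SeriesTools (PS n)
    top = hasTop-* {P} {Q} {h} {h′} (hasTop a (CommutativeRing.refl (PS n))) (hasTop a′ (CommutativeRing.refl (PS n)))

  lead-C : ∀ n {P hs} → Lead n P hs → Lead (suc n) (PowerSeries.C (PS n) P) (0 ∷ hs)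
  lead-C n l = (λ { (suc k) _ → CommutativeRing.refl (PS n) }) , l

  lead-1 : ∀ n → Lead n (CommutativeRing.1# (PS n)) (Vec.replicate n 0)
  lead-1 zero    1≈0 = contradiction (ℕD.∣1⇒≡1 (Zp.≈0⇒∣ 1≈0)) (Scalars.p≢1 Zp.ring p p-prime (char 0))
  lead-1 (suc n) = lead-C n (lead-1 n)

  lead-^ : ∀ n {P hs} g → Lead n P hs → Lead n (Exp._^_ (CommutativeRing.semiring (PS n)) P g) (Vec.map (g ℕ.*_) hs)
  lead-^ n {P} {hs} zero l = ≡.subst (Lead n _) (zeros hs) (lead-1 n)
    where
    zeros : ∀ {m} (hs : Vec ℕ m) → Vec.replicate m 0 ≡ Vec.map (0 ℕ.*_) hs
    zeros []       = ≡.refl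
    zeros (_ ∷ hs) = ≡.cong (0 ∷_) (zeros hs)
  lead-^ n {P} {hs} (suc g) l = ≡.subst (Lead n _) (step hs) (lead-* n l (lead-^ n g l))
    where
    step : ∀ {m} (hs : Vec ℕ m) → zipWith ℕ._+_ hs (Vec.map (g ℕ.*_) hs) ≡ Vec.map (suc g ℕ.*_) hs
    step []       = ≡.refl
    step (_ ∷ hs) = ≡.cong (_ ∷_) (step hs)

  -- A scalar is an integer multiple of 1, hence acts on the coefficients at every level as the same
  -- multiple of 1.
  lead-scalar : ∀ n {s P hs} → Scalar n s → Lead n P hs → Lead n (CommutativeRing._*_ (PS n) s P) hs
  lead-scalar zero {s} {P} {[]} Ss l sP≈0 with Scalars.scalar-inverse Zp.ring p p-prime (char 0) Ss
  ... | t , _ , ts≈1 = l (begin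
      P                 ≈⟨ *-identityˡ P ⟨
      + 1 ℤ.* P         ≈⟨ *-congʳ {P} ts≈1 ⟨
      t ℤ.* s ℤ.* P     ≈⟨ *-assoc t s P ⟩
      t ℤ.* (s ℤ.* P)   ≈⟨ *-congˡ {t} sP≈0 ⟩
      t ℤ.* + 0         ≈⟨ zeroʳ t ⟩
      + 0               ∎)
    where
    open CommutativeRing Zp.ring hiding (zero)
    open SetoidReasoning setoid
  lead-scalar (suc n) {s} {P} {h ∷ hs} (scalar m p∤m s≈m) (a , l) =
    (λ k h<k → trans (scaled k) (trans (*-congˡ (a k h<k)) (zeroʳ _))) ,
    lead-resp n (sym (scaled h)) (lead-scalar n m-scalar l)
    where
    open CommutativeRing (PS n) hiding (zero)
    open SeriesTools (PS n)
    open Mult semiring using () renaming (_×_ to _·_)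
    m-scalar : Scalar n (m · 1#)
    m-scalar = Scalars.scalar {PS n} {char = char n} m p∤m refl
    scaled : ∀ k → coef (s *ₛ P) k ≈ (m · 1#) * coef P k
    scaled k = trans (at (S.*-congʳ {P} {s} {C (m · 1#)} (S.trans s≈m (pointwise λ
        { zero    → coeff-· m S.1# 0
        ; (suc k) → trans (coeff-· m S.1# (suc k)) (·-0 m) }))) k)
      (C*-coeff (m · 1#) P k)

-- Coefficients with respect to one of the roots.

module TopCoefficients (R : Ring) where
  open CommutativeRing R hiding (zero)
  open RingProperties ring using (-0#≈0#)
  open Sum semiring using (sum)
  open Mult semiring using (×-homo-+) renaming (_×_ to _·_)
  open Exp semiring using (_^_)
  open Determinants R
  open SeriesTools R
  open RootPolynomials R
  open FromIntegers R using (solve; _:+_; _:*_; _:-_; :-_; _:=_)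
  module DS = Determinants seriesRing
  module SS = SeriesTools seriesRing
  module RS = RootPolynomials seriesRing
  open SetoidReasoning setoid

  hasTop-neg : ∀ {a n α} → HasTop a n α → HasTop (-ₛ a) n (- α)
  hasTop-neg t = hasTop (λ k l → trans (-‿cong (above t k l)) -0#≈0#) (-‿cong (atTop t))

  hasTop-sgn : ∀ {n} (j : Fin n) → HasTop (DS.sgn j) 0 (sgn j)
  hasTop-sgn zero    = hasTop-C 1#
  hasTop-sgn (suc j) = hasTop-neg (hasTop-sgn j)

  hasTop-sum : ∀ {m n} {f : Fin m → Series Carrier} {α : Fin m → Carrier} →
               (∀ i → HasTop (f i) n (α i)) → HasTop (SSum.sum f) n (sum α)
  hasTop-sum {zero}  {n} t = hasTop (λ k _ → coeff-0 k) (coeff-0 n)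
  hasTop-sum {suc m}     t = hasTop-+ (t zero) (hasTop-sum (t ∘ suc))

  total : ∀ {d} → (Fin d → ℕ) → ℕ
  total {zero}  N = 0
  total {suc d} N = N zero ℕ.+ total (N ∘ suc)

  hasTop-det : ∀ {d} {A : DS.Matrix d d} {N : Fin d → ℕ} {T : Matrix d d} →
               (∀ i j → HasTop (A i j) (N i) (T i j)) → HasTop (DS.detᵣ A) (total N) (detᵣ T)
  hasTop-det {zero}  t = hasTop-C 1#
  hasTop-det {suc d} {A} {N} {T} t = hasTop-sum {suc d} {f = λ j → DS.sgn j S.* (A zero j S.* DS.detᵣ (DS.minor A j))}
    (λ j → hasTop-* (hasTop-sgn j) (hasTop-* (t zero j) (hasTop-det (λ a b → t (suc a) (punchIn j b)))))

  -- Two variables are present: x is outermost, and a root y is the `X` of the coefficient ring. A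
  -- series in x is regarded as one with coefficients constant in y.
  map-C : Series Carrier → Series (Series Carrier)
  coef (map-C w) k = C (coef w k)

  map-C-* : ∀ v w → map-C (v *ₛ w) SS.≈ₛ map-C v SS.*ₛ map-C w
  map-C-* v w = SS.pointwise (go (coef v) (coef w))
    where
    go : ∀ a b k → C (conv a b k) ≈ₛ SS.conv (C ∘ a) (C ∘ b) k
    go a b zero    = C-* _ _
    go a b (suc k) = S.trans (C-+ _ _) (S.+-cong (C-* _ _) (go (a ∘ suc) b k))

  map-C-1 : map-C S.1# SS.≈ₛ SS.S.1#
  map-C-1 = SS.pointwise λ { zero → S.refl ; (suc k) → S.refl }

  map-C-^ : ∀ w e → map-C (w SExp.^ e) SS.≈ₛ map-C w SS.SExp.^ e
  map-C-^ w zero    = map-C-1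
  map-C-^ w (suc e) = SS.S.trans (map-C-* w (w SExp.^ e)) (SS.S.*-congˡ {map-C w} (map-C-^ w e))

  map-C-lin : ∀ x → map-C (lin x) SS.≈ₛ SS.lin (C x)
  map-C-lin x = SS.pointwise λ
    { zero          → S.trans (C-+ 0# (- x)) (S.+-congˡ {C 0#} (C-neg x))
    ; (suc zero)    → S.trans (C-+ 1# (- 0#)) (S.+-congˡ {C 1#} (C-neg 0#))
    ; (suc (suc k)) → S.trans (C-+ 0# (- 0#)) (S.+-congˡ {C 0#} (C-neg 0#)) }

  map-C-F : ∀ {n} (z : Row n) → map-C (F z) SS.≈ₛ RS.F (C ∘ z)
  map-C-F {zero}  z = map-C-1
  map-C-F {suc n} z = SS.S.trans (map-C-* (lin (z zero)) (F (z ∘ suc))) (SS.S.*-cong (map-C-lin (z zero)) (map-C-F (z ∘ suc)))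

  -- β e l is the coefficient of y^l in (1 - y)^e.
  β : ℕ → ℕ → Carrier
  β zero    zero    = 1#
  β zero    (suc l) = 0#
  β (suc e) zero    = β e zero
  β (suc e) (suc l) = β e (suc l) - β e l

  parity : ℕ → Carrier
  parity zero    = 1#
  parity (suc l) = - parity l

  β-binomial : ∀ e l → β e l ≈ parity l * ((e Comb.C l) · 1#)
  β-binomial zero    zero    = trans (sym (+-identityʳ _)) (sym (*-identityˡ _))
  β-binomial zero    (suc l) = sym (zeroʳ _)
  β-binomial (suc e) zero    = trans (β-binomial e zero) (reflexive ≡.refl)
  β-binomial (suc e) (suc l) = begin
    β e (suc l) - β e l
      ≈⟨ +-cong (β-binomial e (suc l)) (-‿cong (β-binomial e l)) ⟩
    - parity l * ((e Comb.C suc l) · 1#) - parity l * ((e Comb.C l) · 1#)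
      ≈⟨ solve 3 (λ s a b → :- s :* b :- s :* a := :- s :* (a :+ b)) refl (parity l) ((e Comb.C l) · 1#) ((e Comb.C suc l) · 1#) ⟩
    - parity l * ((e Comb.C l) · 1# + (e Comb.C suc l) · 1#)
      ≈⟨ *-congˡ (trans (sym (×-homo-+ 1# (e Comb.C l) (e Comb.C suc l))) (reflexive (≡.cong (_· 1#) (nCk+nC[k+1]≡[n+1]C[k+1] e l)))) ⟩
    - parity l * ((suc e Comb.C suc l) · 1#) ∎

  β-above : ∀ {e l} → e < l → β e l ≈ 0#
  β-above {e} {l} e<l = trans (β-binomial e l) (trans (*-congˡ (reflexive (≡.cong (_· 1#) (k>n⇒nCk≡0 e<l)))) (zeroʳ _))

  -- The binomial expansion of (x - y)^e, at y^l. For l > e the truncation in `e ∸ l` is harmless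
  -- because β e l is 0.
  lin-X^-slice : ∀ e w k l → coef (coef (SS.lin X SS.SExp.^ e SS.*ₛ map-C w) k) l ≈
                             β e l * coef (X SExp.^ (e ∸ l) *ₛ w) k
  lin-X^-slice zero    w k l = trans (at (SS.at (SS.S.*-identityˡ (map-C w)) k) l) (case l)
    where
    case : ∀ l → coef (C (coef w k)) l ≈ β zero l * coef (X SExp.^ (zero ∸ l) *ₛ w) k
    case zero    = trans (sym (at (S.*-identityˡ w) k)) (sym (*-identityˡ _))
    case (suc l) = sym (zeroˡ _)
  lin-X^-slice (suc e) w k l = trans (at (SS.at expanded k) l) (case k l)
    where
    T : Series (Series Carrier)
    T = SS.lin X SS.SExp.^ e SS.*ₛ map-C w
    expanded : SS.lin X SS.SExp.^ suc e SS.*ₛ map-C w SS.≈ₛ SS.X SS.*ₛ T SS.S.- SS.C X SS.*ₛ T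
    expanded = SS.S.trans (SS.S.*-assoc (SS.lin X) (SS.lin X SS.SExp.^ e) (map-C w))
      (RingProperties.[y-z]x≈yx-zx SS.S.ring T SS.X (SS.C X))
    shifted : ∀ k l → coef (coef (SS.X SS.*ₛ T) k) l ≈ β e l * coef (X *ₛ (X SExp.^ (e ∸ l) *ₛ w)) k
    shifted zero    l = trans (trans (at (SS.X*-zero T) l) (coeff-0 l)) (sym (trans (*-congˡ (X*-zero (X SExp.^ (e ∸ l) *ₛ w))) (zeroʳ _)))
    shifted (suc k) l = trans (at (SS.X*-suc T k) l) (trans (lin-X^-slice e w k l) (*-congˡ (sym (X*-suc (X SExp.^ (e ∸ l) *ₛ w) k))))
    case : ∀ k l → coef (coef (SS.X SS.*ₛ T) k) l - coef (coef (SS.C X SS.*ₛ T) k) l ≈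
                   β (suc e) l * coef (X SExp.^ (suc e ∸ l) *ₛ w) k
    case k zero = begin
      coef (coef (SS.X SS.*ₛ T) k) 0 - coef (coef (SS.C X SS.*ₛ T) k) 0
        ≈⟨ +-cong (shifted k 0) (trans (-‿cong (trans (at (SS.C*-coeff X T k) 0) (X*-zero (coef T k)))) -0#≈0#) ⟩
      β e 0 * coef (X *ₛ (X SExp.^ e *ₛ w)) k + 0#
        ≈⟨ trans (+-identityʳ _) (*-congˡ (at (S.sym (S.*-assoc X (X SExp.^ e) w)) k)) ⟩
      β e 0 * coef (X SExp.^ suc e *ₛ w) k ∎
    case k (suc l) = begin
      coef (coef (SS.X SS.*ₛ T) k) (suc l) - coef (coef (SS.C X SS.*ₛ T) k) (suc l)
        ≈⟨ +-cong (shifted k (suc l)) (-‿cong (trans (at (SS.C*-coeff X T k) (suc l)) (trans (X*-suc (coef T k) l) (lin-X^-slice e w k l)))) ⟩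
      β e (suc l) * coef (X *ₛ (X SExp.^ (e ∸ suc l) *ₛ w)) k - β e l * c
        ≈⟨ +-congʳ step ⟩
      β e (suc l) * c - β e l * c
        ≈⟨ solve 3 (λ a b c → a :* c :- b :* c := (a :- b) :* c) refl (β e (suc l)) (β e l) c ⟩
      (β e (suc l) - β e l) * c ∎
      where
      c = coef (X SExp.^ (e ∸ l) *ₛ w) k
      step : β e (suc l) * coef (X *ₛ (X SExp.^ (e ∸ suc l) *ₛ w)) k ≈ β e (suc l) * c
      step with suc l ℕ.≤? e
      ... | yes l<e = *-congˡ (trans (at (S.sym (S.*-assoc X (X SExp.^ (e ∸ suc l)) w)) k)
                                     (reflexive (≡.cong (λ i → coef (X SExp.^ i *ₛ w) k) (≡.sym (ℕP.+-∸-assoc 1 l<e)))))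
      ... | no l≮e  = trans (trans (*-congʳ (β-above (ℕP.≰⇒> l≮e))) (zeroˡ _))
                            (sym (trans (*-congʳ (β-above (ℕP.≰⇒> l≮e))) (zeroˡ _)))

  -- For z = `vars s` this unfolds to `F` of `vars (suc s)`, y being the first variable.
  F⁺ : ∀ {s} → Row s → Series (Series Carrier)
  F⁺ z = SS.lin X SS.*ₛ RS.F (C ∘ z)

  F⁺-slice : ∀ {s} (z : Row s) e m k l → coef (coef (SS.X SS.SExp.^ m SS.*ₛ F⁺ z SS.SExp.^ e) k) l ≈
             β e l * coef (X SExp.^ m *ₛ (X SExp.^ (e ∸ l) *ₛ F z SExp.^ e)) k
  F⁺-slice z e m k l with m ℕ.≤? k
  ... | no m≰k  = trans (trans (at (SS.X^*-< m (F⁺ z SS.SExp.^ e) (ℕP.≰⇒> m≰k)) l) (coeff-0 l))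
                        (sym (trans (*-congˡ (X^*-< m (X SExp.^ (e ∸ l) *ₛ F z SExp.^ e) (ℕP.≰⇒> m≰k))) (zeroʳ _)))
  ... | yes m≤k = begin
    coef (coef (SS.X SS.SExp.^ m SS.*ₛ F⁺ z SS.SExp.^ e) k) l
      ≈⟨ at (SS.X^*-≥ m (F⁺ z SS.SExp.^ e) m≤k) l ⟩
    coef (coef (F⁺ z SS.SExp.^ e) (k ∸ m)) l
      ≈⟨ at (SS.at power (k ∸ m)) l ⟩
    coef (coef (SS.lin X SS.SExp.^ e SS.*ₛ map-C (F z SExp.^ e)) (k ∸ m)) l
      ≈⟨ lin-X^-slice e (F z SExp.^ e) (k ∸ m) l ⟩
    β e l * coef (X SExp.^ (e ∸ l) *ₛ F z SExp.^ e) (k ∸ m)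
      ≈⟨ *-congˡ (X^*-≥ m (X SExp.^ (e ∸ l) *ₛ F z SExp.^ e) m≤k) ⟨
    β e l * coef (X SExp.^ m *ₛ (X SExp.^ (e ∸ l) *ₛ F z SExp.^ e)) k ∎
    where
    power : F⁺ z SS.SExp.^ e SS.≈ₛ SS.lin X SS.SExp.^ e SS.*ₛ map-C (F z SExp.^ e)
    power = SS.S.trans (CExp.^-distrib-* SS.S.commutativeSemiring (SS.lin X) (RS.F (C ∘ z)) e)
      (SS.S.*-congˡ {SS.lin X SS.SExp.^ e} (SS.S.trans (SS.SExp.^-congˡ e (SS.S.sym (map-C-F z))) (SS.S.sym (map-C-^ (F z) e))))

-- The leading monomial of det M_d(f^e).

module LeadingDeterminant (q : ℕ) (p-prime : Prime (suc q)) where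
  open Iterated q p-prime hiding (scalar)
  open PrimeBinomials (suc q) p-prime using (p∤nCk)
  module Ev (s : ℕ) = Evaluation (PS s) q p-prime (char s)
  module Det (s : ℕ) = Determinants (PS s)

  power : ∀ s → ℕ → Series ⟦PS s ⟧
  power s e = SeriesTools.SExp._^_ (PS s) (RootPolynomials.F (PS s) (vars s)) e

  hasse : ∀ s d → ℕ → Fin d → Fin d → ⟦PS s ⟧
  hasse s d e = Ev.hasse s d (power s e)

  -- The exponents of the leading monomial of det M_d(f^e) for s roots; d drops by one when
  -- the remaining s - 1 roots give too small a degree for the last row.
  leadExponents : ℕ → ∀ s → ℕ → Vec ℕ s
  leadExponents e zero    d = []
  leadExponents e (suc s) d with d ℕ.* q ℕ.≤? s ℕ.* e
  ... | yes _ = d ℕ.* e ∷ leadExponents e s d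
  ... | no  _ = ℕ.pred d ℕ.* e ℕ.+ (suc s ℕ.* e ∸ d ℕ.* q) ∷ leadExponents e s (ℕ.pred d)

  module _ (s : ℕ) where
    open CommutativeRing (PS s) hiding (zero)
    open Mult semiring using () renaming (_×_ to _·_)
    open Determinants (PS s)
    open Multiplicativity (PS s) using (det-⊗)
    open SpecialDeterminants (PS s)
    open Diagonal (PS s)
    open SeriesTools (PS s)
    open RootPolynomials (PS s)
    open TopCoefficients (PS s)
    open Scalars (PS s) p p-prime (char s) hiding (Scalar)
    open SetoidReasoning setoid

    scalar-β : ∀ {e l} → e ≤ q → l ≤ e → Scalar s (β e l)
    scalar-β {e} {l} e≤q l≤e = scalar-resp (sym (β-binomial e l))
      (scalar-* (scalar-parity l) (scalar (e Comb.C l) (p∤nCk l≤e (s≤s e≤q)) refl))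
      where
      scalar-parity : ∀ l → Scalar s (parity l)
      scalar-parity zero    = scalar-1
      scalar-parity (suc l) = scalar-neg (scalar-parity l)

    hasse-slice : ∀ d e a b l → coef (hasse (suc s) d e a b) l ≈
                  β e l * coef (X SExp.^ (d ∸ toℕ b) *ₛ (X SExp.^ (e ∸ l) *ₛ power s e)) (suc (toℕ a) ℕ.* p)
    hasse-slice d e a b l = F⁺-slice (vars s) e (d ∸ toℕ b) (suc (toℕ a) ℕ.* p) l

    slice-above : ∀ d e a b l → e < l → coef (hasse (suc s) d e a b) l ≈ 0#
    slice-above d e a b l e<l = trans (hasse-slice d e a b l) (trans (*-congʳ (β-above e<l)) (zeroˡ _))

    slice-top : ∀ d e a b → coef (hasse (suc s) d e a b) e ≈
                β e e * coef (X SExp.^ (d ∸ toℕ b) *ₛ power s e) (suc (toℕ a) ℕ.* p)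
    slice-top d e a b = trans (hasse-slice d e a b e) (*-congˡ (at (S.*-congˡ {X SExp.^ (d ∸ toℕ b)}
      (S.trans (S.*-congʳ {power s e} (S.reflexive (≡.cong (X SExp.^_) (ℕP.n∸n≡0 e)))) (S.*-identityˡ (power s e)))) (suc (toℕ a) ℕ.* p)))

    det-scaled : ∀ {d} (c : Carrier) → Scalar s c → (A : Matrix d d) → detᵣ (λ i j → c * A i j) ~ detᵣ A
    det-scaled {d} c Sc A = ~-trans
      (≈⇒~ (trans (det-cong (λ i j → sym (diag-⊗ (λ _ → c) A i j))) (det-⊗ (diag (λ _ → c)) A)))
      (~-scalar (scalar-resp (sym (det-diag {d} (λ _ → c))) (scalar-prod {d} (λ _ → Sc))))

    lead-~ : ∀ {a b hs} → a ~ b → Lead s b hs → Lead s a hs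
    lead-~ (c , Sc , a≈cb) l = lead-resp s (sym a≈cb) (lead-scalar s Sc l)

    -- Every entry has degree at most e in the first root, and its coefficient there is the unit β e
    -- e times the corresponding entry for the other roots.
    lead-full : ∀ d e {hs} → e ≤ q → Lead s (Det.detᵣ s (hasse s d e)) hs →
                Lead (suc s) (Det.detᵣ (suc s) (hasse (suc s) d e)) (d ℕ.* e ∷ hs)
    lead-full d e {hs} e≤q l = ≡.subst (λ k → Lead (suc s) (Det.detᵣ (suc s) (hasse (suc s) d e)) (k ∷ hs)) (total-const d)
      (above t , lead-~ (~-trans (≈⇒~ (atTop t)) (det-scaled (β e e) (scalar-β e≤q ℕP.≤-refl) (hasse s d e))) l)
      where
      t = hasTop-det {A = hasse (suc s) d e} {N = λ _ → e} (λ a b → hasTop (slice-above d e a b) (slice-top d e a b))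
      total-const : ∀ d → total {d} (λ _ → e) ≡ d ℕ.* e
      total-const zero    = ≡.refl
      total-const (suc d) = ≡.cong (e ℕ.+_) (total-const d)

    rowDegree : ℕ → ℕ → ∀ d → Fin (suc d) → ℕ
    rowDegree e b₀ zero    zero    = b₀
    rowDegree e b₀ (suc d) zero    = e
    rowDegree e b₀ (suc d) (suc i) = rowDegree e b₀ d i

    rowDegree-last : ∀ e b₀ d → rowDegree e b₀ d (fromℕ d) ≡ b₀
    rowDegree-last e b₀ zero    = ≡.refl
    rowDegree-last e b₀ (suc d) = rowDegree-last e b₀ d

    rowDegree-inject₁ : ∀ e b₀ d i → rowDegree e b₀ d (inject₁ i) ≡ e
    rowDegree-inject₁ e b₀ (suc d) zero    = ≡.refl
    rowDegree-inject₁ e b₀ (suc d) (suc i) = rowDegree-inject₁ e b₀ d i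

    rowDegree-total : ∀ e b₀ d → total (rowDegree e b₀ d) ≡ d ℕ.* e ℕ.+ b₀
    rowDegree-total e b₀ zero    = ℕP.+-identityʳ b₀
    rowDegree-total e b₀ (suc d) = ≡.trans (≡.cong (e ℕ.+_) (rowDegree-total e b₀ d)) (≡.sym (ℕP.+-assoc e (d ℕ.* e) b₀))

    -- The last row is (β e b₀ y^{b₀}, 0, …, 0) up to lower powers of y.
    module _ (d e b₀ : ℕ) (e≤q : e ≤ q) (b₀<e : b₀ < e) (b₀≡ : e ℕ.+ s ℕ.* e ≡ b₀ ℕ.+ suc d ℕ.* q) where
      A : Fin (suc d) → Fin (suc d) → ⟦PS suc s ⟧
      A = hasse (suc s) (suc d) e

      N : ℕ
      N = suc (toℕ (fromℕ d)) ℕ.* p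

      N≡ : N ≡ suc d ℕ.+ suc d ℕ.* q
      N≡ = ≡.trans (≡.cong (λ i → suc i ℕ.* p) (FinP.toℕ-fromℕ d)) (ℕP.*-suc (suc d) q)

      power-top : ∀ l m → HasTop (X SExp.^ m *ₛ (X SExp.^ (e ∸ l) *ₛ power s e)) (m ℕ.+ ((e ∸ l) ℕ.+ s ℕ.* e)) 1#
      power-top l m = hasTop-resp S.refl (trans (*-identityˡ _) (*-identityˡ _))
        (hasTop-* (X^-top m) (hasTop-* (X^-top (e ∸ l)) (≡.subst (λ k → HasTop (power s e) k 1#) (ℕP.*-comm e s) (hasTop-^ e (F-top (vars s))))))

      degree : ∀ {l} → l ≤ e → ((e ∸ l) ℕ.+ s ℕ.* e) ℕ.+ l ≡ b₀ ℕ.+ suc d ℕ.* q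
      degree {l} l≤e = ≡.trans (ℕP.+-comm _ l) (≡.trans (≡.sym (ℕP.+-assoc l (e ∸ l) (s ℕ.* e)))
        (≡.trans (≡.cong (ℕ._+ s ℕ.* e) (ℕP.m+[n∸m]≡n l≤e)) b₀≡))

      degree-b₀ : (e ∸ b₀) ℕ.+ s ℕ.* e ≡ suc d ℕ.* q
      degree-b₀ = ℕP.+-cancelʳ-≡ b₀ _ _ (≡.trans (degree (ℕP.<⇒≤ b₀<e)) (ℕP.+-comm b₀ _))

      last-above : ∀ b l → b₀ < l → coef (A (fromℕ d) b) l ≈ 0#
      last-above b l b₀<l with l ℕ.≤? e
      ... | no l≰e  = slice-above (suc d) e (fromℕ d) b l (ℕP.≰⇒> l≰e)
      ... | yes l≤e = trans (hasse-slice (suc d) e (fromℕ d) b l) (trans (*-congˡ (above (power-top l (suc d ∸ toℕ b)) N small)) (zeroʳ _))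
        where
        small : (suc d ∸ toℕ b) ℕ.+ ((e ∸ l) ℕ.+ s ℕ.* e) < N
        small = ≡.subst ((suc d ∸ toℕ b) ℕ.+ ((e ∸ l) ℕ.+ s ℕ.* e) <_) (≡.sym N≡) (ℕP.+-mono-≤-< (ℕP.m∸n≤m (suc d) (toℕ b))
          (ℕP.+-cancelʳ-< l _ _ (≡.subst₂ _<_ (≡.sym (degree l≤e)) (ℕP.+-comm l (suc d ℕ.* q)) (ℕP.+-monoˡ-< (suc d ℕ.* q) b₀<l))))

      last-zero : coef (A (fromℕ d) zero) b₀ ≈ β e b₀
      last-zero = trans (hasse-slice (suc d) e (fromℕ d) zero b₀) (trans
        (*-congˡ (trans (reflexive (≡.cong (coef (X SExp.^ suc d *ₛ (X SExp.^ (e ∸ b₀) *ₛ power s e)))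
                   (≡.trans N≡ (≡.cong (suc d ℕ.+_) (≡.sym degree-b₀))))) (atTop (power-top b₀ (suc d)))))
        (*-identityʳ _))

      last-suc : ∀ b → coef (A (fromℕ d) (suc b)) b₀ ≈ 0#
      last-suc b = trans (hasse-slice (suc d) e (fromℕ d) (suc b) b₀) (trans (*-congˡ (above (power-top b₀ (d ∸ toℕ b)) N small)) (zeroʳ _))
        where
        small : (d ∸ toℕ b) ℕ.+ ((e ∸ b₀) ℕ.+ s ℕ.* e) < N
        small = ≡.subst₂ _<_ (≡.cong ((d ∸ toℕ b) ℕ.+_) (≡.sym degree-b₀)) (≡.sym N≡)
          (ℕP.+-monoˡ-< (suc d ℕ.* q) (s≤s (ℕP.m∸n≤m d (toℕ b))))

      T : Matrix (suc d) (suc d)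
      T i j = coef (A i j) (rowDegree e b₀ d i)

      A-top : ∀ i j → HasTop (A i j) (rowDegree e b₀ d i) (T i j)
      A-top i j = hasTop (λ l → bound i j l) refl
        where
        bound : ∀ i j l → rowDegree e b₀ d i < l → coef (A i j) l ≈ 0#
        bound i j l r<l with view i
        ... | ‵fromℕ     = last-above j l (≡.subst (_< l) (rowDegree-last e b₀ d) r<l)
        ... | ‵inject₁ i = slice-above (suc d) e (inject₁ i) j l (≡.subst (_< l) (rowDegree-inject₁ e b₀ d i) r<l)

      T-inject₁ : ∀ i j → T (inject₁ i) (suc j) ≈ β e e * hasse s d e i j
      T-inject₁ i j = begin
        coef (A (inject₁ i) (suc j)) (rowDegree e b₀ d (inject₁ i))
          ≡⟨ ≡.cong (coef (A (inject₁ i) (suc j))) (rowDegree-inject₁ e b₀ d i) ⟩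
        coef (A (inject₁ i) (suc j)) e
          ≈⟨ slice-top (suc d) e (inject₁ i) (suc j) ⟩
        β e e * coef (X SExp.^ (d ∸ toℕ j) *ₛ power s e) (suc (toℕ (inject₁ i)) ℕ.* p)
          ≡⟨ ≡.cong (λ k → β e e * coef (X SExp.^ (d ∸ toℕ j) *ₛ power s e) (suc k ℕ.* p)) (FinP.toℕ-inject₁ i) ⟩
        β e e * hasse s d e i j ∎

      det-T : detᵣ T ~ detᵣ (hasse s d e)
      det-T = ~-trans (≈⇒~ (trans
          (det-lastRow T (λ j → trans (reflexive (≡.cong (coef (A (fromℕ d) (suc j))) (rowDegree-last e b₀ d))) (last-suc j)))
          (*-congˡ {sgn (fromℕ d)} (*-cong (trans (reflexive (≡.cong (coef (A (fromℕ d) zero)) (rowDegree-last e b₀ d))) last-zero)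
                          (det-cong {d} {λ a b → T (inject₁ a) (suc b)} {λ i j → β e e * hasse s d e i j} T-inject₁)))))
        (~-trans (~-scalar (scalar-sgn (fromℕ d)))
        (~-trans (~-scalar (scalar-β e≤q (ℕP.<⇒≤ b₀<e)))
        (det-scaled (β e e) (scalar-β e≤q ℕP.≤-refl) (hasse s d e))))

      lead-drop : ∀ {hs} → Lead s (Det.detᵣ s (hasse s d e)) hs →
                  Lead (suc s) (Det.detᵣ (suc s) (hasse (suc s) (suc d) e)) (d ℕ.* e ℕ.+ b₀ ∷ hs)
      lead-drop {hs} l = ≡.subst (λ k → Lead (suc s) (Det.detᵣ (suc s) A) (k ∷ hs)) (rowDegree-total e b₀ d)
        (above t , lead-~ (~-trans (≈⇒~ (atTop t)) det-T) l)
        where t = hasTop-det {A = A} {N = rowDegree e b₀ d} {T = T} A-top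

  -- The inequality d q ≤ s e allows the last row to be nonzero. If both d and s drop by one it
  -- persists because e ≤ q; if only s drops, it is the case condition.
  lead-det : ∀ s d e → 1 ≤ q → e ≤ q → d ℕ.* q ≤ s ℕ.* e → Lead s (Det.detᵣ s (hasse s d e)) (leadExponents e s d)
  lead-det zero    zero    e 1≤q e≤q _  = lead-1 zero
  lead-det zero    (suc d) e 1≤q e≤q dq≤0 = contradiction (ℕP.≤-trans 1≤q (ℕP.≤-trans (ℕP.m≤m+n q (d ℕ.* q)) dq≤0)) λ ()
  lead-det (suc s) d e 1≤q e≤q dq≤ with d ℕ.* q ℕ.≤? s ℕ.* e
  lead-det (suc s) d e 1≤q e≤q dq≤ | yes dq≤se = lead-full s d e e≤q (lead-det s d e 1≤q e≤q dq≤se)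
  lead-det (suc s) zero e 1≤q e≤q dq≤ | no dq≰se = contradiction z≤n dq≰se
  lead-det (suc s) (suc d) e 1≤q e≤q dq≤ | no dq≰se =
    lead-drop s d e b₀ e≤q b₀<e b₀≡ (lead-det s d e 1≤q e≤q
      (ℕP.+-cancelˡ-≤ q _ _ (ℕP.≤-trans dq≤ (ℕP.+-monoˡ-≤ (s ℕ.* e) e≤q))))
    where
    -- The largest l for which x^{d+1} x^{e-l} times the e-th power for the other s roots still
    -- reaches degree (d + 1) p.
    b₀ : ℕ
    b₀ = suc s ℕ.* e ∸ suc d ℕ.* q
    b₀≡ : e ℕ.+ s ℕ.* e ≡ b₀ ℕ.+ suc d ℕ.* q
    b₀≡ = ≡.sym (ℕP.m∸n+n≡m dq≤)
    b₀<e : b₀ < e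
    b₀<e = ℕP.+-cancelʳ-< (suc d ℕ.* q) b₀ e (≡.subst (_< e ℕ.+ suc d ℕ.* q) b₀≡ (ℕP.+-monoʳ-< e (ℕP.≰⇒> dq≰se)))

-- Comparison of the exponents of leading monomials.

δExponents : ∀ s → Vec ℕ s
δExponents zero    = []
δExponents (suc s) = s ∷ δExponents s

module Classification (q : ℕ) (p-prime : Prime (suc q)) (1≤q : 1 ≤ q)
  (m e g : ℕ) (m+e≡q : m ℕ.+ e ≡ q) (1≤g : 1 ≤ g) where
  open LeadingDeterminant q p-prime using (leadExponents)
  open ≡ using (refl; sym; trans; cong; subst)
  open +-*-Solver
  open ≡.≡-Reasoning

  -- The possibilities for s roots, where m = p - 1 - e. For s = 1 and d = 0 the exponents do not
  -- determine `g`, hence the alternative in `corank1`.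
  data Shape (s d : ℕ) : Set where
    full   : d ≡ s → m ≡ 0 → Shape s d
    corank1 : suc d ≡ s → s ≡ 1 ⊎ g ℕ.+ q ≡ e ℕ.+ e → Shape s d
    corank2 : suc (suc d) ≡ s → s ℕ.* m ≡ q → g ℕ.+ q ≡ e ℕ.+ e → Shape s d

  g≢0 : g ≢ 0
  g≢0 refl = contradiction 1≤g λ ()

  g+m≡e : g ℕ.+ q ≡ e ℕ.+ e → g ℕ.+ m ≡ e
  g+m≡e h = ℕP.+-cancelʳ-≡ e (g ℕ.+ m) e (trans (ℕP.+-assoc g m e) (trans (cong (g ℕ.+_) m+e≡q) h))

  dm≡g : ∀ d → suc (suc d) ℕ.* m ≡ q → g ℕ.+ q ≡ e ℕ.+ e → d ℕ.* m ≡ g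
  dm≡g d h₁ h₂ = ℕP.+-cancelʳ-≡ (m ℕ.+ m) (d ℕ.* m) g (begin
    d ℕ.* m ℕ.+ (m ℕ.+ m)   ≡⟨ solve 2 (λ d m → d :* m :+ (m :+ m) := m :+ (m :+ d :* m)) refl d m ⟩
    suc (suc d) ℕ.* m       ≡⟨ trans h₁ (sym m+e≡q) ⟩
    m ℕ.+ e                 ≡⟨ cong (m ℕ.+_) (sym (g+m≡e h₂)) ⟩
    m ℕ.+ (g ℕ.+ m)         ≡⟨ solve 2 (λ g m → m :+ (g :+ m) := g :+ (m :+ m)) refl g m ⟩
    g ℕ.+ (m ℕ.+ m)         ∎)

  -- `h` equates the exponents of an added root while the size stays `d`. It leads from full size to
  -- corank 1 with e = g, and from there to corank 2 with d m = g; from corank 2 it would give g =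
  -- 0.
  keep-step : ∀ s d → d ℕ.* e ≡ g ℕ.* suc s → Shape (suc s) d → Shape (suc (suc s)) d
  keep-step s d h (full refl refl) = corank1 refl (inj₂ (trans (cong (ℕ._+ q) (sym e≡g)) (cong (e ℕ.+_) (sym m+e≡q))))
    where
    e≡g : e ≡ g
    e≡g = ℕP.*-cancelˡ-≡ e g (suc s) (trans h (ℕP.*-comm g (suc s)))
  keep-step s d h (corank1 refl (inj₁ refl)) = contradiction (trans (sym (ℕP.*-identityʳ g)) (sym h)) g≢0
  keep-step s d h (corank1 refl (inj₂ g+q≡2e)) = corank2 refl (begin
      suc (suc d) ℕ.* m           ≡⟨ solve 2 (λ d m → m :+ (m :+ d :* m) := d :* m :+ m :+ m) refl d m ⟩
      d ℕ.* m ℕ.+ m ℕ.+ m         ≡⟨ cong (λ k → k ℕ.+ m ℕ.+ m) dm≡g′ ⟩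
      g ℕ.+ m ℕ.+ m               ≡⟨ cong (ℕ._+ m) (g+m≡e g+q≡2e) ⟩
      e ℕ.+ m                     ≡⟨ trans (ℕP.+-comm e m) m+e≡q ⟩
      q                           ∎) g+q≡2e
    where
    dm≡g′ : d ℕ.* m ≡ g
    dm≡g′ = ℕP.+-cancelˡ-≡ (d ℕ.* g) (d ℕ.* m) g (begin
      d ℕ.* g ℕ.+ d ℕ.* m    ≡⟨ ℕP.*-distribˡ-+ d g m ⟨
      d ℕ.* (g ℕ.+ m)        ≡⟨ cong (d ℕ.*_) (g+m≡e g+q≡2e) ⟩
      d ℕ.* e                ≡⟨ h ⟩
      g ℕ.* suc d            ≡⟨ solve 2 (λ d g → g :* (con 1 :+ d) := d :* g :+ g) refl d g ⟩
      d ℕ.* g ℕ.+ g          ∎)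
  keep-step s d h (corank2 refl sm≡q g+q≡2e) = contradiction g≡0 g≢0
    where
    g≡0 : g ≡ 0
    g≡0 = sym (ℕP.+-cancelˡ-≡ (d ℕ.* g ℕ.+ g) 0 g (begin
      d ℕ.* g ℕ.+ g ℕ.+ 0       ≡⟨ trans (ℕP.+-identityʳ _) (cong (d ℕ.* g ℕ.+_) (sym (dm≡g d sm≡q g+q≡2e))) ⟩
      d ℕ.* g ℕ.+ d ℕ.* m       ≡⟨ ℕP.*-distribˡ-+ d g m ⟨
      d ℕ.* (g ℕ.+ m)           ≡⟨ cong (d ℕ.*_) (g+m≡e g+q≡2e) ⟩
      d ℕ.* e                   ≡⟨ h ⟩
      g ℕ.* suc (suc d)         ≡⟨ solve 2 (λ d g → g :* (con 2 :+ d) := d :* g :+ g :+ g) refl d g ⟩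
      d ℕ.* g ℕ.+ g ℕ.+ g       ∎))

  -- Size and number of roots grow together, so the corank is kept. For corank 2 the equations give
  -- (2d + 3)(d + 1) m = (2d + 1)(d + 2) m; the coefficients differ by 1, so m = 0, and then q = 0.
  drop-step : ∀ s d b₀ → d ℕ.* e ℕ.+ b₀ ≡ g ℕ.* suc s → b₀ ℕ.+ suc d ℕ.* q ≡ suc (suc s) ℕ.* e →
              Shape (suc s) d → Shape (suc (suc s)) (suc d)
  drop-step s d b₀ h b≡ (full refl m≡0) = full refl m≡0
  drop-step s d b₀ h b≡ (corank1 refl (inj₂ g+q≡2e)) = corank1 refl (inj₂ g+q≡2e)
  drop-step s d b₀ h b≡ (corank1 refl (inj₁ refl)) = corank1 refl (inj₂ (begin
    g ℕ.+ q          ≡⟨ cong (ℕ._+ q) (trans h (ℕP.*-identityʳ g)) ⟨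
    b₀ ℕ.+ q         ≡⟨ cong (b₀ ℕ.+_) (ℕP.+-identityʳ q) ⟨
    b₀ ℕ.+ (q ℕ.+ 0) ≡⟨ b≡ ⟩
    e ℕ.+ (e ℕ.+ 0)  ≡⟨ cong (e ℕ.+_) (ℕP.+-identityʳ e) ⟩
    e ℕ.+ e          ∎))
  drop-step s d b₀ h b≡ (corank2 refl sm≡q g+q≡2e) = contradiction 1≤q (subst (λ k → ¬ 1 ≤ k) q≡0 λ ())
    where
    e≡ : suc d ℕ.* m ≡ e
    e≡ = trans (ℕP.+-comm m (d ℕ.* m)) (trans (cong (ℕ._+ m) (dm≡g d sm≡q g+q≡2e)) (g+m≡e g+q≡2e))
    lhs : ℕ → ℕ → ℕ
    lhs d m = d ℕ.* (suc d ℕ.* m) ℕ.+ suc (suc (suc d)) ℕ.* (suc d ℕ.* m)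
    rhs : ℕ → ℕ → ℕ
    rhs d m = d ℕ.* m ℕ.* suc (suc d) ℕ.+ suc d ℕ.* (suc (suc d) ℕ.* m)
    m≡0 : m ≡ 0
    m≡0 = ℕP.+-cancelˡ-≡ (rhs d m) m 0 (begin
      rhs d m ℕ.+ m    ≡⟨ solve 2 (λ d m → (d :* m :* (con 2 :+ d) :+ (con 1 :+ d) :* ((con 2 :+ d) :* m)) :+ m :=
                                            d :* ((con 1 :+ d) :* m) :+ (con 3 :+ d) :* ((con 1 :+ d) :* m)) refl d m ⟩
      lhs d m          ≡⟨ ≡.cong₂ (λ a b → d ℕ.* a ℕ.+ suc (suc (suc d)) ℕ.* b) e≡ e≡ ⟩
      d ℕ.* e ℕ.+ suc (suc (suc d)) ℕ.* e   ≡⟨ cong (d ℕ.* e ℕ.+_) b≡ ⟨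
      d ℕ.* e ℕ.+ (b₀ ℕ.+ suc d ℕ.* q)      ≡⟨ ℕP.+-assoc (d ℕ.* e) b₀ _ ⟨
      d ℕ.* e ℕ.+ b₀ ℕ.+ suc d ℕ.* q        ≡⟨ cong (ℕ._+ suc d ℕ.* q) h ⟩
      g ℕ.* suc (suc d) ℕ.+ suc d ℕ.* q     ≡⟨ ≡.cong₂ (λ a b → a ℕ.* suc (suc d) ℕ.+ suc d ℕ.* b) (dm≡g d sm≡q g+q≡2e) sm≡q ⟨
      rhs d m          ≡⟨ ℕP.+-identityʳ _ ⟨
      rhs d m ℕ.+ 0    ∎)
    q≡0 : 0 ≡ q
    q≡0 = trans (sym (trans (cong (suc (suc d) ℕ.*_) m≡0) (ℕP.*-zeroʳ (suc (suc d))))) sm≡q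

  e≤q : e ≤ q
  e≤q = subst (e ≤_) m+e≡q (ℕP.m≤n+m e m)

  classify : ∀ s d → d ℕ.* q ≤ suc s ℕ.* e → leadExponents e (suc s) d ≡ Vec.map (g ℕ.*_) (δExponents (suc s)) → Shape (suc s) d
  classify s d dq≤ h with d ℕ.* q ℕ.≤? s ℕ.* e
  classify zero    zero    dq≤ h | yes _ = corank1 refl (inj₁ refl)
  classify zero    (suc d) dq≤ h | yes l = contradiction (ℕP.≤-trans 1≤q (ℕP.≤-trans (ℕP.m≤m+n q (d ℕ.* q)) l)) λ ()
  classify (suc s) d       dq≤ h | yes l = keep-step s d (VecP.∷-injectiveˡ h) (classify s d l (VecP.∷-injectiveʳ h))
  classify s       zero    dq≤ h | no ¬l = contradiction z≤n ¬l
  classify zero    (suc zero) dq≤ h | no _ = full refl (ℕP.m+n≡0⇒m≡0 m {0} (trans (ℕP.+-identityʳ m)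
    (ℕP.+-cancelʳ-≡ e m 0 (trans m+e≡q (ℕP.≤-antisym (≡.subst₂ _≤_ (ℕP.+-identityʳ q) (ℕP.+-identityʳ e) dq≤) e≤q)))))
  classify zero    (suc (suc d)) dq≤ h | no _ = contradiction
    (ℕP.≤-trans (ℕP.+-monoʳ-≤ q (ℕP.≤-trans 1≤q (ℕP.m≤m+n q (d ℕ.* q)))) (ℕP.≤-trans dq≤ (subst (_≤ q) (sym (ℕP.+-identityʳ e)) e≤q)))
    (ℕP.<⇒≱ (subst (q <_) (ℕP.+-comm 1 q) (ℕP.n<1+n q)))
  classify (suc s) (suc d) dq≤ h | no ¬l =
    drop-step s d (suc (suc s) ℕ.* e ∸ suc d ℕ.* q) (VecP.∷-injectiveˡ h) (ℕP.m∸n+n≡m dq≤)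
      (classify s d (ℕP.+-cancelˡ-≤ q _ _ (ℕP.≤-trans dq≤ (ℕP.+-monoˡ-≤ (suc s ℕ.* e) e≤q))) (VecP.∷-injectiveʳ h))

-- Translation of `Poly` into iterated power series.

sumℤ : List ℤ → ℤ
sumℤ = foldr ℤ._+_ (+ 0)

sumℤ-++ : ∀ xs ys → sumℤ (xs ++ ys) ≡ sumℤ xs ℤ.+ sumℤ ys
sumℤ-++ []       ys = ≡.sym (ℤP.+-identityˡ _)
sumℤ-++ (x ∷ xs) ys = ≡.trans (≡.cong (λ k → x ℤ.+ k) (sumℤ-++ xs ys)) (≡.sym (ℤP.+-assoc x _ _))

sumℤ-concat : ∀ {A B : Set} (f : B → ℤ) (G : A → List B) xs →
              sumℤ (map f (concat (map G xs))) ≡ sumℤ (map (λ x → sumℤ (map f (G x))) xs)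
sumℤ-concat f G []       = ≡.refl
sumℤ-concat f G (x ∷ xs) = ≡.trans (≡.cong sumℤ (ListP.map-++ f (G x) (concat (map G xs))))
  (≡.trans (sumℤ-++ (map f (G x)) _) (≡.cong (λ k → sumℤ (map f (G x)) ℤ.+ k) (sumℤ-concat f G xs)))

convₚ : ∀ {n} → (ℕ → Poly n) → (ℕ → Poly n) → ℕ → Poly n
convₚ A B zero    = A 0 *ₚ B 0
convₚ A B (suc k) = (A 0 *ₚ B (suc k)) +ₚ convₚ (A ∘ suc) B k

-- The list `below (k ∷ m)` is grouped by the first exponent, so the product is a convolution in the
-- first variable.
*ₚ-conv : ∀ {n} (P Q : Poly (suc n)) k m → (P *ₚ Q) (k ∷ m) ≡ convₚ (λ i b → P (i ∷ b)) (λ i b → Q (i ∷ b)) k m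
*ₚ-conv {n} P Q k m = begin
  sumℤ (map f (concat (map (λ i → map (i ∷_) (below m)) (upTo (suc k)))))
    ≡⟨ sumℤ-concat f (λ i → map (i ∷_) (below m)) (upTo (suc k)) ⟩
  sumℤ (map (λ i → sumℤ (map f (map (i ∷_) (below m)))) (upTo (suc k)))
    ≡⟨ ≡.cong sumℤ (ListP.map-cong (λ i → ≡.cong sumℤ (≡.sym (ListP.map-∘ {g = f} {f = i ∷_} (below m)))) (upTo (suc k))) ⟩
  sumℤ (map (λ i → (A i *ₚ B (k ∸ i)) m) (upTo (suc k)))
    ≡⟨ ≡.cong sumℤ (ListP.map-applyUpTo id (λ i → (A i *ₚ B (k ∸ i)) m) (suc k)) ⟩
  sumℤ (applyUpTo (λ i → (A i *ₚ B (k ∸ i)) m) (suc k))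
    ≡⟨ go k A ⟩
  convₚ A B k m ∎
  where
  open ≡.≡-Reasoning
  A B : ℕ → Poly n
  A i b = P (i ∷ b)
  B i b = Q (i ∷ b)
  f : Mono (suc n) → ℤ
  f a = P a ℤ.* Q (zipWith _∸_ (k ∷ m) a)
  go : ∀ k A → sumℤ (applyUpTo (λ i → (A i *ₚ B (k ∸ i)) m) (suc k)) ≡ convₚ A B k m
  go zero    A = ℤP.+-identityʳ _
  go (suc k) A = ≡.cong (λ s → (A 0 *ₚ B (suc k)) m ℤ.+ s) (go k (A ∘ suc))

module Interpretation (q : ℕ) (p-prime : Prime (suc q)) where
  open Iterated q p-prime hiding (scalar)
  open LeadingDeterminant q p-prime using (hasse; power)
  module PSR (n : ℕ) = CommutativeRing (PS n)


  -- Currying of the exponent vector; the integers are unchanged, so congruence modulo p and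
  -- equality of series imply each other.
  ⟦_⟧ : ∀ {n} → Poly n → ⟦PS n ⟧
  ⟦_⟧ {zero}  P = P []
  coef (⟦_⟧ {suc n} P) k = ⟦ (λ m → P (k ∷ m)) ⟧

  ⟦⟧-mod : ∀ {n} {P Q : Poly n} → P ≡ₚ Q [mod p ] → PSR._≈_ n ⟦ P ⟧ ⟦ Q ⟧
  ⟦⟧-mod {zero}  e = Zp.congruent (∣ᵤ⇒∣ (e []))
  ⟦⟧-mod {suc n} e = PowerSeries.pointwise (λ k → ⟦⟧-mod (λ m → e (k ∷ m)))

  mod-⟦⟧ : ∀ {n} {P Q : Poly n} → PSR._≈_ n ⟦ P ⟧ ⟦ Q ⟧ → P ≡ₚ Q [mod p ]
  mod-⟦⟧ {zero}  e []      = ∣⇒∣ᵤ (Zp.p∣a-b e)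
  mod-⟦⟧ {suc n} e (k ∷ m) = mod-⟦⟧ (PowerSeries.at e k) m

  ⟦⟧-cong : ∀ {n} {P Q : Poly n} → (∀ m → P m ≡ Q m) → PSR._≈_ n ⟦ P ⟧ ⟦ Q ⟧
  ⟦⟧-cong {zero}  e = PSR.reflexive zero (e [])
  ⟦⟧-cong {suc n} e = PowerSeries.pointwise (λ k → ⟦⟧-cong (λ m → e (k ∷ m)))

  ⟦⟧-+ : ∀ {n} (P Q : Poly n) → PSR._≈_ n ⟦ P +ₚ Q ⟧ (PSR._+_ n ⟦ P ⟧ ⟦ Q ⟧)
  ⟦⟧-+ {zero}  P Q = PSR.refl zero
  ⟦⟧-+ {suc n} P Q = PowerSeries.pointwise (λ k → ⟦⟧-+ (λ m → P (k ∷ m)) (λ m → Q (k ∷ m)))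

  ⟦⟧-neg : ∀ {n} (P : Poly n) → PSR._≈_ n ⟦ -ₚ P ⟧ (PSR.-_ n ⟦ P ⟧)
  ⟦⟧-neg {zero}  P = PSR.refl zero
  ⟦⟧-neg {suc n} P = PowerSeries.pointwise (λ k → ⟦⟧-neg (λ m → P (k ∷ m)))

  ⟦⟧-minus : ∀ {n} (P Q : Poly n) → PSR._≈_ n ⟦ P -ₚ Q ⟧ (PSR._-_ n ⟦ P ⟧ ⟦ Q ⟧)
  ⟦⟧-minus {n} P Q = PSR.trans n (⟦⟧-+ P (-ₚ Q)) (PSR.+-congˡ n (⟦⟧-neg Q))

  ⟦⟧-* : ∀ {n} (P Q : Poly n) → PSR._≈_ n ⟦ P *ₚ Q ⟧ (PSR._*_ n ⟦ P ⟧ ⟦ Q ⟧)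
  ⟦⟧-* {zero}  P Q = PSR.reflexive zero (ℤP.+-identityʳ _)
  ⟦⟧-* {suc n} P Q = PowerSeries.pointwise (λ k → PSR.trans n (⟦⟧-cong (*ₚ-conv P Q k)) (go (λ i m → P (i ∷ m)) (λ i m → Q (i ∷ m)) k))
    where
    go : ∀ (A B : ℕ → Poly n) k → PSR._≈_ n ⟦ convₚ A B k ⟧ (PowerSeries.conv (PS n) (⟦_⟧ ∘ A) (⟦_⟧ ∘ B) k)
    go A B zero    = ⟦⟧-* (A 0) (B 0)
    go A B (suc k) = PSR.trans n (⟦⟧-+ (A 0 *ₚ B (suc k)) (convₚ (A ∘ suc) B k))
                                 (PSR.+-cong n (⟦⟧-* (A 0) (B (suc k))) (go (A ∘ suc) B k))

  const : ∀ n → ℤ → ⟦PS n ⟧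
  const zero    c = c
  const (suc n) c = PowerSeries.C (PS n) (const n c)

  const-0 : ∀ n → PSR._≈_ n (const n (+ 0)) (PSR.0# n)
  const-0 zero    = PSR.refl zero
  const-0 (suc n) = SeriesTools.C-cong (PS n) (const-0 n)

  const-1 : ∀ n → PSR._≈_ n (const n (+ 1)) (PSR.1# n)
  const-1 zero    = PSR.refl zero
  const-1 (suc n) = SeriesTools.C-cong (PS n) (const-1 n)

  const-neg : ∀ n c → PSR._≈_ n (const n (ℤ.- c)) (PSR.-_ n (const n c))
  const-neg zero    c = PSR.refl zero
  const-neg (suc n) c = PSR.trans (suc n) (SeriesTools.C-cong (PS n) (const-neg n c)) (SeriesTools.C-neg (PS n) (const n c))

  const-+ : ∀ n c d → PSR._≈_ n (const n (c ℤ.+ d)) (PSR._+_ n (const n c) (const n d))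
  const-+ zero    c d = PSR.refl zero
  const-+ (suc n) c d = PSR.trans (suc n) (SeriesTools.C-cong (PS n) (const-+ n c d)) (SeriesTools.C-+ (PS n) (const n c) (const n d))

  const-nat : ∀ n m → PSR._≈_ n (const n (+ m)) (Mult._×_ (PSR.semiring n) m (PSR.1# n))
  const-nat n zero    = const-0 n
  const-nat n (suc m) = PSR.trans n (const-+ n (+ 1) (+ m)) (PSR.+-cong n (const-1 n) (const-nat n m))

  const≈0⇒∣ : ∀ n c → PSR._≈_ n (const n c) (PSR.0# n) → (+ p) ℤD.∣ c
  const≈0⇒∣ zero    c e = Zp.≈0⇒∣ e
  const≈0⇒∣ (suc n) c e = const≈0⇒∣ n c (PowerSeries.at e 0)

  lead-const : ∀ n c → ¬ ((+ p) ℤD.∣ c) → Lead n (const n c) (Vec.replicate n 0)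
  lead-const zero    c p∤c c≈0 = p∤c (Zp.≈0⇒∣ c≈0)
  lead-const (suc n) c p∤c     = lead-C n (lead-const n c p∤c)

  ⟦⟧-0 : ∀ n → PSR._≈_ n ⟦ (λ (_ : Mono n) → + 0) ⟧ (PSR.0# n)
  ⟦⟧-0 zero    = PSR.refl zero
  ⟦⟧-0 (suc n) = PowerSeries.pointwise λ { zero → ⟦⟧-0 n ; (suc k) → ⟦⟧-0 n }

  ⟦⟧-const : ∀ n c → PSR._≈_ n ⟦ constP {n} c ⟧ (const n c)
  ⟦⟧-const zero    c = PSR.refl zero
  ⟦⟧-const (suc n) c = PowerSeries.pointwise λ { zero → ⟦⟧-const n c ; (suc k) → ⟦⟧-0 n }

  ⟦⟧-1 : ∀ n → PSR._≈_ n ⟦ 1ₚ {n} ⟧ (PSR.1# n)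
  ⟦⟧-1 n = PSR.trans n (⟦⟧-const n (+ 1)) (const-1 n)

  ⟦⟧-var : ∀ n i → PSR._≈_ n ⟦ varP {n} i ⟧ (vars n i)
  ⟦⟧-var (suc n) zero    = PowerSeries.pointwise λ
    { zero          → ⟦⟧-0 n
    ; (suc zero)    → PSR.trans n (⟦⟧-cong (λ m → ≡.cong (λ u → monoP (+ 1) u m) (tabulate-0 n))) (⟦⟧-1 n)
    ; (suc (suc k)) → ⟦⟧-0 n }
    where
    tabulate-0 : ∀ n → Vec.tabulate {n = n} (λ _ → 0) ≡ Vec.replicate n 0
    tabulate-0 zero    = ≡.refl
    tabulate-0 (suc n) = ≡.cong (0 ∷_) (tabulate-0 n)
  ⟦⟧-var (suc n) (suc i) = PowerSeries.pointwise λ { zero → ⟦⟧-var n i ; (suc k) → ⟦⟧-0 n }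

  ⟦⟧-^ : ∀ {n} (P : Poly n) e → PSR._≈_ n ⟦ P ^ₚ e ⟧ (Exp._^_ (PSR.semiring n) ⟦ P ⟧ e)
  ⟦⟧-^ {n} P zero    = ⟦⟧-1 n
  ⟦⟧-^ {n} P (suc e) = PSR.trans n (⟦⟧-* P (P ^ₚ e)) (PSR.*-congˡ n (⟦⟧-^ P e))

  module _ (n : ℕ) where
    open CommutativeRing (PS n) hiding (zero)
    open Sum semiring using (sum; sum-cong-≋)
    open Determinants (PS n)
    open SpecialDeterminants (PS n) using (prod; prod-cong)
    open RootPolynomials (PS n) using (δ)

    ⟦⟧-sum : ∀ {A : Set} {m} (f : A → Poly n) (g : Fin m → A) → ⟦ sumP (map f (tabulate g)) ⟧ ≈ sum (λ i → ⟦ f (g i) ⟧)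
    ⟦⟧-sum {m = zero}  f g = trans (⟦⟧-const n (+ 0)) (const-0 n)
    ⟦⟧-sum {m = suc m} f g = trans (⟦⟧-+ (f (g zero)) _) (+-congˡ (⟦⟧-sum f (g ∘ suc)))

    ⟦⟧-sign : ∀ {m} (j : Fin m) → ⟦ constP {n} ((ℤ.- (+ 1)) ℤ.^ toℕ j) ⟧ ≈ sgn j
    ⟦⟧-sign j = trans (⟦⟧-const n _) (go j)
      where
      go : ∀ {m} (j : Fin m) → const n ((ℤ.- (+ 1)) ℤ.^ toℕ j) ≈ sgn j
      go zero    = const-1 n
      go (suc j) = trans (reflexive (≡.cong (const n) (ℤP.-1*i≡-i ((ℤ.- (+ 1)) ℤ.^ toℕ j)))) (trans (const-neg n _) (-‿cong (go j)))

    ⟦⟧-det : ∀ {d} (A : Fin d → Fin d → Poly n) → ⟦ det A ⟧ ≈ detᵣ (λ i j → ⟦ A i j ⟧)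
    ⟦⟧-det {zero}  A = ⟦⟧-1 n
    ⟦⟧-det {suc d} A = trans (⟦⟧-sum {m = suc d} (λ j → constP ((ℤ.- (+ 1)) ℤ.^ toℕ j) *ₚ (A zero j *ₚ det (λ a b → A (suc a) (punchIn j b)))) id) (sum-cong-≋ {suc d} (λ j →
      trans (⟦⟧-* (constP ((ℤ.- (+ 1)) ℤ.^ toℕ j)) (A zero j *ₚ det (λ a b → A (suc a) (punchIn j b))))
            (*-cong (⟦⟧-sign j) (trans (⟦⟧-* (A zero j) (det (λ a b → A (suc a) (punchIn j b))))
                                       (*-congˡ (⟦⟧-det (λ a b → A (suc a) (punchIn j b))))))))

    ⟦⟧-prod-++ : ∀ (xs ys : List (Poly n)) → ⟦ prodP (xs ++ ys) ⟧ ≈ ⟦ prodP xs ⟧ * ⟦ prodP ys ⟧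
    ⟦⟧-prod-++ []       ys = sym (trans (*-congʳ (⟦⟧-1 n)) (*-identityˡ _))
    ⟦⟧-prod-++ (P ∷ xs) ys = trans (⟦⟧-* P (prodP (xs ++ ys))) (trans (*-congˡ (⟦⟧-prod-++ xs ys))
      (trans (sym (*-assoc _ _ _)) (*-congʳ (sym (⟦⟧-* P (prodP xs))))))

    ⟦⟧-prod-concat : ∀ {A : Set} {m} (G : A → List (Poly n)) (g : Fin m → A) →
                     ⟦ prodP (concat (map G (tabulate g))) ⟧ ≈ prod (λ i → ⟦ prodP (G (g i)) ⟧)
    ⟦⟧-prod-concat {m = zero}  G g = ⟦⟧-1 n
    ⟦⟧-prod-concat {m = suc m} G g =
      trans (⟦⟧-prod-++ (G (g zero)) (concat (map G (tabulate (g ∘ suc))))) (*-congˡ (⟦⟧-prod-concat G (g ∘ suc)))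

    prodAfter : ∀ {m} → Fin m → (Fin m → Carrier) → Carrier
    prodAfter zero    f = prod (f ∘ suc)
    prodAfter (suc i) f = prodAfter i (f ∘ suc)

    prodAfter-cong : ∀ {m} (i : Fin m) {f g} → (∀ j → f j ≈ g j) → prodAfter i f ≈ prodAfter i g
    prodAfter-cong zero    e = prod-cong (e ∘ suc)
    prodAfter-cong (suc i) e = prodAfter-cong i (e ∘ suc)

    ⟦⟧-prod-all : ∀ {A : Set} {P : A → Set} {m} (P? : Decidable P) (f : A → Poly n) (h : Fin m → A) →
                  (∀ j → does (P? (h j)) ≡ true) →
                  ⟦ prodP (map f (filter P? (tabulate h))) ⟧ ≈ prod (λ j → ⟦ f (h j) ⟧)
    ⟦⟧-prod-all {m = zero}  P? f h e = ⟦⟧-1 n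
    ⟦⟧-prod-all {m = suc m} P? f h e with does (P? (h zero)) | e zero
    ... | true | _ = trans (⟦⟧-* (f (h zero)) _) (*-congˡ (⟦⟧-prod-all P? f (h ∘ suc) (e ∘ suc)))

    -- Only the truth values of `P?` along `h` are prescribed, so the induction can pass to tails of
    -- the list while the predicate stays fixed.
    ⟦⟧-prod-after : ∀ {A : Set} {P : A → Set} {m} (P? : Decidable P) (f : A → Poly n) (i : Fin m) (h : Fin m → A) →
                    (∀ j → does (P? (h j)) ≡ (toℕ i <ᵇ toℕ j)) →
                    ⟦ prodP (map f (filter P? (tabulate h))) ⟧ ≈ prodAfter i (λ j → ⟦ f (h j) ⟧)
    ⟦⟧-prod-after {m = suc m} P? f zero    h e with does (P? (h zero)) | e zero
    ... | false | _ = ⟦⟧-prod-all P? f (h ∘ suc) (e ∘ suc)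
    ⟦⟧-prod-after {m = suc m} P? f (suc i) h e with does (P? (h zero)) | e zero
    ... | false | _ = ⟦⟧-prod-after P? f i (h ∘ suc) (e ∘ suc)

    prod-after-δ : ∀ {m} (z : Fin m → Carrier) → prod (λ i → prodAfter i (λ j → z i - z j)) ≈ δ z
    prod-after-δ {zero}  z = refl
    prod-after-δ {suc m} z = *-congˡ (prod-after-δ (z ∘ suc))

    ⟦⟧-δ : ⟦ δP n ⟧ ≈ δ (vars n)
    ⟦⟧-δ = trans (⟦⟧-prod-concat (λ i → map (λ j → varP i -ₚ varP j) (filter (λ j → toℕ i ℕ.<? toℕ j) (allFin n))) id)
      (trans (prod-cong {n} (λ i → trans
               (⟦⟧-prod-after (λ j → toℕ i ℕ.<? toℕ j) (λ j → varP i -ₚ varP j) i id (λ j → ≡.refl))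
               (prodAfter-cong i (λ j → trans (⟦⟧-minus (varP i) (varP j)) (+-cong (⟦⟧-var n i) (-‿cong (⟦⟧-var n j)))))))
             (prod-after-δ (vars n)))

  module _ (r : ℕ) where
    open CommutativeRing (PS r) hiding (zero)
    open SeriesTools (PS r)
    open RootPolynomials (PS r)
    open SetoidReasoning setoid

    ⟦⟧-f : ⟦ fP r ⟧ ≈ₛ F (vars r)
    ⟦⟧-f = go id
      where
      go : ∀ {m} (g : Fin m → Fin r) →
           ⟦ prodP (map (λ j → xP r -ₚ varP (Fin.suc j)) (tabulate g)) ⟧ ≈ₛ F (vars r ∘ g)
      go {zero}  g = ⟦⟧-1 (suc r)
      go {suc m} g = S.trans (⟦⟧-* (xP r -ₚ varP (Fin.suc (g zero))) _) (S.*-cong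
        (S.trans (⟦⟧-minus (xP r) (varP (Fin.suc (g zero)))) (S.+-cong (⟦⟧-var (suc r) zero) (S.-‿cong (⟦⟧-var (suc r) (suc (g zero))))))
        (go (g ∘ suc)))

    ⟦⟧-coeff : ∀ e k → ⟦ coeff r e k ⟧ ≈ coef (power r e) k
    ⟦⟧-coeff e k = at (S.trans (⟦⟧-^ (fP r) e) (SExp.^-congˡ e ⟦⟧-f)) k

    ⟦⟧-if : ∀ {A : Set} (A? : Dec A) {P Q : Poly r} {t : Carrier} →
            (A → ⟦ P ⟧ ≈ t) → (¬ A → ⟦ Q ⟧ ≈ t) → ⟦ (if does A? then P else Q) ⟧ ≈ t
    ⟦⟧-if (yes a) f g = f a
    ⟦⟧-if (no ¬a) f g = g ¬a

    -- The index (a + 1) p + (b + 1) - (d + 1) equals (a + 1) p - (d - b), which is the shift by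
    -- x^{d-b}; a negative index gives 0 on both sides.
    ⟦⟧-Mmat : ∀ d e a b → ⟦ Mmat r p e d a b ⟧ ≈ hasse r d e a b
    ⟦⟧-Mmat d e a b = ⟦⟧-if (suc d ℕ.≤? (N ℕ.+ suc (toℕ b))) {coeff r e (N ℕ.+ suc (toℕ b) ∸ suc d)} {0ₚ} nonnegative negative
      where
      N = suc (toℕ a) ℕ.* p
      nonnegative : suc d ≤ N ℕ.+ suc (toℕ b) → ⟦ coeff r e (N ℕ.+ suc (toℕ b) ∸ suc d) ⟧ ≈ hasse r d e a b
      nonnegative l = begin
        ⟦ coeff r e (N ℕ.+ suc (toℕ b) ∸ suc d) ⟧         ≈⟨ ⟦⟧-coeff e (N ℕ.+ suc (toℕ b) ∸ suc d) ⟩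
        coef (power r e) (N ℕ.+ suc (toℕ b) ∸ suc d)      ≡⟨ ≡.cong (coef (power r e)) index ⟩
        coef (power r e) (N ∸ (d ∸ toℕ b))                ≈⟨ X^*-≥ (d ∸ toℕ b) (power r e) d-b≤N ⟨
        hasse r d e a b                                   ∎
        where
        b≤d = ℕP.<⇒≤ (FinP.toℕ<n b)
        d-b≤N : d ∸ toℕ b ≤ N
        d-b≤N = ℕP.m≤n+o⇒m∸n≤o d (toℕ b) (≡.subst (d ≤_) (ℕP.+-comm N (toℕ b)) (ℕP.≤-pred (≡.subst (suc d ≤_) (ℕP.+-suc N (toℕ b)) l)))
        index : N ℕ.+ suc (toℕ b) ∸ suc d ≡ N ∸ (d ∸ toℕ b)
        index = ≡.trans (≡.cong (_∸ suc d) (ℕP.+-suc N (toℕ b)))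
          (≡.trans (≡.cong₂ _∸_ (ℕP.+-comm N (toℕ b)) (≡.sym (ℕP.m+[n∸m]≡n b≤d))) (ℕP.[m+n]∸[m+o]≡n∸o (toℕ b) N (d ∸ toℕ b)))
      negative : ¬ suc d ≤ N ℕ.+ suc (toℕ b) → ⟦ 0ₚ {r} ⟧ ≈ hasse r d e a b
      negative ¬l = trans (trans (⟦⟧-const r (+ 0)) (const-0 r)) (sym (X^*-< (d ∸ toℕ b) (power r e) N<))
        where
        N< : N < d ∸ toℕ b
        N< = ℕP.m+n≤o⇒m≤o∸n (suc N) (ℕP.≤-pred (≡.subst (_≤ suc d) (≡.cong suc (ℕP.+-suc N (toℕ b))) (ℕP.≰⇒> ¬l)))

    ⟦⟧-det-Mmat : ∀ d e → ⟦ det (Mmat r p e d) ⟧ ≈ Determinants.detᵣ (PS r) (hasse r d e)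
    ⟦⟧-det-Mmat d e = trans (⟦⟧-det r (Mmat r p e d)) (Determinants.det-cong (PS r) (⟦⟧-Mmat d e))

-- The constant term and the inclusion of constants as homomorphisms.

module ConstantTerms (R : Ring) where
  open CommutativeRing R hiding (zero)
  open Sum semiring using (sum; sum-cong-≋)
  open Exp semiring using (_^_)
  open Determinants R
  open SpecialDeterminants R using (prod)
  open SeriesTools R
  open RootPolynomials R using (δ)
  module Dₛ = Determinants seriesRing
  module δₛ = RootPolynomials seriesRing
  module prodₛ = SpecialDeterminants seriesRing

  constant-sgn : ∀ {n} (j : Fin n) → coef (Dₛ.sgn j) 0 ≈ sgn j
  constant-sgn zero    = refl
  constant-sgn (suc j) = -‿cong (constant-sgn j)

  constant-det : ∀ {d} (A : Dₛ.Matrix d d) → coef (Dₛ.detᵣ A) 0 ≈ detᵣ (λ i j → coef (A i j) 0)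
  constant-det {zero}  A = refl
  constant-det {suc d} A = trans (coeff-sum {suc d} (λ j → Dₛ.sgn j *ₛ (A zero j *ₛ Dₛ.detᵣ (Dₛ.minor A j))) 0)
    (sum-cong-≋ {suc d} (λ j → *-cong (constant-sgn j) (*-congˡ {coef (A zero j) 0} (constant-det (Dₛ.minor A j)))))

  constant-prod : ∀ {n} (f : Fin n → Series Carrier) → coef (prodₛ.prod f) 0 ≈ prod (λ i → coef (f i) 0)
  constant-prod {zero}  f = refl
  constant-prod {suc n} f = *-congˡ (constant-prod (f ∘ suc))

  constant-^ : ∀ a g → coef (a SExp.^ g) 0 ≈ coef a 0 ^ g
  constant-^ a zero    = refl
  constant-^ a (suc g) = *-congˡ (constant-^ a g)

  constant-δ : ∀ {n} (z : Fin n → Series Carrier) → coef (δₛ.δ z) 0 ≈ δ (λ i → coef (z i) 0)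
  constant-δ {zero}  z = refl
  constant-δ {suc n} z = *-cong (constant-prod (λ j → z zero S.- z (suc j))) (constant-δ (z ∘ suc))

  C-prod : ∀ {n} (f : Fin n → Carrier) → C (prod f) ≈ₛ prodₛ.prod (C ∘ f)
  C-prod {zero}  f = S.refl
  C-prod {suc n} f = S.trans (C-* (f zero) (prod (f ∘ suc))) (S.*-congˡ (C-prod (f ∘ suc)))

  C-minus : ∀ x y → C (x - y) ≈ₛ C x S.- C y
  C-minus x y = S.trans (C-+ x (- y)) (S.+-congˡ (C-neg y))

  C-δ : ∀ {n} (z : Fin n → Carrier) → C (δ z) ≈ₛ δₛ.δ (C ∘ z)
  C-δ {zero}  z = S.refl
  C-δ {suc n} z = S.trans (C-* (prod (λ j → z zero - z (suc j))) (δ (z ∘ suc))) (S.*-cong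
    (S.trans (C-prod (λ j → z zero - z (suc j))) (prodₛ.prod-cong {n} (λ j → C-minus (z zero) (z (suc j)))))
    (C-δ (z ∘ suc)))

  prod-lin-top : ∀ {n} (z : Fin n → Carrier) → HasTop (prodₛ.prod (λ j → lin (z j))) n 1#
  prod-lin-top {zero}  z = hasTop-C 1#
  prod-lin-top {suc n} z = hasTop-resp S.refl (*-identityˡ _) (hasTop-* (lin-top (z zero)) (prod-lin-top (z ∘ suc)))

-- The two inclusions.

module Conclusion (q : ℕ) (p-prime : Prime (suc q)) where
  open Iterated q p-prime hiding (scalar)
  open LeadingDeterminant q p-prime using (hasse; power; leadExponents; lead-det; hasse-slice; module Ev)
  open Interpretation q p-prime

  1≤q : 1 ≤ q
  1≤q = nontrivial q p-prime
    where
    nontrivial : ∀ q → Prime (suc q) → 1 ≤ q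
    nontrivial zero    pr with prime⇒nonTrivial pr
    ... | ()
    nontrivial (suc q) pr = s≤s z≤n

  δᵥ : ∀ n → ⟦PS n ⟧
  δᵥ n = RootPolynomials.δ (PS n) (vars n)

  zipWith-0 : ∀ {m} (hs : Vec ℕ m) → zipWith ℕ._+_ (Vec.replicate m 0) hs ≡ hs
  zipWith-0 []       = ≡.refl
  zipWith-0 (h ∷ hs) = ≡.cong (h ∷_) (zipWith-0 hs)

  -- The first variable enters δ only through n monic linear factors, one for each other variable.
  lead-δ : ∀ n → Lead n (δᵥ n) (δExponents n)
  lead-δ zero    = lead-1 zero
  lead-δ (suc n) = ≡.subst (λ h → Lead (suc n) (δᵥ (suc n)) (h ∷ δExponents n)) (ℕP.+-identityʳ n)
    (≡.subst (Lead (suc n) (δᵥ (suc n))) (≡.cong (n ℕ.+ 0 ∷_) (zipWith-0 (δExponents n)))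
      (lead-resp (suc n) (S.*-congˡ {Δ} (C-δ (vars n)))
        (lead-* (suc n) {Δ} {C (δᵥ n)} {n ∷ Vec.replicate n 0} {0 ∷ δExponents n}
          (above (prod-lin-top (vars n)) , lead-resp n (PSR.sym n (atTop (prod-lin-top (vars n)))) (lead-1 n))
          (lead-C n (lead-δ n)))))
    where
    open SeriesTools (PS n)
    open ConstantTerms (PS n)
    Δ : Series ⟦PS n ⟧
    Δ = prodₛ.prod (λ j → lin (vars n j))

  module _ (r : ℕ) where
    open CommutativeRing (PS r) hiding (zero)
    open Exp semiring using (_^_)
    open Mult semiring using () renaming (_×_ to _·_)
    open Determinants (PS r)
    open Regularity (PS r) hiding (Regular)
    open Scalars (PS r) p p-prime (char r) hiding (Scalar)

    IsPowerOfδ : ℕ → ℕ → Set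
    IsPowerOfδ e d = Σ ℤ (λ ε → ¬ ((+ p) ℤD.∣ ε) × Σ ℕ (λ g → 1 ≤ g × det (Mmat r p e d) ≡ₚ (constP ε *ₚ (δP r ^ₚ g)) [mod p ]))

    ⟦⟧-εδ : ∀ ε g → ⟦ constP ε *ₚ (δP r ^ₚ g) ⟧ ≈ const r ε * δᵥ r ^ g
    ⟦⟧-εδ ε g = trans (⟦⟧-* (constP ε) (δP r ^ₚ g)) (*-cong (⟦⟧-const r ε)
      (trans (⟦⟧-^ (δP r) g) (Exp.^-congˡ semiring g (⟦⟧-δ r))))

    fromScalar : ∀ e d g → 1 ≤ g → detᵣ (hasse r d e) ~ δᵥ r ^ g → IsPowerOfδ e d
    fromScalar e d g 1≤g (s , Scalars.scalar m p∤m s≈m , eq) = + m , p∤m , g , 1≤g , mod-⟦⟧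
      (trans (⟦⟧-det-Mmat r d e) (trans eq (trans (*-congʳ (trans s≈m (sym (const-nat r m)))) (sym (⟦⟧-εδ (+ m) g)))))

    module Converse (e d g : ℕ) (ε : ℤ) (p∤ε : ¬ ((+ p) ℤD.∣ ε)) (1≤g : 1 ≤ g)
      (eq : det (Mmat r p e d) ≡ₚ (constP ε *ₚ (δP r ^ₚ g)) [mod p ]) where

      equation : detᵣ (hasse r d e) ≈ const r ε * δᵥ r ^ g
      equation = trans (sym (⟦⟧-det-Mmat r d e)) (trans (⟦⟧-mod eq) (⟦⟧-εδ ε g))

      regular-δᵥ : Regular r (δᵥ r)
      regular-δᵥ = regular-δ r id id

      det≉0 : ¬ detᵣ (hasse r d e) ≈ 0#
      det≉0 z = p∤ε (const≈0⇒∣ r ε (regular-^ g regular-δᵥ (const r ε) (trans (*-comm _ _) (trans (sym equation) z))))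

      lead : 1 ≤ q → e ≤ q → d ℕ.* q ≤ r ℕ.* e → leadExponents e r d ≡ Vec.map (g ℕ.*_) (δExponents r)
      lead 1≤q e≤q dq≤re = lead-unique r (lead-det r d e 1≤q e≤q dq≤re)
        (lead-resp r (sym equation) (≡.subst (Lead r (const r ε * δᵥ r ^ g)) (zipWith-0 _)
          (lead-* r (lead-const r ε p∤ε) (lead-^ r g (lead-δ r)))))

  -- The last row is taken at x^{(d+1)p}, beyond the degree of all the series involved, which is at
  -- most d + 1 + r e.
  det-small : ∀ r d e → r ℕ.* e < suc d ℕ.* q → PSR._≈_ r (Determinants.detᵣ (PS r) (hasse r (suc d) e)) (PSR.0# r)
  det-small r d e re<dq = SpecialDeterminants.det-zeroRow (PS r) (hasse r (suc d) e) (fromℕ d)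
    (λ b → above (top b) N (bound b))
    where
    open CommutativeRing (PS r) hiding (zero)
    open SeriesTools (PS r)
    N = suc (toℕ (fromℕ d)) ℕ.* p
    top : ∀ (b : Fin (suc d)) → HasTop (X SExp.^ (suc d ∸ toℕ b) *ₛ power r e) ((suc d ∸ toℕ b) ℕ.+ e ℕ.* r) (1# * 1#)
    top b = hasTop-* (X^-top (suc d ∸ toℕ b)) (hasTop-^ e (RootPolynomials.F-top (PS r) (vars r)))
    bound : ∀ (b : Fin (suc d)) → (suc d ∸ toℕ b) ℕ.+ e ℕ.* r < N
    bound b = ≡.subst ((suc d ∸ toℕ b) ℕ.+ e ℕ.* r <_)
      (≡.sym (≡.trans (≡.cong (λ i → suc i ℕ.* p) (FinP.toℕ-fromℕ d)) (ℕP.*-suc (suc d) q)))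
      (ℕP.+-mono-≤-< (ℕP.m∸n≤m (suc d) (toℕ b)) (≡.subst (_< suc d ℕ.* q) (ℕP.*-comm r e) re<dq))

  -- For e ≥ p the first row vanishes when the first variable is put equal to 0.
  det-large : ∀ r d e → p ≤ e → PSR._≈_ r (coef (Determinants.detᵣ (PS (suc r)) (hasse (suc r) (suc d) e)) 0) (PSR.0# r)
  det-large r d e p≤e = trans (ConstantTerms.constant-det (PS r) (hasse (suc r) (suc d) e))
    (SpecialDeterminants.det-zeroRow (PS r) (λ i j → coef (hasse (suc r) (suc d) e i j) 0) zero (λ b →
      trans (hasse-slice r (suc d) e zero b 0) (trans (*-congˡ (vanish b)) (zeroʳ _))))
    where
    open CommutativeRing (PS r) hiding (zero)
    open SeriesTools (PS r)
    vanish : ∀ (b : Fin (suc d)) → coef (X SExp.^ (suc d ∸ toℕ b) *ₛ (X SExp.^ e *ₛ power r e)) (1 ℕ.* p) ≈ 0#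
    vanish b with (suc d ∸ toℕ b) ℕ.≤? (1 ℕ.* p)
    ... | no ≰  = X^*-< (suc d ∸ toℕ b) (X SExp.^ e *ₛ power r e) (ℕP.≰⇒> ≰)
    ... | yes l = trans (X^*-≥ (suc d ∸ toℕ b) (X SExp.^ e *ₛ power r e) l)
      (X^*-< e (power r e) (ℕP.<-≤-trans (ℕP.∸-monoʳ-< (ℕP.m<n⇒0<n∸m (FinP.toℕ<n b)) l)
        (≡.subst (_≤ e) (≡.sym (ℕP.*-identityˡ p)) p≤e)))

  A⇒B : ∀ r e d → InA p r e d × Side p r → InB p r e d × Side p r
  A⇒B (suc zero) e d ((s≤s () , _) , _)
  A⇒B (suc (suc n)) e (suc d) ((2≤r , 1≤e , 1≤d , d≤p , ε , p∤ε , g , 1≤g , eq) , side) =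
    byCases (e ℕ.≤? q) (suc d ℕ.* q ℕ.≤? r ℕ.* e) , side
    where
    r = suc (suc n)
    open Converse r e (suc d) g ε p∤ε 1≤g eq

    -- Putting the first root equal to 0 kills the determinant but keeps δ a non-zero-divisor, as
    -- the other roots remain distinct variables.
    e≤q-necessary : ¬ p ≤ e
    e≤q-necessary p≤e = p∤ε (const≈0⇒∣ (suc n) ε (regular-^ g regular-δ₀ (const (suc n) ε)
      (trans (*-comm _ _) (trans (sym at-0) (det-large (suc n) d e p≤e)))))
      where
      open CommutativeRing (PS (suc n)) hiding (zero)
      open Exp semiring using (_^_)
      open Regularity (PS (suc n)) hiding (Regular)
      open ConstantTerms (PS (suc n))
      δ₀ : ⟦PS suc n ⟧
      δ₀ = coef (δᵥ r) 0
      regular-δ₀ : Regular (suc n) δ₀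
      regular-δ₀ = regular-resp (sym (constant-δ (vars r))) (regular-*
        (regular-prod {suc n} (λ j → regular-resp (sym (+-identityˡ _)) (regular-neg (regular-var (suc n) j))))
        (regular-δ (suc n) id id))
      at-0 : coef (Determinants.detᵣ (PS r) (hasse r (suc d) e)) 0 ≈ const (suc n) ε * δ₀ ^ g
      at-0 = trans (PowerSeries.at equation 0) (*-congˡ (constant-^ (δᵥ r) g))

    module _ (e≤q : e ≤ q) (dq≤re : suc d ℕ.* q ≤ r ℕ.* e) where
      open Classification q p-prime 1≤q (q ∸ e) e g (ℕP.m∸n+n≡m e≤q) 1≤g using (Shape; full; corank1; corank2)

      -- For size r - 1, the inequality (r - 1) q ≤ r e is a rearrangement of r (q - e) ≤ q.
      rm≤q : suc d ≡ suc n → r ℕ.* (q ∸ e) ≤ q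
      rm≤q ≡.refl = ≡.subst (_≤ q) (≡.sym (ℕP.*-distribˡ-∸ r q e))
        (ℕP.m≤n+o⇒m∸n≤o (r ℕ.* q) (r ℕ.* e) (≡.subst (r ℕ.* q ≤_) (ℕP.+-comm q _) (ℕP.+-monoʳ-≤ q dq≤re)))

      conclude : Shape r (suc d) → InB p r e (suc d)
      conclude (full d≡r m≡0) = inj₁ (2≤r , ≡.subst (_≤ p) d≡r d≤p , ℕP.≤-antisym e≤q (ℕP.m∸n≡0⇒m≤n m≡0) , d≡r)
      conclude (corank1 1+d≡r (inj₂ g+q≡2e)) = inj₂ (inj₁ (2≤r , ≡.subst (_≤ suc p) 1+d≡r (s≤s d≤p) ,
        ≡.subst (q <_) (≡.trans g+q≡2e (≡.cong (e ℕ.+_) (≡.sym (ℕP.+-identityʳ e)))) (ℕP.+-monoˡ-≤ q 1≤g) ,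
        e≤q , rm≤q (ℕP.suc-injective 1+d≡r) , ℕP.suc-injective 1+d≡r))
      -- Here r divides q, so the side condition forces r = 2, and the positive size `suc d` would
      -- have to be 0.
      conclude (corank2 2+d≡r rm≡q _) = contradiction (≡.trans 2+d≡r (divisible side)) λ ()
        where
        divisible : Side p r → r ≡ 2
        divisible (inj₁ r≡2) = r≡2
        divisible (inj₂ r∤q) = contradiction (≡.subst (r ∣_) rm≡q (ℕD.m∣m*n (q ∸ e))) r∤q

    byCases : Dec (e ≤ q) → Dec (suc d ℕ.* q ≤ r ℕ.* e) → InB p r e (suc d)
    byCases (no e≰q)  _           = contradiction (ℕP.≰⇒> e≰q) e≤q-necessary
    byCases (yes e≤q) (no dq≰re)  = contradiction (det-small r d e (ℕP.≰⇒> dq≰re)) det≉0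
    byCases (yes e≤q) (yes dq≤re) = conclude e≤q dq≤re
      (Classification.classify q p-prime 1≤q (q ∸ e) e g (ℕP.m∸n+n≡m e≤q) 1≤g (suc n) (suc d) dq≤re (lead 1≤q e≤q dq≤re))

  -- Makes the exponent g = q - 2 (q - e) of δ positive.
  2m<q : ∀ {e} → q < 2 ℕ.* e → e ≤ q → (q ∸ e) ℕ.+ (q ∸ e) < q
  2m<q {e} q<2e e≤q = ℕP.+-cancelʳ-< (e ℕ.+ e) _ _ (≡.subst (_< q ℕ.+ (e ℕ.+ e)) (≡.sym double)
    (ℕP.+-monoʳ-< q (≡.subst (q <_) (≡.cong (e ℕ.+_) (ℕP.+-identityʳ e)) q<2e)))
    where
    m = q ∸ e
    double : m ℕ.+ m ℕ.+ (e ℕ.+ e) ≡ q ℕ.+ q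
    double = ≡.trans (solve 2 (λ m e → m :+ m :+ (e :+ e) := (m :+ e) :+ (m :+ e)) ≡.refl m e)
      (≡.cong₂ ℕ._+_ (ℕP.m∸n+n≡m e≤q) (ℕP.m∸n+n≡m e≤q))
      where open +-*-Solver

  B⇒A : ∀ r e d → InB p r e d × Side p r → InA p r e d × Side p r
  B⇒A (suc n) e d (inj₁ (2≤r , r≤p , ≡.refl , ≡.refl) , side) =
    (2≤r , 1≤q , s≤s z≤n , r≤p , fromScalar (suc n) q (suc n) q 1≤q
      (Ev.det-hasse-p-1 (suc n) (vars (suc n)) (regular-δ (suc n) id id))) , side
  B⇒A (suc zero) e d (inj₂ (inj₁ (s≤s () , _)) , side)
  B⇒A (suc (suc n)) e d (inj₂ (inj₁ (2≤r , r≤1+p , q<2e , e≤q , rm≤q , ≡.refl)) , side) =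
    (2≤r , 1≤e , s≤s z≤n , ℕP.≤-pred r≤1+p , fromScalar (suc (suc n)) e (suc n) (q ∸ (m ℕ.+ m))
      (ℕP.m<n⇒0<n∸m 2m<)
      (Iteration.det-hasse-δ (PS (suc (suc n))) q p-prime (char (suc (suc n))) (vars (suc (suc n)))
        (regular-δ (suc (suc n)) id id) m e (q ∸ (m ℕ.+ m))
        (ℕP.m+[n∸m]≡n e≤q) (ℕP.m∸n+n≡m (ℕP.<⇒≤ 2m<)) rm≤q)) , side
    where
    m = q ∸ e
    2m< : m ℕ.+ m < q
    2m< = 2m<q q<2e e≤q
    1≤e : 1 ≤ e
    1≤e = positive e q<2e
      where
      positive : ∀ e → q < 2 ℕ.* e → 1 ≤ e
      positive (suc e) _ = s≤s z≤n
  -- For r = 2 the equation of `InB₋` says 2 (q - e) = q, while q < 2 e gives 2 (q - e) < q.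
  B⇒A r e d (inj₂ (inj₂ (2≤r , q<2e , e≤q , rm≡q , d≡)) , inj₁ ≡.refl) =
    contradiction (2m<q q<2e e≤q) (ℕP.≤⇒≯ (ℕP.≤-reflexive (≡.sym (≡.trans (≡.cong ((q ∸ e) ℕ.+_) (≡.sym (ℕP.+-identityʳ (q ∸ e)))) rm≡q))))
  B⇒A r e d (inj₂ (inj₂ (2≤r , q<2e , e≤q , rm≡q , d≡)) , inj₂ r∤q) =
    contradiction (≡.subst (r ∣_) rm≡q (ℕD.m∣m*n (q ∸ e))) r∤q

theorem2 : (p : ℕ) → Prime p → (r e d : ℕ) →
    (InA p r e d × Side p r) ⇔ (InB p r e d × Side p r)
theorem2 zero    p-prime r e d = contradiction p-prime ¬prime[0]
theorem2 (suc q) p-prime r e d = mk⇔ (A⇒B r e d) (B⇒A r e d)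
  where open Conclusion q p-prime
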